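{- Let $\beta>20$ be a constant and let $\Delta$ be such that $L=\log_\beta\Delta$ is an integer with $L>3$. In a dynamic graph $G=(V,E)$ with maximum degree at most $\Delta$ at all times, one can deterministically maintain a level assignment $\ell:V\to\{4,5,\dots,L\}$ such that after every update: (1) every vertex $v$ with $\ell(v)>4$ satisfies $|\mathcal{N}_v(4,\ell(v)-1)|\ge \beta^{\ell(v)-5}$, and (2) every vertex $v$ satisfies $|\mathcal{N}_v(4,\ell(v))|\le \beta^{\ell(v)}$; the amortized update time is $O(\log\Delta)$.
   Context: Dynamic setting: fixed vertex set $V$, the graph starts empty and undergoes edge insertions and deletions, the maximum degree never exceeding the known bound $\Delta$. For a vertex $v$ and levels $4\le i\le j\le L$, $\mathcal{N}_v(i,j)=\{u:(u,v)\in E,\ i\le \ell(u)\le j\}$ is the set of neighbors of $v$ whose level lies between $i$ and $j$ (and $\mathcal{N}_v(i,j)=\emptyset$ if $i>j$). Amortized update time $\alpha$ means the total time of the first $t$ updates is at most $\alpha t$ for all $t$. -}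

module Defs where

import Algebra.Properties.Ring as RingProperties
open import Data.Bool using (Bool; true; false; _∧_; _∨_; not; if_then_else_)
open import Data.Fin using (Fin; toℕ)
import Data.Fin as Fin
open import Data.Fin.Subset using (Subset; ∣_∣)
open import Data.Integer using (+_)
open import Data.List using (List; []; _∷_)
open import Data.Nat as ℕ using (ℕ; zero; suc)
import Data.Nat.Properties as ℕ
open import Data.Product using (∃; _×_; _,_; proj₁; proj₂)
open import Data.Rational as ℚ using (ℚ; 0ℚ; 1ℚ)
import Data.Rational.Properties as ℚ
open import Data.Unit using (⊤)
open import Data.Vec using (tabulate)
open import Relation.Nullary using (does)
open import Relation.Binary.PropositionalEquality
  using (_≡_; _≢_; refl; sym; cong; cong₂; subst)

-- Reals are Cauchy sequences of rationals; their equality is _≃ℝ_.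

Cauchy : (ℕ → ℚ) → Set
Cauchy x = ∀ ε → 0ℚ ℚ.< ε →
  ∃ λ N → ∀ m n → N ℕ.≤ m → N ℕ.≤ n → ℚ.∣ x m ℚ.- x n ∣ ℚ.≤ ε

record ℝ : Set where
  constructor mkℝ
  field
    seq    : ℕ → ℚ
    cauchy : Cauchy seq
open ℝ public

infix 4 _≤ℝ_ _<ℝ_ _≃ℝ_

_≤ℝ_ : ℝ → ℝ → Set
x ≤ℝ y = ∀ ε → 0ℚ ℚ.< ε → ∃ λ N → ∀ n → N ℕ.≤ n → seq x n ℚ.≤ seq y n ℚ.+ ε

_<ℝ_ : ℝ → ℝ → Set
x <ℝ y = ∃ λ ε → 0ℚ ℚ.< ε × ∃ λ N → ∀ n → N ℕ.≤ n → seq x n ℚ.+ ε ℚ.≤ seq y n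

_≃ℝ_ : ℝ → ℝ → Set
x ≃ℝ y = x ≤ℝ y × y ≤ℝ x

fromℚ : ℚ → ℝ
fromℚ q = mkℝ (λ _ → q) λ ε 0<ε → 0 , λ _ _ _ _ →
  subst (ℚ._≤ ε) (cong ℚ.∣_∣ (sym (ℚ.+-inverseʳ q))) (ℚ.<⇒≤ 0<ε)

fromℕ : ℕ → ℝ
fromℕ n = fromℚ (+ n ℚ./ 1)

private
  open ℚ.≤-Reasoning
  open RingProperties ℚ.+-*-ring using (x[y-z]≈xy-xz; [y-z]x≈yx-zx)

  x≡x-y+y : ∀ x y → x ≡ x ℚ.- y ℚ.+ y
  x≡x-y+y x y = sym (begin-equality
    x ℚ.- y ℚ.+ y           ≡⟨ ℚ.+-assoc x (ℚ.- y) y ⟩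
    x ℚ.+ (ℚ.- y ℚ.+ y)     ≡⟨ cong (x ℚ.+_) (ℚ.+-inverseˡ y) ⟩
    x ℚ.+ 0ℚ                ≡⟨ ℚ.+-identityʳ x ⟩
    x                       ∎)

  bounded : ∀ x → Cauchy x → ∃ λ B → ℚ.Positive B × ∃ λ N → ∀ n → N ℕ.≤ n → ℚ.∣ x n ∣ ℚ.≤ B
  bounded x c with c 1ℚ (ℚ.positive⁻¹ 1ℚ)
  ... | N , close = B , B⁺ , N , bound
    where
    B = 1ℚ ℚ.+ ℚ.∣ x N ∣
    B⁺ : ℚ.Positive B
    B⁺ = ℚ.pos+nonNeg⇒pos 1ℚ ℚ.∣ x N ∣ {{ℚ.∣-∣-nonNeg (x N)}}
    bound : ∀ n → N ℕ.≤ n → ℚ.∣ x n ∣ ℚ.≤ B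
    bound n N≤n = begin
      ℚ.∣ x n ∣                           ≡⟨ cong ℚ.∣_∣ (x≡x-y+y (x n) (x N)) ⟩
      ℚ.∣ (x n ℚ.- x N) ℚ.+ x N ∣         ≤⟨ ℚ.∣p+q∣≤∣p∣+∣q∣ (x n ℚ.- x N) (x N) ⟩
      ℚ.∣ x n ℚ.- x N ∣ ℚ.+ ℚ.∣ x N ∣     ≤⟨ ℚ.+-monoˡ-≤ ℚ.∣ x N ∣ (close n N N≤n ℕ.≤-refl) ⟩
      B                                   ∎

  ∣*∣-mono : ∀ a b {A B} → ℚ.NonNegative A → ℚ.∣ a ∣ ℚ.≤ A → ℚ.∣ b ∣ ℚ.≤ B →
             ℚ.∣ a ℚ.* b ∣ ℚ.≤ A ℚ.* B
  ∣*∣-mono a b {A} {B} A⁺ a≤ b≤ = begin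
    ℚ.∣ a ℚ.* b ∣         ≡⟨ ℚ.∣p*q∣≡∣p∣*∣q∣ a b ⟩
    ℚ.∣ a ∣ ℚ.* ℚ.∣ b ∣   ≤⟨ ℚ.*-monoʳ-≤-nonNeg ℚ.∣ b ∣ {{ℚ.∣-∣-nonNeg b}} a≤ ⟩
    A ℚ.* ℚ.∣ b ∣         ≤⟨ ℚ.*-monoˡ-≤-nonNeg A {{A⁺}} b≤ ⟩
    A ℚ.* B               ∎

  *-cauchy : ∀ x y → Cauchy x → Cauchy y → Cauchy (λ n → x n ℚ.* y n)
  *-cauchy x y cx cy ε 0<ε with bounded x cx | bounded y cy
  ... | A , A⁺ , N₁ , x≤A | B , B⁺ , N₂ , y≤B = N , close
    where
    instance
      S⁺ : ℚ.Positive (A ℚ.+ B)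
      S⁺ = ℚ.pos+pos⇒pos A {{A⁺}} B {{B⁺}}
      S≢0 : ℚ.NonZero (A ℚ.+ B)
      S≢0 = ℚ.pos⇒nonZero (A ℚ.+ B)
    i = ℚ.1/ (A ℚ.+ B)
    δ = i ℚ.* ε
    0<δ : 0ℚ ℚ.< δ
    0<δ = ℚ.positive⁻¹ δ {{ℚ.pos*pos⇒pos i {{ℚ.1/pos⇒pos (A ℚ.+ B)}} ε {{ℚ.positive 0<ε}}}}
    N₃ = proj₁ (cx δ 0<δ)
    N₄ = proj₁ (cy δ 0<δ)
    N = (N₁ ℕ.⊔ N₂) ℕ.⊔ (N₃ ℕ.⊔ N₄)
    N₁≤ : N₁ ℕ.≤ N
    N₁≤ = ℕ.≤-trans (ℕ.m≤m⊔n N₁ N₂) (ℕ.m≤m⊔n _ _)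
    N₂≤ : N₂ ℕ.≤ N
    N₂≤ = ℕ.≤-trans (ℕ.m≤n⊔m N₁ N₂) (ℕ.m≤m⊔n _ _)
    N₃≤ : N₃ ℕ.≤ N
    N₃≤ = ℕ.≤-trans (ℕ.m≤m⊔n N₃ N₄) (ℕ.m≤n⊔m (N₁ ℕ.⊔ N₂) _)
    N₄≤ : N₄ ℕ.≤ N
    N₄≤ = ℕ.≤-trans (ℕ.m≤n⊔m N₃ N₄) (ℕ.m≤n⊔m (N₁ ℕ.⊔ N₂) _)
    split : ∀ a b c d → a ℚ.* b ℚ.- c ℚ.* d ≡ a ℚ.* (b ℚ.- d) ℚ.+ d ℚ.* (a ℚ.- c)
    split a b c d = begin-equality
      a ℚ.* b ℚ.- c ℚ.* d
        ≡⟨ cong (ℚ._- c ℚ.* d) (x≡x-y+y (a ℚ.* b) (a ℚ.* d)) ⟩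
      a ℚ.* b ℚ.- a ℚ.* d ℚ.+ a ℚ.* d ℚ.- c ℚ.* d
        ≡⟨ ℚ.+-assoc (a ℚ.* b ℚ.- a ℚ.* d) (a ℚ.* d) (ℚ.- (c ℚ.* d)) ⟩
      (a ℚ.* b ℚ.- a ℚ.* d) ℚ.+ (a ℚ.* d ℚ.- c ℚ.* d)
        ≡⟨ cong₂ ℚ._+_ (x[y-z]≈xy-xz a b d) ([y-z]x≈yx-zx d a c) ⟨
      a ℚ.* (b ℚ.- d) ℚ.+ (a ℚ.- c) ℚ.* d
        ≡⟨ cong (a ℚ.* (b ℚ.- d) ℚ.+_) (ℚ.*-comm (a ℚ.- c) d) ⟩
      a ℚ.* (b ℚ.- d) ℚ.+ d ℚ.* (a ℚ.- c) ∎
    collect : A ℚ.* δ ℚ.+ B ℚ.* δ ≡ ε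
    collect = begin-equality
      A ℚ.* δ ℚ.+ B ℚ.* δ         ≡⟨ sym (ℚ.*-distribʳ-+ δ A B) ⟩
      (A ℚ.+ B) ℚ.* (i ℚ.* ε)     ≡⟨ sym (ℚ.*-assoc (A ℚ.+ B) i ε) ⟩
      ((A ℚ.+ B) ℚ.* i) ℚ.* ε     ≡⟨ cong (ℚ._* ε) (ℚ.*-inverseʳ (A ℚ.+ B)) ⟩
      1ℚ ℚ.* ε                    ≡⟨ ℚ.*-identityˡ ε ⟩
      ε                           ∎
    close : ∀ m n → N ℕ.≤ m → N ℕ.≤ n → ℚ.∣ x m ℚ.* y m ℚ.- x n ℚ.* y n ∣ ℚ.≤ ε
    close m n N≤m N≤n = begin
      ℚ.∣ x m ℚ.* y m ℚ.- x n ℚ.* y n ∣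
        ≡⟨ cong ℚ.∣_∣ (split (x m) (y m) (x n) (y n)) ⟩
      ℚ.∣ x m ℚ.* (y m ℚ.- y n) ℚ.+ y n ℚ.* (x m ℚ.- x n) ∣
        ≤⟨ ℚ.∣p+q∣≤∣p∣+∣q∣ (x m ℚ.* (y m ℚ.- y n)) (y n ℚ.* (x m ℚ.- x n)) ⟩
      ℚ.∣ x m ℚ.* (y m ℚ.- y n) ∣ ℚ.+ ℚ.∣ y n ℚ.* (x m ℚ.- x n) ∣
        ≤⟨ ℚ.+-mono-≤
             (∣*∣-mono (x m) (y m ℚ.- y n) (ℚ.pos⇒nonNeg A {{A⁺}})
               (x≤A m (ℕ.≤-trans N₁≤ N≤m))
               (proj₂ (cy δ 0<δ) m n (ℕ.≤-trans N₄≤ N≤m) (ℕ.≤-trans N₄≤ N≤n)))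
             (∣*∣-mono (y n) (x m ℚ.- x n) (ℚ.pos⇒nonNeg B {{B⁺}})
               (y≤B n (ℕ.≤-trans N₂≤ N≤n))
               (proj₂ (cx δ 0<δ) m n (ℕ.≤-trans N₃≤ N≤m) (ℕ.≤-trans N₃≤ N≤n))) ⟩
      A ℚ.* δ ℚ.+ B ℚ.* δ
        ≡⟨ collect ⟩
      ε ∎

infixl 7 _*ℝ_
infixr 8 _^ℝ_

_*ℝ_ : ℝ → ℝ → ℝ
x *ℝ y = mkℝ (λ n → seq x n ℚ.* seq y n) (*-cauchy (seq x) (seq y) (cauchy x) (cauchy y))

_^ℝ_ : ℝ → ℕ → ℝ
x ^ℝ zero  = fromℕ 1
x ^ℝ suc k = x *ℝ (x ^ℝ k)

Graph : ℕ → Set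
Graph n = Fin n → Fin n → Bool

data Update (n : ℕ) : Set where
  insert delete : (u v : Fin n) → Update n

joins : ∀ {n} → Fin n → Fin n → Graph n
joins u v x y = (does (x Fin.≟ u) ∧ does (y Fin.≟ v)) ∨ (does (x Fin.≟ v) ∧ does (y Fin.≟ u))

apply : ∀ {n} → Update n → Graph n → Graph n
apply (insert u v) G x y = joins u v x y ∨ G x y
apply (delete u v) G x y = not (joins u v x y) ∧ G x y

-- Update sequences are lists with the most recent update first.
graph : ∀ {n} → List (Update n) → Graph n
graph []       = λ _ _ → false
graph (e ∷ es) = apply e (graph es)

degree : ∀ {n} → Graph n → Fin n → ℕ
degree G v = ∣ tabulate (λ u → G u v) ∣

Admissible : ∀ {n} → Graph n → Update n → Set
Admissible G (insert u v) = u ≢ v × G u v ≡ false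
Admissible G (delete u v) = G u v ≡ true

Legal : ∀ {n} → ℕ → List (Update n) → Set
Legal Δ []       = ⊤
Legal Δ (e ∷ es) =
  Legal Δ es × Admissible (graph es) e × (∀ v → degree (graph (e ∷ es)) v ℕ.≤ Δ)

𝒩 : ∀ {n} → Graph n → (Fin n → ℕ) → Fin n → ℕ → ℕ → Subset n
𝒩 G ℓ v i j = tabulate λ u → G u v ∧ (i ℕ.≤ᵇ ℓ u) ∧ (ℓ u ℕ.≤ᵇ j)

record ValidLevels {n} (β : ℝ) (L : ℕ) (G : Graph n) (ℓ : Fin n → ℕ) : Set where
  field
    range : ∀ v → 4 ℕ.≤ ℓ v × ℓ v ℕ.≤ L
    lower : ∀ v → 4 ℕ.< ℓ v → β ^ℝ (ℓ v ℕ.∸ 5) ≤ℝ fromℕ ∣ 𝒩 G ℓ v 4 (ℓ v ℕ.∸ 1) ∣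
    upper : ∀ v → fromℕ ∣ 𝒩 G ℓ v 4 (ℓ v) ∣ ≤ℝ β ^ℝ (ℓ v)

-- Programs are run on a deterministic word RAM.  The memory is organised as named arrays of words;
-- a program mentions only finitely many names, so interleaving the arrays
-- gives an ordinary single-memory RAM with constant overhead.

Store : Set
Store = ℕ → ℕ → ℕ

_[_,_↦_] : Store → ℕ → ℕ → ℕ → Store
(s [ a , i ↦ w ]) b j = if does (b ℕ.≟ a) ∧ does (j ℕ.≟ i) then w else s b j

data Op : Set where
  plus monus times leq : Op

⟦_⟧ : Op → ℕ → ℕ → ℕ
⟦ plus  ⟧ x y = x ℕ.+ y
⟦ monus ⟧ x y = x ℕ.∸ y
⟦ times ⟧ x y = x ℕ.* y
⟦ leq   ⟧ x y = if x ℕ.≤ᵇ y then 1 else 0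

data Exp : Set where
  lit   : ℕ → Exp
  read  : (array : ℕ) (index : Exp) → Exp
  binop : Op → Exp → Exp → Exp

eval : Exp → Store → ℕ
eval (lit c)       s = c
eval (read a e)    s = s a (eval e s)
eval (binop o e f) s = ⟦ o ⟧ (eval e s) (eval f s)

-- Every word (addresses included) arising in the evaluation is below W.
Fits : ℕ → Exp → Store → Set
Fits W e@(lit _)       s = eval e s ℕ.< W
Fits W e@(read _ i)    s = eval e s ℕ.< W × Fits W i s
Fits W e@(binop _ f g) s = eval e s ℕ.< W × Fits W f s × Fits W g s

cost : Exp → ℕ
cost (lit _)       = 1
cost (read _ e)    = suc (cost e)
cost (binop _ e f) = suc (cost e ℕ.+ cost f)

infixr 5 _⨾_

data Cmd : Set where
  skip  : Cmd
  write : (array : ℕ) (index value : Exp) → Cmd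
  _⨾_   : Cmd → Cmd → Cmd
  cond  : Exp → Cmd → Cmd → Cmd
  while : Exp → Cmd → Cmd

-- Exec W c s s' t: with words below W, c takes store s to store s' in time t.
-- A word overflow leaves the command without a result.
data Exec (W : ℕ) : Cmd → Store → Store → ℕ → Set where
  skip  : ∀ {s} → Exec W skip s s 1
  write : ∀ {a i e s} → Fits W i s → Fits W e s →
          Exec W (write a i e) s (s [ a , eval i s ↦ eval e s ]) (suc (cost i ℕ.+ cost e))
  _⨾_   : ∀ {c d s s' s'' t t'} → Exec W c s s' t → Exec W d s' s'' t' →
          Exec W (c ⨾ d) s s'' (suc (t ℕ.+ t'))
  cond-true   : ∀ {e c d s s' t} → Fits W e s → eval e s ≢ 0 → Exec W c s s' t →
                Exec W (cond e c d) s s' (suc (cost e ℕ.+ t))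
  cond-false  : ∀ {e c d s s' t} → Fits W e s → eval e s ≡ 0 → Exec W d s s' t →
                Exec W (cond e c d) s s' (suc (cost e ℕ.+ t))
  while-true  : ∀ {e c s s' s'' t t'} → Fits W e s → eval e s ≢ 0 →
                Exec W c s s' t → Exec W (while e c) s' s'' t' →
                Exec W (while e c) s s'' (suc (cost e ℕ.+ t ℕ.+ t'))
  while-false : ∀ {e c s} → Fits W e s → eval e s ≡ 0 →
                Exec W (while e c) s s (suc (cost e))

params floors ceilings arguments levels : ℕ
params    = 0
floors    = 1
ceilings  = 2
arguments = 3
levels    = 4

-- The level assignment is maintained explicitly, one array cell per vertex.
levelOf : ∀ {n} → Store → Fin n → ℕ
levelOf s v = s levels (toℕ v)

-- The memory before the first update: the known parameters, the real constant
-- β being presented by the integer roundings of β⁰, …, β^L; the constant level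
-- assignment 4; and zeros.
record Initial (β : ℝ) (Δ L n : ℕ) (s : Store) : Set where
  field
    size     : s params 0 ≡ n
    bound    : s params 1 ≡ Δ
    top      : s params 2 ≡ L
    floor    : ∀ k → k ℕ.≤ L →
               fromℕ (s floors k) ≤ℝ β ^ℝ k × β ^ℝ k <ℝ fromℕ (suc (s floors k))
    ceiling  : ∀ k → k ℕ.≤ L →
               β ^ℝ k ≤ℝ fromℕ (s ceilings k) × fromℕ (ℕ.pred (s ceilings k)) <ℝ β ^ℝ k
    initial  : ∀ v → s levels v ≡ 4
    params₀  : ∀ i → 2 ℕ.< i → s params i ≡ 0
    floors₀  : ∀ k → L ℕ.< k → s floors k ≡ 0
    ceil₀    : ∀ k → L ℕ.< k → s ceilings k ≡ 0
    args₀    : ∀ i → s arguments i ≡ 0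
    rest₀    : ∀ a i → levels ℕ.< a → s a i ≡ 0

record Algorithm : Set where
  field
    onInsert onDelete : Cmd
open Algorithm public

handler : ∀ {n} → Algorithm → Update n → Cmd
handler A (insert _ _) = onInsert A
handler A (delete _ _) = onDelete A

supply : ∀ {n} → Update n → Store → Store
supply (insert u v) s = (s [ arguments , 0 ↦ toℕ u ]) [ arguments , 1 ↦ toℕ v ]
supply (delete u v) s = (s [ arguments , 0 ↦ toℕ u ]) [ arguments , 1 ↦ toℕ v ]

-- Run A W s₀ es s T: processing the updates es (most recent first) one after
-- another from store s₀ leads to store s in total time T.
data Run {n} (A : Algorithm) (W : ℕ) (s₀ : Store) : List (Update n) → Store → ℕ → Set where
  []   : Run A W s₀ [] s₀ 0
  step : ∀ {e es s s' T t} → Run A W s₀ es s T → Exec W (handler A e) (supply e s) s' t →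
         Run A W s₀ (e ∷ es) s' (T ℕ.+ t)

{-# OPTIONS --safe #-}
module Submission where

-- A vertex is dirty when it violates one of the two conditions; a stack holds all dirty vertices.  The vertex v on top
-- of it is treated as follows: if it is overcrowded, it climbs to the lowest level k with |𝒩_v(4,k)| ≤ β^k, if it is
-- sparse, it drops by one level, and otherwise it is popped.  Time is paid from the potential
--   c · Σ_{(u,v) ∈ E} (L − max(ℓ(u), ℓ(v)))  +  α · Σ_{ℓ(v) > 4} max(0, β^{ℓ(v)−1} − |𝒩_v(4,ℓ(v)−1)|),
-- which an update increases by O(L).  A climb to k costs O(β^k); it releases the first sum at the more than β^{k−1}
-- neighbours below level k, and leaves v without slack.  A drop from level i costs O(β^i); it releases about β^{i−1} of
-- the slack of v, and only the fewer than β^{i−5} edges to lower vertices gain potential.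
-- As β^L = Δ is an integer, ⌊β^k⌋ and ⌈β^k⌉ are integer L-th roots of Δ^k, so they can be computed although β is
-- only given by a Cauchy sequence.

open import Algebra.Bundles using (module CommutativeRing)
open import Data.Bool using (Bool; true; false; _∧_; _∨_; not; if_then_else_; T)
open import Data.Bool.Properties using (∧-comm; ∨-comm; ∧-zeroʳ)
open import Data.Empty using (⊥-elim)
open import Data.Fin as Fin using (Fin; toℕ; zero; suc)
import Data.Fin.Properties as Fin
open import Data.Fin.Subset using (∣_∣)
import Data.Integer as ℤ
import Data.Integer.Properties as ℤ
open import Data.List using (List; []; _∷_; _++_; length)
open import Data.List.Membership.Propositional using (_∈_; _∉_)
open import Data.List.Membership.Propositional.Properties using (∈-++⁻; ∈-++⁺ˡ; ∈-++⁺ʳ)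
open import Data.List.Properties using (length-++; ++-assoc)
open import Data.List.Relation.Unary.All as All using (_∷_)
open import Data.List.Relation.Unary.AllPairs using ([]; _∷_)
open import Data.List.Relation.Unary.Any using (here; there)
open import Data.List.Relation.Unary.Unique.Propositional using (Unique)
open import Data.List.Relation.Unary.Unique.Propositional.Properties using (++⁺)
open import Data.Nat using (ℕ; zero; suc; pred; _+_; _*_; _∸_; _^_; _≤_; _<_; _⊔_; _≤ᵇ_; _≡ᵇ_; z≤n; s≤s; NonZero; >-nonZero)
import Data.Nat.Coprimality as Coprimality
open import Data.Nat.Induction using (<-wellFounded)
open import Data.Nat.Logarithm using (⌊log₂_⌋; ⌊log₂⌋-mono-≤; ⌊log₂[2^n]⌋≡n)
open import Data.Nat.Properties
open import Data.Nat.Tactic.RingSolver using (solve-∀)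
open import Data.Product using (∃; ∃-syntax; _×_; _,_; proj₁; proj₂)
open import Data.Rational as ℚ using (ℚ; mkℚ; 0ℚ; 1ℚ; ½)
import Data.Rational.Properties as ℚ
open import Data.Sum using (_⊎_; inj₁; inj₂; [_,_]′)
open import Data.Unit using (⊤; tt)
import Data.Vec as Vec
open import Defs
open import Function using (_∘_; id)
open import Induction.WellFounded using (Acc; acc)
open import Relation.Binary.Definitions using (tri<; tri≈; tri>)
open import Relation.Binary.PropositionalEquality
  using (_≡_; _≢_; refl; sym; trans; cong; cong₂; subst; subst₂; module ≡-Reasoning)
open import Relation.Nullary using (¬_; Dec; yes; no; does; contradiction)
open import Algebra.Properties.CommutativeMonoid.Sum +-0-commutativeMonoid
  using () renaming (sum to ∑; sum-cong-≗ to ∑-cong; ∑-distrib-+ to ∑-+)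
import Algebra.Properties.Semiring.Exp (CommutativeRing.semiring ℚ.+-*-commutativeRing) as Power

-- Finite sums and cardinalities

-- The constants are fixed in the order `w`, `α`, `c`. A climb that releases `D⁻` edges may give a
-- unit of slack to as many as `b * D⁻` neighbours, so `c` has to exceed `α` by a factor of about β.
-- A drop from level i then raises fewer than β^(i-5) edges by an amount of order `c`, about
-- α·β^(i-4) in all, against a released slack of order α·β^(i-1). This is the reason why the
-- threshold of the slack lies four powers of β above the point where condition (1) fails. Taking
-- the maximum in the weight of an edge confines the effect of a move of v to the neighbours up to
-- the larger of its two levels. The table of neighbours mirrors this: a vertex does not distinguish
-- its lower neighbours, so the rows of higher neighbours stay as they are. The stack may hold
-- repetitions, but every entry is prepaid, so its length is at most the stock of credits, which the
-- potential bounds by a polynomial in n + Δ; hence all words fit. The constant of the time bound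
-- must not depend on Δ, so `b` is finally replaced by a natural number that bounds β.

suc-∸1 : ∀ {k m} → k < m → suc (m ∸ 1) ≡ m
suc-∸1 (s≤s _) = refl

bit : Bool → ℕ
bit true  = 1
bit false = 0

at : ∀ {n} → Fin n → ℕ → Fin n → ℕ
at v c x = if does (x Fin.≟ v) then c else 0

abstract
  sum : ∀ {n} → (Fin n → ℕ) → ℕ
  sum = ∑

  sum-cong-≗ : ∀ {n} {f g : Fin n → ℕ} → (∀ x → f x ≡ g x) → sum f ≡ sum g
  sum-cong-≗ = ∑-cong

  ∑-distrib-+ : ∀ {n} (f g : Fin n → ℕ) → sum (λ x → f x + g x) ≡ sum f + sum g
  ∑-distrib-+ = ∑-+

  sum-mono : ∀ {n} {f g : Fin n → ℕ} → (∀ x → f x ≤ g x) → sum f ≤ sum g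
  sum-mono {zero}  le = z≤n
  sum-mono {suc n} le = +-mono-≤ (le zero) (sum-mono (le ∘ suc))

  sum-≤-const : ∀ {n} {f : Fin n → ℕ} c → (∀ x → f x ≤ c) → sum f ≤ n * c
  sum-≤-const {zero}  c le = z≤n
  sum-≤-const {suc n} c le = +-mono-≤ (le zero) (sum-≤-const c (le ∘ suc))

  sum-zero : ∀ {n} {f : Fin n → ℕ} → (∀ x → f x ≡ 0) → sum f ≡ 0
  sum-zero {zero}  z = refl
  sum-zero {suc n} z = cong₂ _+_ (z zero) (sum-zero (z ∘ suc))

  sum-at : ∀ {n} (v : Fin n) c → sum (at v c) ≡ c
  sum-at {suc n} zero c = trans (cong (c +_) (sum-zero {n} {λ x → at (suc {n} x) c zero} λ _ → refl)) (+-identityʳ c)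
  sum-at (suc v) c = trans (sum-cong-≗ {f = λ x → at (suc v) c (suc x)} {g = at v c} λ _ → refl) (sum-at v c)

  card : ∀ {n} (f : Fin n → Bool) → ∣ Vec.tabulate f ∣ ≡ sum (λ x → bit (f x))
  card {zero}  f = refl
  card {suc n} f with f zero
  ... | true  = cong suc (card (f ∘ suc))
  ... | false = card (f ∘ suc)

sum-≤-+ : ∀ {n} {f g h : Fin n → ℕ} → (∀ x → f x ≤ g x + h x) → sum f ≤ sum g + sum h
sum-≤-+ {g = g} {h} le = ≤-trans (sum-mono le) (≤-reflexive (∑-distrib-+ g h))

sum-+-≤ : ∀ {n} {f g h : Fin n → ℕ} → (∀ x → f x + g x ≤ h x) → sum f + sum g ≤ sum h
sum-+-≤ {f = f} {g} le = ≤-trans (≤-reflexive (sym (∑-distrib-+ f g))) (sum-mono le)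

at-same : ∀ {n} (v : Fin n) c → at v c v ≡ c
at-same v c with v Fin.≟ v
... | yes _  = refl
... | no v≢v = contradiction refl v≢v

# : ∀ {n} → (Fin n → Bool) → ℕ
# f = sum λ x → bit (f x)

-- Links the lists that the program collects to the cardinalities in the invariants. Induction on
-- the list: `f'` is `f` with the head `y` taken out, and the indicator of `f` is that of `f'` plus
-- a unit at `y`.
unique-# : ∀ {n} (f : Fin n → Bool) ys → Unique ys → (∀ {y} → y ∈ ys → f y ≡ true) →
           (∀ {y} → f y ≡ true → y ∈ ys) → length ys ≡ # f
unique-# f [] _ _ all = sym (sum-zero λ x → none x (f x) refl)
  where
  none : ∀ x c → f x ≡ c → bit c ≡ 0
  none x false _ = refl
  none x true  e = contradiction (all e) λ ()
unique-# f (y ∷ ys) (y∉ ∷ uniq) sound all = begin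
  suc (length ys)                      ≡⟨ cong suc (unique-# f' ys uniq sound' all') ⟩
  suc (# f')                           ≡⟨ +-comm 1 (# f') ⟩
  # f' + 1                             ≡⟨ cong (# f' +_) (sym (sum-at y 1)) ⟩
  # f' + sum (at y 1)                  ≡⟨ sym (∑-distrib-+ (bit ∘ f') (at y 1)) ⟩
  sum (λ x → bit (f' x) + at y 1 x)    ≡⟨ sum-cong-≗ split ⟩
  # f                                  ∎
  where
  open ≡-Reasoning
  f' = λ x → f x ∧ not (does (x Fin.≟ y))
  sound' : ∀ {x} → x ∈ ys → f' x ≡ true
  sound' {x} x∈ with x Fin.≟ y
  ... | yes refl = contradiction refl (All.lookup y∉ x∈)
  ... | no _ with f x | sound (there x∈)
  ... | true | _ = refl
  all' : ∀ {x} → f' x ≡ true → x ∈ ys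
  all' {x} e with x Fin.≟ y | f x | all {x}
  ... | no x≢y | true | a with a refl
  ... | here x≡y = contradiction x≡y x≢y
  ... | there x∈ = x∈
  split : ∀ x → bit (f' x) + at y 1 x ≡ bit (f x)
  split x with x Fin.≟ y
  ... | yes refl rewrite sound (here refl) = refl
  ... | no _ with f x
  ... | true  = refl
  ... | false = refl

#-≤ : ∀ {n} (f : Fin n → Bool) → # f ≤ n
#-≤ {n} f = ≤-trans (sum-≤-const 1 (bit≤1 ∘ f)) (≤-reflexive (*-identityʳ n))
  where
  bit≤1 : ∀ c → bit c ≤ 1
  bit≤1 true  = ≤-refl
  bit≤1 false = z≤n

-- The potential

sum-at-row : ∀ {n} (u : Fin n) (g : Fin n → ℕ) x → sum (λ y → at u (g y) x) ≡ at u (sum g) x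
sum-at-row u g x with x Fin.≟ u
... | yes _ = refl
... | no _  = sum-zero λ _ → refl

∧⁻ : ∀ {p q} → p ∧ q ≡ true → p ≡ true × q ≡ true
∧⁻ {true} e = refl , e

∧⁺ : ∀ {p q} → p ≡ true → q ≡ true → p ∧ q ≡ true
∧⁺ refl refl = refl

≤ᵇ⁻ : ∀ {a b} → (a ≤ᵇ b) ≡ true → a ≤ b
≤ᵇ⁻ {a} {b} e = ≤ᵇ⇒≤ a b (subst T (sym e) tt)

≤ᵇ⁺ : ∀ {a b} → a ≤ b → (a ≤ᵇ b) ≡ true
≤ᵇ⁺ {a} {b} a≤b with a ≤ᵇ b | ≤⇒≤ᵇ a≤b
... | true | _ = refl

≤ᵇ-false : ∀ {a b} → b < a → (a ≤ᵇ b) ≡ false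
≤ᵇ-false {a} {b} b<a with a ≤ᵇ b in e
... | false = refl
... | true  = contradiction (≤ᵇ⁻ e) (<⇒≱ b<a)

bit-≤ : ∀ p {q r} → (p ≡ true → q ≡ true ⊎ 1 ≤ r) → bit p ≤ bit q + r
bit-≤ false h = z≤n
bit-≤ true {q} h with h refl
... | inj₁ refl = s≤s z≤n
... | inj₂ 1≤r  = ≤-trans 1≤r (m≤n+m _ (bit q))

bit-* : ∀ p {q m m' r} → (p ≡ true → m ≤ bit q * m' + r) → bit p * m ≤ bit q * m' + r
bit-* false h = z≤n
bit-* true {m = m} h = ≤-trans (≤-reflexive (+-identityʳ m)) (h refl)

-- This is the size of 𝒩_v(4,j): the lower limit 4 can be left out because no level is below 4.
deg : ∀ {n} → Graph n → (Fin n → ℕ) → Fin n → ℕ → ℕ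
deg G ℓ v j = # λ u → G u v ∧ (ℓ u ≤ᵇ j)

-- `r` marks the neighbours that may be lost in passing from `G`, `ℓ`, `j` to `G'`, `ℓ'`, `j'`.
deg-≤ : ∀ {n} {G G' : Graph n} {ℓ ℓ' : Fin n → ℕ} {x j j'} (r : Fin n → ℕ) →
        (∀ y → G y x ≡ true → ℓ y ≤ j → (G' y x ≡ true × ℓ' y ≤ j') ⊎ 1 ≤ r y) →
        deg G ℓ x j ≤ deg G' ℓ' x j' + sum r
deg-≤ {G = G} {G'} {ℓ} {ℓ'} {x} {j} {j'} r h = sum-≤-+ {h = r} λ y → bit-≤ (G y x ∧ (ℓ y ≤ᵇ j)) λ e →
  [ (λ { (g , le) → inj₁ (∧⁺ g (≤ᵇ⁺ le)) }) , inj₂ ]′ (h y (proj₁ (∧⁻ e)) (≤ᵇ⁻ (proj₂ (∧⁻ e))))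

deg-mono : ∀ {n} {G G' : Graph n} {ℓ ℓ' : Fin n → ℕ} {x j j'} →
           (∀ y → G y x ≡ true → ℓ y ≤ j → G' y x ≡ true × ℓ' y ≤ j') → deg G ℓ x j ≤ deg G' ℓ' x j'
deg-mono {n} {G} {G'} {ℓ} {ℓ'} {x} {j} {j'} h = ≤-trans (deg-≤ {n} {G} {G'} {ℓ} {ℓ'} (λ _ → 0) λ y g le → inj₁ (h y g le))
  (≤-reflexive (trans (cong (deg G' ℓ' x j' +_) (sum-zero {n} λ _ → refl)) (+-identityʳ _)))

-- What the analysis knows about F k = ⌊β^k⌋ and C k = ⌈β^k⌉, as inequalities between naturals, so
-- that no real number enters the potential argument. `F-ratio` carries β > 20, `F-lower` and
-- `F-upper` are multiplicativity up to rounding with `F 1` in the place of β, and `F-top` carries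
-- β^L = Δ.
record Thresholds (Δ L : ℕ) (F C : ℕ → ℕ) : Set where
  field
    F-zero  : 1 ≤ F 0
    F-ratio : ∀ k → 20 * F k ≤ F (suc k)
    F-lower : ∀ k → F 1 * F k ≤ F (suc k)
    F-upper : ∀ k → F (suc k) ≤ suc (F 1) * suc (F k)
    C-upper : ∀ k → C k ≤ suc (F k)
    F-top   : Δ ≤ F L
    F-bound : ∀ k → k ≤ L → F k ≤ Δ

record Simple {n} (G : Graph n) : Set where
  field
    symmetric   : ∀ x y → G x y ≡ G y x
    irreflexive : ∀ x → G x x ≡ false

module Potential {Δ L F C} (th : Thresholds Δ L F C) (w : ℕ) where
  open Thresholds th

  -- b exceeds β; α lets the slack of a sparse vertex pay for its drop, and c lets the edges to the lower
  -- neighbours of an overcrowded vertex pay for its climb.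
  b α c : ℕ
  b = suc (F 1)
  α = 16 * w * b
  c = (α + w) * b + 3 * w

  -- Condition (1) demands nothing at level 4, so no slack is counted there; in particular the
  -- initial assignment has potential 0.
  threshold : ℕ → ℕ
  threshold j = if j ≤ᵇ 4 then 0 else F (j ∸ 1)

  F-positive : ∀ k → 1 ≤ F k
  F-positive zero    = F-zero
  F-positive (suc k) = ≤-trans (F-positive k) (≤-trans (m≤n*m (F k) 20) (F-ratio k))

  k<F : ∀ k → k ≤ F k
  k<F zero    = z≤n
  k<F (suc k) = begin
    suc k          ≡⟨ +-comm 1 k ⟩
    k + 1          ≤⟨ +-mono-≤ (k<F k) (≤-trans (F-positive k) (m≤m+n _ _)) ⟩
    20 * F k       ≤⟨ F-ratio k ⟩
    F (suc k)      ∎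
    where open ≤-Reasoning

  threshold-≤ : ∀ j → 5 ≤ j → threshold j ≡ F (j ∸ 1)
  threshold-≤ j 5≤j rewrite ≤ᵇ-false 5≤j = refl

  threshold-suc : ∀ j → threshold (suc j) ≤ F j
  threshold-suc j with suc j ≤ᵇ 4
  ... | true  = z≤n
  ... | false = ≤-refl

  threshold-bound : ∀ j → j ≤ L → threshold j ≤ Δ
  threshold-bound j j≤L with j ≤ᵇ 4
  ... | true  = z≤n
  ... | false = F-bound (j ∸ 1) (≤-trans (m∸n≤m j 1) j≤L)

  module _ {n : ℕ} where

    weight : Graph n → (Fin n → ℕ) → Fin n → Fin n → ℕ
    weight G ℓ x y = bit (G x y) * (L ∸ (ℓ x ⊔ ℓ y))

    -- The sum runs over ordered pairs, so each edge counts twice: hence `L + L` for an insertion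
    -- and `2 * low` for a drop.
    weights : Graph n → (Fin n → ℕ) → ℕ
    weights G ℓ = sum λ x → sum λ y → weight G ℓ x y

    slack : Graph n → (Fin n → ℕ) → Fin n → ℕ
    slack G ℓ x = threshold (ℓ x) ∸ deg G ℓ x (ℓ x ∸ 1)

    Φ : Graph n → (Fin n → ℕ) → ℕ
    Φ G ℓ = c * weights G ℓ + α * sum (slack G ℓ)

    -- Needed for the word size: the credits bound the height of the stack, and this bounds the
    -- credits.
    Φ-bound : ∀ G ℓ → (∀ x → ℓ x ≤ L) → Φ G ℓ ≤ c * (n * (n * L)) + α * (n * Δ)
    Φ-bound G ℓ ℓ≤L = +-mono-≤
      (*-monoʳ-≤ c (sum-≤-const (n * L) λ x → sum-≤-const L λ y → ≤-trans (bit*≤ (G x y)) (m∸n≤m L (ℓ x ⊔ ℓ y))))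
      (*-monoʳ-≤ α (sum-≤-const Δ λ x → ≤-trans (m∸n≤m _ (deg G ℓ x (ℓ x ∸ 1))) (threshold-bound (ℓ x) (ℓ≤L x))))
      where
      bit*≤ : ∀ p {m} → bit p * m ≤ m
      bit*≤ true  = ≤-reflexive (+-identityʳ _)
      bit*≤ false = z≤n

    Φ-empty : Φ (λ _ _ → false) (λ _ → 4) ≡ 0
    Φ-empty = cong₂ _+_
      (trans (cong (c *_) (sum-zero {n} λ _ → sum-zero {n} λ _ → refl)) (*-zeroʳ c))
      (trans (cong (α *_) (sum-zero {n} λ x → 0∸n≡0 (deg {n} (λ _ _ → false) (λ _ → 4) x 3))) (*-zeroʳ α))

    Φ-mono : ∀ {G G' ℓ ℓ'} {d e : ℕ} → weights G' ℓ' ≤ weights G ℓ + d → sum (slack G' ℓ') ≤ sum (slack G ℓ) + e →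
             Φ G' ℓ' ≤ Φ G ℓ + (c * d + α * e)
    Φ-mono {G} {G'} {ℓ} {ℓ'} {d} {e} w≤ s≤ = begin
      c * weights G' ℓ' + α * sum (slack G' ℓ')              ≤⟨ +-mono-≤ (*-monoʳ-≤ c w≤) (*-monoʳ-≤ α s≤) ⟩
      c * (weights G ℓ + d) + α * (sum (slack G ℓ) + e)      ≡⟨ lem c α (weights G ℓ) d (sum (slack G ℓ)) e ⟩
      Φ G ℓ + (c * d + α * e)                                ∎
      where
      open ≤-Reasoning
      lem : ∀ c α a d s e → c * (a + d) + α * (s + e) ≡ (c * a + α * s) + (c * d + α * e)
      lem = solve-∀

    slack-mono : ∀ {G G' ℓ ℓ'} x {r} → threshold (ℓ' x) ≤ threshold (ℓ x) →
                 deg G ℓ x (ℓ x ∸ 1) ≤ deg G' ℓ' x (ℓ' x ∸ 1) + r → slack G' ℓ' x ≤ slack G ℓ x + r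
    slack-mono {G} {G'} {ℓ} {ℓ'} x {r} t≤ d≤ = m≤n+o⇒m∸n≤o (threshold (ℓ' x)) (deg G' ℓ' x (ℓ' x ∸ 1)) (begin
      threshold (ℓ' x)                                              ≤⟨ t≤ ⟩
      threshold (ℓ x)                                               ≤⟨ m≤n+m∸n (threshold (ℓ x)) (deg G ℓ x (ℓ x ∸ 1)) ⟩
      deg G ℓ x (ℓ x ∸ 1) + slack G ℓ x                             ≤⟨ +-monoˡ-≤ _ d≤ ⟩
      deg G' ℓ' x (ℓ' x ∸ 1) + r + slack G ℓ x                      ≡⟨ +-assoc (deg G' ℓ' x (ℓ' x ∸ 1)) r _ ⟩
      deg G' ℓ' x (ℓ' x ∸ 1) + (r + slack G ℓ x)                    ≡⟨ cong (deg G' ℓ' x (ℓ' x ∸ 1) +_) (+-comm r _) ⟩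
      deg G' ℓ' x (ℓ' x ∸ 1) + (slack G ℓ x + r)                    ∎)
      where open ≤-Reasoning

    private
      joins⁻ : ∀ (u v x y : Fin n) → joins u v x y ≡ true → (x ≡ u × y ≡ v) ⊎ (x ≡ v × y ≡ u)
      joins⁻ u v x y e with x Fin.≟ u | y Fin.≟ v | x Fin.≟ v | y Fin.≟ u
      ... | yes a | yes b | _     | _     = inj₁ (a , b)
      ... | yes a | no b  | yes c | yes d = inj₂ (c , d)
      ... | no a  | _     | yes c | yes d = inj₂ (c , d)

      both : ℕ → Fin n → Fin n → Fin n → Fin n → ℕ
      both m u v x y = at u (at v m y) x + at v (at u m y) x

      joins-both : ∀ m u v x y → joins u v x y ≡ true → m ≤ both m u v x y
      joins-both m u v x y e with joins⁻ u v x y e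
      ... | inj₁ (refl , refl) = ≤-trans (≤-reflexive (sym (trans (at-same u _) (at-same v m)))) (m≤m+n _ _)
      ... | inj₂ (refl , refl) = ≤-trans (≤-reflexive (sym (trans (at-same v _) (at-same u m)))) (m≤n+m _ (at u _ x))

      sum-both : ∀ m u v → sum (λ x → sum (both m u v x)) ≡ m + m
      sum-both m u v = trans (sum-cong-≗ λ x → trans (∑-distrib-+ (λ y → at u (at v m y) x) (λ y → at v (at u m y) x))
          (cong₂ _+_ (trans (sum-at-row u (at v m) x) (cong (λ z → at u z x) (sum-at v m)))
                     (trans (sum-at-row v (at u m) x) (cong (λ z → at v z x) (sum-at u m)))))
        (trans (∑-distrib-+ (at u m) (at v m)) (cong₂ _+_ (sum-at u m) (sum-at v m)))

      sum-column : ∀ u v x → sum (λ y → both 1 u v y x) ≡ at v 1 x + at u 1 x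
      sum-column u v x = trans (∑-distrib-+ (at u (at v 1 x)) (at v (at u 1 x)))
        (cong₂ _+_ (sum-at u (at v 1 x)) (sum-at v (at u 1 x)))

    -- Only the new edge gains weight, at most `L` in each of its two ordered pairs; degrees grow,
    -- so no slack does.
    Φ-insert : ∀ G ℓ u v → Φ (apply (insert u v) G) ℓ ≤ Φ G ℓ + c * (L + L)
    Φ-insert G ℓ u v = ≤-trans (Φ-mono {G} {G'} {ℓ} {ℓ} w≤ s≤)
      (≤-reflexive (cong (Φ G ℓ +_) (trans (cong (c * (L + L) +_) (*-zeroʳ α)) (+-identityʳ _))))
      where
      G' = apply (insert u v) G
      w≤ : weights G' ℓ ≤ weights G ℓ + (L + L)
      w≤ = ≤-trans (sum-≤-+ λ x → sum-≤-+ {h = both L u v x} λ y → bit-* (G' x y) {G x y} {r = both L u v x y} (pt x y))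
                   (≤-reflexive (cong (weights G ℓ +_) (sum-both L u v)))
        where
        pt : ∀ x y → G' x y ≡ true → L ∸ (ℓ x ⊔ ℓ y) ≤ bit (G x y) * (L ∸ (ℓ x ⊔ ℓ y)) + both L u v x y
        pt x y e with joins u v x y in je | G x y
        ... | true  | g = ≤-trans (m∸n≤m L (ℓ x ⊔ ℓ y))
            (≤-trans (joins-both L u v x y je) (m≤n+m _ (bit g * (L ∸ (ℓ x ⊔ ℓ y)))))
        ... | false | true = ≤-trans (≤-reflexive (sym (+-identityʳ _))) (m≤m+n _ _)
      s≤ : sum (slack G' ℓ) ≤ sum (slack G ℓ) + 0
      s≤ = ≤-trans (sum-mono λ x → ∸-monoʳ-≤ (threshold (ℓ x))
             (deg-mono {G = G} {G'} {ℓ} {ℓ} {x} λ y g le → grow y x g , le)) (≤-reflexive (sym (+-identityʳ _)))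
        where
        grow : ∀ y x → G y x ≡ true → G' y x ≡ true
        grow y x g with joins u v y x
        ... | true  = refl
        ... | false = g

    -- Weights can only vanish, and each endpoint loses at most one lower neighbour, hence gains at
    -- most one unit of slack.
    Φ-delete : ∀ G ℓ u v → Φ (apply (delete u v) G) ℓ ≤ Φ G ℓ + α * 2
    Φ-delete G ℓ u v = ≤-trans (Φ-mono {G} {G'} {ℓ} {ℓ} w≤ s≤)
      (≤-reflexive (cong (Φ G ℓ +_) (cong (_+ α * 2) (*-zeroʳ c))))
      where
      G' = apply (delete u v) G
      w≤ : weights G' ℓ ≤ weights G ℓ + 0
      w≤ = ≤-trans (sum-mono λ x → sum-mono λ y → *-monoˡ-≤ (L ∸ (ℓ x ⊔ ℓ y)) (shrink (joins u v x y) (G x y)))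
                   (≤-reflexive (sym (+-identityʳ _)))
        where
        shrink : ∀ p q → bit (not p ∧ q) ≤ bit q
        shrink true  q = z≤n
        shrink false q = ≤-refl
      s≤ : sum (slack G' ℓ) ≤ sum (slack G ℓ) + 2
      s≤ = ≤-trans (sum-≤-+ {h = λ x → at v 1 x + at u 1 x} λ x → slack-mono {G} {G'} {ℓ} {ℓ} x ≤-refl
             (≤-trans (deg-≤ {G = G} {G'} {ℓ} {ℓ} {x} (λ y → both 1 u v y x) (keep x))
                 (≤-reflexive (cong (deg G' ℓ x (ℓ x ∸ 1) +_) (sum-column u v x)))))
           (≤-reflexive (cong (sum (slack G ℓ) +_)
               (trans (∑-distrib-+ (at v 1) (at u 1)) (cong₂ _+_ (sum-at v 1) (sum-at u 1)))))
        where
        keep : ∀ x y → G y x ≡ true → ℓ y ≤ ℓ x ∸ 1 → (G' y x ≡ true × ℓ y ≤ ℓ x ∸ 1) ⊎ 1 ≤ both 1 u v y x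
        keep x y g le with joins u v y x in je
        ... | true  = inj₂ (joins-both 1 u v y x je)
        ... | false = inj₁ (g , le)

-- The potential when one vertex changes its level

module Relevel {Δ L F C} (th : Thresholds Δ L F C) (w : ℕ) {n} {G : Graph n} (simple : Simple G)
               {ℓ ℓ' : Fin n → ℕ} (v : Fin n) (others : ∀ x → x ≢ v → ℓ' x ≡ ℓ x) where
  open Thresholds th
  open Potential th w
  open Simple simple

  neighbor≢ : ∀ {x} → G x v ≡ true → x ≢ v
  neighbor≢ g refl with trans (sym g) (irreflexive v)
  ... | ()

  module Up (up : ℓ v < ℓ' v) (4≤ : 4 ≤ ℓ v) (≤L : ℓ' v ≤ L)
            (full : F (ℓ' v ∸ 1) < deg G ℓ v (ℓ' v ∸ 1)) (fits : deg G ℓ v (ℓ' v) ≤ F (ℓ' v)) where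
    k = ℓ' v
    D⁻ = deg G ℓ v (k ∸ 1)
    D  = deg G ℓ v k

    rises : ∀ x → ℓ x ≤ ℓ' x
    rises x with x Fin.≟ v
    ... | yes refl = <⇒≤ up
    ... | no ≢     = ≤-reflexive (sym (others x ≢))

    suc-pred-k : suc (k ∸ 1) ≡ k
    suc-pred-k = suc-∸1 up

    weight≤ : ∀ x y → weight G ℓ' x y ≤ weight G ℓ x y
    weight≤ x y = *-monoʳ-≤ (bit (G x y)) (∸-monoʳ-≤ L (⊔-mono-≤ (rises x) (rises y)))

    -- For a neighbour below level k the maximum of the two levels was at most `k ∸ 1` and is now k,
    -- so the weight falls by at least one. The row of `v` alone already yields the `D⁻` units that
    -- are needed.
    weight-v : ∀ y → weight G ℓ' v y + bit (G y v ∧ (ℓ y ≤ᵇ k ∸ 1)) ≤ weight G ℓ v y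
    weight-v y with G y v in g | symmetric v y
    ... | false | e rewrite e = ≤-refl
    ... | true  | e rewrite e | others y (neighbor≢ g) with ℓ y ≤ᵇ k ∸ 1 in le
    ... | false = ≤-trans (≤-reflexive (+-identityʳ _))
      (+-monoˡ-≤ 0 (∸-monoʳ-≤ L (⊔-monoˡ-≤ (ℓ y) (<⇒≤ up))))
    ... | true = begin
      L ∸ (k ⊔ ℓ y) + 0 + 1   ≡⟨ cong (_+ 1) (+-identityʳ _) ⟩
      L ∸ (k ⊔ ℓ y) + 1       ≤⟨ +-monoˡ-≤ 1 (∸-monoʳ-≤ L (m≤m⊔n k (ℓ y))) ⟩
      L ∸ k + 1               ≡⟨ +-comm _ 1 ⟩
      suc (L ∸ k)             ≡⟨ sym (+-∸-assoc 1 ≤L) ⟩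
      suc L ∸ k               ≡⟨ cong (suc L ∸_) (sym suc-pred-k) ⟩
      L ∸ (k ∸ 1)             ≤⟨ ∸-monoʳ-≤ L (⊔-lub (≤-pred (≤-trans up (≤-reflexive (sym suc-pred-k)))) (≤ᵇ⁻ le)) ⟩
      L ∸ (ℓ v ⊔ ℓ y)         ≡⟨ sym (+-identityʳ _) ⟩
      L ∸ (ℓ v ⊔ ℓ y) + 0     ∎
      where open ≤-Reasoning

    weights≤ : weights G ℓ' + D⁻ ≤ weights G ℓ
    weights≤ = subst (λ d → weights G ℓ' + d ≤ weights G ℓ) (sum-at v D⁻) (sum-+-≤ row)
      where
      row : ∀ x → sum (weight G ℓ' x) + at v D⁻ x ≤ sum (weight G ℓ x)
      row x with x Fin.≟ v
      ... | yes refl = sum-+-≤ weight-v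
      ... | no _     = ≤-trans (≤-reflexive (+-identityʳ _)) (sum-mono (weight≤ x))

    -- A neighbour above level k still has `v` strictly below it, so only neighbours up to level k
    -- can lose `v` from their lower neighbours.
    others-deg : ∀ {x} → x ≢ v → deg G ℓ x (ℓ x ∸ 1) ≤ deg G ℓ' x (ℓ' x ∸ 1) + bit (G x v ∧ (ℓ x ≤ᵇ k))
    others-deg {x} x≢v = subst (λ r → deg G ℓ x (ℓ x ∸ 1) ≤ deg G ℓ' x (ℓ' x ∸ 1) + r) (sum-at v _)
      (deg-≤ {G = G} {G} {ℓ} {ℓ'} (at v (bit (G x v ∧ (ℓ x ≤ᵇ k)))) pt)
      where
      pt : ∀ y → G y x ≡ true → ℓ y ≤ ℓ x ∸ 1 →
           (G y x ≡ true × ℓ' y ≤ ℓ' x ∸ 1) ⊎ 1 ≤ at v (bit (G x v ∧ (ℓ x ≤ᵇ k))) y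
      pt y g le with y Fin.≟ v
      ... | no ≢ rewrite others y ≢ | others x x≢v = inj₁ (g , le)
      ... | yes refl with ℓ x ≤ᵇ k in xk
      ... | true rewrite symmetric x v | g = inj₂ ≤-refl
      ... | false rewrite others x x≢v = inj₁ (g , ≤-pred (begin
        suc k           ≤⟨ ≰⇒> (λ xk' → contradiction (trans (sym xk) (≤ᵇ⁺ xk')) λ ()) ⟩
        ℓ x             ≤⟨ m≤n+m∸n (ℓ x) 1 ⟩
        suc (ℓ x ∸ 1)   ∎))
        where open ≤-Reasoning

    slacks≤ : sum (slack G ℓ') ≤ sum (slack G ℓ) + D
    slacks≤ = sum-≤-+ pt
      where
      pt : ∀ x → slack G ℓ' x ≤ slack G ℓ x + bit (G x v ∧ (ℓ x ≤ᵇ k))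
      pt x with x Fin.≟ v
      ... | no ≢ = slack-mono {G = G} {G} {ℓ} {ℓ'} x (≤-reflexive (cong threshold (others x ≢))) (others-deg ≢)
      -- By minimality of k, level `k ∸ 1` was still overcrowded, so `v` arrives with more lower
      -- neighbours than its threshold asks for.
      ... | yes refl = ≤-trans (≤-reflexive (m≤n⇒m∸n≡0 (begin
        threshold k           ≡⟨ cong threshold (sym suc-pred-k) ⟩
        threshold (suc (k ∸ 1))  ≤⟨ threshold-suc (k ∸ 1) ⟩
        F (k ∸ 1)             ≤⟨ <⇒≤ full ⟩
        deg G ℓ v (k ∸ 1)     ≤⟨ deg-mono {G = G} {G} {ℓ} {ℓ'}
            (λ y g le → g , ≤-trans (≤-reflexive (others y (neighbor≢ g))) le) ⟩
        deg G ℓ' v (k ∸ 1)    ∎))) z≤n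
        where open ≤-Reasoning

    -- The climb stops at level k but not at `k ∸ 1`, so the `D` neighbours handled and the `D⁻`
    -- edges released are compared by one step of `F`, a factor of about β.
    D≤ : D ≤ b * D⁻
    D≤ = begin
      D                     ≤⟨ fits ⟩
      F k                   ≡⟨ cong F (sym suc-pred-k) ⟩
      F (suc (k ∸ 1))       ≤⟨ F-upper (k ∸ 1) ⟩
      b * suc (F (k ∸ 1))   ≤⟨ *-monoʳ-≤ b full ⟩
      b * D⁻                ∎
      where open ≤-Reasoning

    -- The levels tested on the way and the fixed overhead of a round, the `+ 2`, are charged to the
    -- same `D⁻` edges, as `F` outgrows its index. The factor 3 is the one in the term `3 * w` of
    -- `c`.
    steps≤ : k ∸ ℓ v + 2 ≤ 3 * D⁻
    steps≤ = begin
      k ∸ ℓ v + 2           ≤⟨ +-monoˡ-≤ 2 (∸-monoʳ-≤ k (≤-trans (s≤s z≤n) 4≤)) ⟩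
      k ∸ 1 + 2             ≤⟨ +-monoˡ-≤ 2 (≤-trans (k<F (k ∸ 1)) (<⇒≤ full)) ⟩
      D⁻ + 2                ≤⟨ +-monoʳ-≤ D⁻ (*-monoʳ-≤ 2 (≤-trans (s≤s z≤n) full)) ⟩
      D⁻ + 2 * D⁻           ≡⟨⟩
      3 * D⁻                ∎
      where open ≤-Reasoning

    -- Here the form of `c` is used: per released edge, `(α + w) * b` pays for the slack gained by
    -- the neighbours up to level k and for handling them, and `3 * w` for `steps≤`.
    Φ-up : Φ G ℓ' + w * (D + (k ∸ ℓ v + 2)) ≤ Φ G ℓ
    Φ-up = begin
      c * weights G ℓ' + α * sum (slack G ℓ') + w * (D + (k ∸ ℓ v + 2))
        ≤⟨ +-mono-≤ (+-monoʳ-≤ (c * weights G ℓ') (*-monoʳ-≤ α slacks≤)) (*-monoʳ-≤ w (+-monoʳ-≤ D steps≤)) ⟩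
      c * weights G ℓ' + α * (sum (slack G ℓ) + D) + w * (D + 3 * D⁻)
        ≡⟨ lem₁ (c * weights G ℓ') α (sum (slack G ℓ)) D w D⁻ ⟩
      (α + w) * D + (c * weights G ℓ' + α * sum (slack G ℓ) + w * (3 * D⁻))
        ≤⟨ +-monoˡ-≤ _ (*-monoʳ-≤ (α + w) D≤) ⟩
      (α + w) * (b * D⁻) + (c * weights G ℓ' + α * sum (slack G ℓ) + w * (3 * D⁻))
        ≡⟨ lem₂ (α + w) b w D⁻ (weights G ℓ') (α * sum (slack G ℓ)) ⟩
      c * (weights G ℓ' + D⁻) + α * sum (slack G ℓ)
        ≤⟨ +-monoˡ-≤ _ (*-monoʳ-≤ c weights≤) ⟩
      c * weights G ℓ + α * sum (slack G ℓ) ∎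
      where
      open ≤-Reasoning
      lem₁ : ∀ e α s D w D⁻ → e + α * (s + D) + w * (D + 3 * D⁻) ≡ (α + w) * D + (e + α * s + w * (3 * D⁻))
      lem₁ = solve-∀
      lem₂ : ∀ a b w D⁻ e s → a * (b * D⁻) + ((a * b + 3 * w) * e + s + w * (3 * D⁻)) ≡ (a * b + 3 * w) * (e + D⁻) + s
      lem₂ = solve-∀

  module Down (down : suc (ℓ' v) ≡ ℓ v) (5≤ : 5 ≤ ℓ v)
              (sparse : deg G ℓ v (ℓ v ∸ 1) < C (ℓ v ∸ 5)) (fits : deg G ℓ v (ℓ v) ≤ F (ℓ v)) where
    i = ℓ v
    k = ℓ' v
    low = deg G ℓ v (i ∸ 1)
    D = deg G ℓ v i

    k≡ : i ∸ 1 ≡ k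
    k≡ = cong (_∸ 1) (sym down)

    falls : ∀ x → ℓ' x ≤ ℓ x
    falls x with x Fin.≟ v
    ... | yes refl = ≤-trans (n≤1+n _) (≤-reflexive down)
    ... | no ≢     = ≤-reflexive (others x ≢)

    -- Only the edges from v to lower neighbours change their maximum level.
    max-drops : ∀ y → L ∸ (k ⊔ ℓ y) ≤ L ∸ (i ⊔ ℓ y) + bit (ℓ y ≤ᵇ k)
    max-drops y with ℓ y ≤ᵇ k in le
    ... | true = begin
      L ∸ (k ⊔ ℓ y)           ≡⟨ cong (L ∸_) (m≥n⇒m⊔n≡m {k} {ℓ y} (≤ᵇ⁻ le)) ⟩
      L ∸ k                   ≤⟨ m≤n+m∸n (L ∸ k) 1 ⟩
      suc (L ∸ k ∸ 1)         ≡⟨ cong suc (∸-+-assoc L k 1) ⟩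
      suc (L ∸ (k + 1))       ≡⟨ cong (λ z → suc (L ∸ z)) (trans (+-comm k 1) down) ⟩
      suc (L ∸ i)             ≡⟨ cong (λ z → suc (L ∸ z))
          (sym (m≥n⇒m⊔n≡m (≤-trans (≤ᵇ⁻ le) (≤-trans (n≤1+n k) (≤-reflexive down))))) ⟩
      suc (L ∸ (i ⊔ ℓ y))     ≡⟨ +-comm 1 _ ⟩
      L ∸ (i ⊔ ℓ y) + 1       ∎
      where open ≤-Reasoning
    ... | false = ≤-trans (∸-monoʳ-≤ L
        (⊔-lub (≤-trans (≤-reflexive (sym down)) (≤-trans k<ℓy (m≤n⊔m k (ℓ y)))) (m≤n⊔m k (ℓ y))))
                          (≤-reflexive (sym (+-identityʳ _)))
      where
      k<ℓy : k < ℓ y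
      k<ℓy = ≰⇒> λ le' → contradiction (trans (sym le) (≤ᵇ⁺ le')) λ ()

    lower : Fin n → ℕ
    lower y = bit (G y v ∧ (ℓ y ≤ᵇ i ∸ 1))

    lower-≥ : ∀ {y} → G y v ≡ true → bit (ℓ y ≤ᵇ k) ≤ lower y
    lower-≥ g rewrite g | k≡ = ≤-refl

    weight≤ : ∀ x y → weight G ℓ' x y ≤ weight G ℓ x y + (at v (lower y) x + at v (lower x) y)
    weight≤ x y = bit-* (G x y) {G x y} {r = at v (lower y) x + at v (lower x) y} pt
      where
      pt : G x y ≡ true → L ∸ (ℓ' x ⊔ ℓ' y) ≤ bit (G x y) * (L ∸ (ℓ x ⊔ ℓ y)) + (at v (lower y) x + at v (lower x) y)
      pt g rewrite g | +-identityʳ (L ∸ (ℓ x ⊔ ℓ y)) with x Fin.≟ v | y Fin.≟ v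
      ... | yes refl | yes refl = contradiction refl (neighbor≢ g)
      ... | yes refl | no y≢ rewrite others y y≢ | +-identityʳ (lower y) =
        ≤-trans (max-drops y) (+-monoʳ-≤ _ (lower-≥ (trans (symmetric y v) g)))
      ... | no x≢ | yes refl rewrite others x x≢ | ⊔-comm (ℓ x) k | ⊔-comm (ℓ x) i =
        ≤-trans (max-drops x) (+-monoʳ-≤ _ (lower-≥ g))
      ... | no x≢ | no y≢ rewrite others x x≢ | others y y≢ = m≤m+n _ 0

    weights≤ : weights G ℓ' ≤ weights G ℓ + 2 * low
    weights≤ = ≤-trans (sum-≤-+ {h = λ x → sum λ y → at v (lower y) x + at v (lower x) y}
        λ x → sum-≤-+ {h = λ y → at v (lower y) x + at v (lower x) y} (weight≤ x))
      (≤-reflexive (cong (weights G ℓ +_) (trans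
        (sum-cong-≗ λ x → trans (∑-distrib-+ (λ y → at v (lower y) x) (at v (lower x)))
          (cong₂ _+_ (sum-at-row v lower x) (sum-at v (lower x))))
        (trans (∑-distrib-+ (at v low) lower)
          (cong₂ _+_ (sum-at v low) (sym (+-identityʳ low)))))))

    -- As `v` falls, other vertices can only gain lower neighbours. The slack of `v` itself was
    -- `F (i ∸ 1) ∸ low` and becomes at most `F (i ∸ 2)`; `d` is any amount that fits into this
    -- difference.
    slacks≤ : ∀ d → F (i ∸ 2) + low + d ≤ F (i ∸ 1) → sum (slack G ℓ') + d ≤ sum (slack G ℓ)
    slacks≤ d le = subst (λ z → sum (slack G ℓ') + z ≤ sum (slack G ℓ)) (sum-at v d) (sum-+-≤ pt)
      where
      k≡2 : suc (i ∸ 2) ≡ k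
      k≡2 = trans (sym (+-∸-assoc 1 (≤-trans (s≤s (s≤s z≤n)) 5≤))) k≡
      pt : ∀ x → slack G ℓ' x + at v d x ≤ slack G ℓ x
      pt x with x Fin.≟ v
      ... | no ≢ = ≤-trans (≤-reflexive (+-identityʳ _)) (≤-trans
        (slack-mono {G = G} {G} {ℓ} {ℓ'} x (≤-reflexive (cong threshold (others x ≢)))
          (≤-trans (deg-mono {G = G} {G} {ℓ} {ℓ'} λ y g l → g , ≤-trans (falls y)
              (≤-trans l (≤-reflexive (cong (_∸ 1) (sym (others x ≢)))))) (m≤m+n _ 0)))
        (≤-reflexive (+-identityʳ _)))
      ... | yes refl = begin
        slack G ℓ' v + d               ≤⟨ +-monoˡ-≤ d (m∸n≤m (threshold k) (deg G ℓ' v (k ∸ 1))) ⟩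
        threshold k + d                ≡⟨ cong (λ z → threshold z + d) (sym k≡2) ⟩
        threshold (suc (i ∸ 2)) + d    ≤⟨ +-monoˡ-≤ d (threshold-suc (i ∸ 2)) ⟩
        F (i ∸ 2) + d                  ≡⟨ sym (m+n∸n≡m _ low) ⟩
        F (i ∸ 2) + d + low ∸ low      ≡⟨ cong (_∸ low)
            (trans (+-assoc (F (i ∸ 2)) d low)
            (trans (cong (F (i ∸ 2) +_) (+-comm d low)) (sym (+-assoc (F (i ∸ 2)) low d)))) ⟩
        F (i ∸ 2) + low + d ∸ low      ≤⟨ ∸-monoˡ-≤ low le ⟩
        F (i ∸ 1) ∸ low                ≡⟨ cong (_∸ low) (sym (threshold-≤ i 5≤)) ⟩
        threshold i ∸ low              ∎
        where open ≤-Reasoning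

    module _ (1≤w : 1 ≤ w) where
      -- The scales of a drop: `g` is the old threshold, `f` bounds the lower degree of a sparse
      -- vertex, and `q` is one level above `f`, where the product of `f` with `b` lands. `d` is the
      -- slack that is released.
      g = F (i ∸ 1)
      q = F (i ∸ 4)
      f = F (i ∸ 5)
      d = g ∸ (F (i ∸ 2) + low)

      i∸ : ∀ m → m ≤ 4 → suc (i ∸ suc m) ≡ i ∸ m
      i∸ m m≤4 = sym (+-∸-assoc 1 (≤-trans (s≤s m≤4) 5≤))

      ratio : ∀ m → m ≤ 4 → 20 * F (i ∸ suc m) ≤ F (i ∸ m)
      ratio m m≤4 = subst (λ z → 20 * F (i ∸ suc m) ≤ F z) (i∸ m m≤4) (F-ratio (i ∸ suc m))

      q-g : 8000 * q ≤ g
      q-g = begin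
        8000 * q              ≡⟨ *-assoc 20 400 q ⟩
        20 * (400 * q)        ≡⟨ cong (20 *_) (*-assoc 20 20 q) ⟩
        20 * (20 * (20 * q))  ≤⟨ *-monoʳ-≤ 20 (*-monoʳ-≤ 20 (ratio 3 (s≤s (s≤s (s≤s z≤n))))) ⟩
        20 * (20 * F (i ∸ 3)) ≤⟨ *-monoʳ-≤ 20 (ratio 2 (s≤s (s≤s z≤n))) ⟩
        20 * F (i ∸ 2)        ≤⟨ ratio 1 (s≤s z≤n) ⟩
        g                     ∎
        where open ≤-Reasoning

      low≤f : low ≤ f
      low≤f = ≤-pred (≤-trans sparse (C-upper (i ∸ 5)))

      b*f≤ : b * f ≤ 2 * q
      b*f≤ = begin
        f + F 1 * f   ≤⟨ +-monoˡ-≤ (F 1 * f) (m≤n*m f (F 1) {{>-nonZero (F-positive 1)}}) ⟩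
        F 1 * f + F 1 * f  ≤⟨ +-mono-≤ F1f F1f ⟩
        q + q         ≡⟨ cong (q +_) (sym (+-identityʳ q)) ⟩
        2 * q         ∎
        where
        open ≤-Reasoning
        F1f : F 1 * f ≤ q
        F1f = subst (λ z → F 1 * f ≤ F z) (i∸ 4 ≤-refl) (F-lower (i ∸ 5))

      f≤q : f ≤ q
      f≤q = ≤-trans (m≤n*m f 20) (ratio 4 ≤-refl)

      -- At least half of the threshold is released: `F (i ∸ 2)` is at most a twentieth of `g`, and
      -- `low` is no larger than `F (i ∸ 2)`.
      half : 2 * (F (i ∸ 2) + low) ≤ g
      half = begin
        2 * (F (i ∸ 2) + low)          ≤⟨ *-monoʳ-≤ 2 (+-monoʳ-≤ (F (i ∸ 2)) (≤-trans low≤f (≤-trans f≤q q≤))) ⟩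
        2 * (F (i ∸ 2) + F (i ∸ 2))    ≡⟨ lem (F (i ∸ 2)) ⟩
        4 * F (i ∸ 2)                  ≤⟨ *-monoˡ-≤ (F (i ∸ 2)) (≤ᵇ⇒≤ 4 20 tt) ⟩
        20 * F (i ∸ 2)                 ≤⟨ ratio 1 (s≤s z≤n) ⟩
        g                              ∎
        where
        open ≤-Reasoning
        lem : ∀ x → 2 * (x + x) ≡ 4 * x
        lem = solve-∀
        q≤ : q ≤ F (i ∸ 2)
        q≤ = ≤-trans (m≤n*m q 20) (≤-trans (ratio 3 (s≤s (s≤s (s≤s z≤n)))) (≤-trans (m≤n*m _ 20) (ratio 2 (s≤s (s≤s z≤n)))))

      g≤2d : g ≤ 2 * d
      g≤2d = +-cancelʳ-≤ (2 * (F (i ∸ 2) + low)) g (2 * d) (begin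
        g + 2 * (F (i ∸ 2) + low)        ≤⟨ +-monoʳ-≤ g half ⟩
        g + g                            ≤⟨ +-mono-≤ (m≤n+m∸n g (F (i ∸ 2) + low)) (m≤n+m∸n g (F (i ∸ 2) + low)) ⟩
        (F (i ∸ 2) + low + d) + (F (i ∸ 2) + low + d)   ≡⟨ lem (F (i ∸ 2) + low) d ⟩
        2 * d + 2 * (F (i ∸ 2) + low)    ∎)
        where
        open ≤-Reasoning
        lem : ∀ x d → (x + d) + (x + d) ≡ 2 * d + 2 * x
        lem = solve-∀

      D≤ : D + 2 ≤ 4 * (b * g)
      D≤ = begin
        D + 2                 ≤⟨ +-monoˡ-≤ 2 fits ⟩
        F i + 2               ≡⟨ cong (λ z → F z + 2) (sym (i∸ 0 z≤n)) ⟩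
        F (suc (i ∸ 1)) + 2   ≤⟨ +-mono-≤ (F-upper (i ∸ 1)) (*-monoʳ-≤ 2 1≤bg) ⟩
        b * suc g + 2 * (b * g)  ≤⟨ +-monoˡ-≤ _ (*-monoʳ-≤ b (+-monoˡ-≤ g (F-positive (i ∸ 1)))) ⟩
        b * (g + g) + 2 * (b * g) ≡⟨ lem b g ⟩
        4 * (b * g)           ∎
        where
        open ≤-Reasoning
        1≤bg : 1 ≤ b * g
        1≤bg = *-mono-≤ {1} {b} {1} (s≤s z≤n) (F-positive (i ∸ 1))
        lem : ∀ b g → b * (g + g) + 2 * (b * g) ≡ 4 * (b * g)
        lem = solve-∀

      w≤α : w ≤ α
      w≤α = ≤-trans (m≤n*m w 16) (m≤m*n (16 * w) b)

      -- As `w ≤ α`, `c` is at most `5 * α * b`; the factor `b` lifts `low` from the scale `f` to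
      -- the scale `q`, which is still far below `g`.
      c-low : 4 * (c * low) ≤ α * (40 * q)
      c-low = begin
        4 * (c * low)                                   ≤⟨ *-monoʳ-≤ 4 (*-monoʳ-≤ c low≤f) ⟩
        4 * (((α + w) * b + 3 * w) * f)                 ≤⟨ *-monoʳ-≤ 4
            (*-monoˡ-≤ f (+-mono-≤ (*-monoˡ-≤ b (+-monoʳ-≤ α w≤α)) 3w≤)) ⟩
        4 * (((α + α) * b + 3 * (α * b)) * f)           ≡⟨ lem α b f ⟩
        (20 * α) * (b * f)                              ≤⟨ *-monoʳ-≤ (20 * α) b*f≤ ⟩
        (20 * α) * (2 * q)                              ≡⟨ lem' α q ⟩
        α * (40 * q)                                    ∎
        where
        open ≤-Reasoning
        3w≤ : 3 * w ≤ 3 * (α * b)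
        3w≤ = *-monoʳ-≤ 3 (≤-trans w≤α (m≤m*n α b))
        lem : ∀ α b f → 4 * (((α + α) * b + 3 * (α * b)) * f) ≡ (20 * α) * (b * f)
        lem = solve-∀
        lem' : ∀ α q → (20 * α) * (2 * q) ≡ α * (40 * q)
        lem' = solve-∀

      funds : c * (2 * low) + w * (D + 2) ≤ α * d
      funds = *-cancelˡ-≤ 4 (begin
        4 * (c * (2 * low) + w * (D + 2))           ≡⟨ lem₁ c low w (D + 2) ⟩
        2 * (4 * (c * low)) + 4 * (w * (D + 2))     ≤⟨ +-mono-≤ (*-monoʳ-≤ 2 c-low) (*-monoʳ-≤ 4 (*-monoʳ-≤ w D≤)) ⟩
        -- The second summand equals `α * g`: the 16 in `α` is the 4 of this estimate times the 4 of
        -- `D≤`. The outer factor 4 leaves two shares `α * (2 * d)`, one for the edges and one for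
        -- the work.
        2 * (α * (40 * q)) + 4 * (w * (4 * (b * g)))  ≡⟨ lem₂ α q w b g ⟩
        α * (80 * q) + α * g                        ≤⟨ +-monoˡ-≤ (α * g)
            (*-monoʳ-≤ α (≤-trans (*-monoˡ-≤ q (≤ᵇ⇒≤ 80 8000 tt)) q-g)) ⟩
        α * g + α * g                               ≤⟨ +-mono-≤ (*-monoʳ-≤ α g≤2d) (*-monoʳ-≤ α g≤2d) ⟩
        α * (2 * d) + α * (2 * d)                   ≡⟨ lem₃ α d ⟩
        4 * (α * d)                                 ∎)
        where
        open ≤-Reasoning
        lem₁ : ∀ c l w D → 4 * (c * (2 * l) + w * D) ≡ 2 * (4 * (c * l)) + 4 * (w * D)
        lem₁ = solve-∀
        lem₂ : ∀ α q w b g → 2 * (α * (40 * q)) + 4 * (w * (4 * (b * g))) ≡ α * (80 * q) + (16 * w * b) * g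
        lem₂ = solve-∀
        lem₃ : ∀ α d → α * (2 * d) + α * (2 * d) ≡ 4 * (α * d)
        lem₃ = solve-∀

      Φ-down : Φ G ℓ' + w * (D + 2) ≤ Φ G ℓ
      Φ-down = begin
        c * weights G ℓ' + α * sum (slack G ℓ') + w * (D + 2)
          ≤⟨ +-monoˡ-≤ _ (+-monoˡ-≤ _ (*-monoʳ-≤ c weights≤)) ⟩
        c * (weights G ℓ + 2 * low) + α * sum (slack G ℓ') + w * (D + 2)
          ≡⟨ lem c (weights G ℓ) (2 * low) (α * sum (slack G ℓ')) (w * (D + 2)) ⟩
        c * weights G ℓ + (α * sum (slack G ℓ') + (c * (2 * low) + w * (D + 2)))
          ≤⟨ +-monoʳ-≤ (c * weights G ℓ) (+-monoʳ-≤ _ funds) ⟩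
        c * weights G ℓ + (α * sum (slack G ℓ') + α * d)
          ≡⟨ cong (c * weights G ℓ +_) (sym (*-distribˡ-+ α _ d)) ⟩
        c * weights G ℓ + α * (sum (slack G ℓ') + d)
          ≤⟨ +-monoʳ-≤ (c * weights G ℓ) (*-monoʳ-≤ α
              (slacks≤ d (≤-reflexive (m+[n∸m]≡n {F (i ∸ 2) + low} (≤-trans (m≤m+n (F (i ∸ 2) + low) _) half))))) ⟩
        c * weights G ℓ + α * sum (slack G ℓ) ∎
        where
        open ≤-Reasoning
        lem : ∀ c W l s t → c * (W + l) + s + t ≡ c * W + (s + (c * l + t))
        lem = solve-∀

-- Programs on the word RAM, with time credits

get-same : ∀ s a i w → (s [ a , i ↦ w ]) a i ≡ w
get-same s a i w with a ≡ᵇ a | ≡⇒≡ᵇ a a refl | i ≡ᵇ i | ≡⇒≡ᵇ i i refl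
... | true | _ | true | _ = refl

get-diff : ∀ s a i w {j} → j ≢ i → (s [ a , i ↦ w ]) a j ≡ s a j
get-diff s a i w {j} j≢i with a ≡ᵇ a | j ≡ᵇ i | ≡ᵇ⇒≡ j i
... | true  | true  | eq = contradiction (eq tt) j≢i
... | true  | false | _  = refl
... | false | _     | _  = refl

-- A word expression is below B ^ m, where m counts its leaves and B bounds all memory cells.
leaves : Exp → ℕ
leaves (lit _)       = 1
leaves (read _ _)    = 1
leaves (binop _ e f) = leaves e + leaves f

-- A common bound for the number of leaves of every expression in the program. Words are below
-- `B ^ R`, which makes `R` a factor of the final exponent.
R : ℕ
R = 40

wf : Exp → Bool
wf (lit c)       = c ≤ᵇ 9
wf (read _ e)    = wf e
wf (binop _ e f) = wf e ∧ wf f ∧ (leaves e + leaves f ≤ᵇ R)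

straight : Cmd → Bool
straight skip          = true
straight (write _ i e) = wf i ∧ wf e
straight (c ⨾ d)       = straight c ∧ straight d
straight (cond _ _ _)  = false
straight (while _ _)   = false

-- The final store of a straight-line command, by computation; conditionals and loops are treated
-- through `Runs` instead, and the last clause is a mere default for them.
post : Cmd → Store → Store
post (write a i e) s = s [ a , eval i s ↦ eval e s ]
post (c ⨾ d)       s = post d (post c s)
post _             s = s

time : Cmd → ℕ
time (write _ i e) = suc (cost i + cost e)
time (c ⨾ d)       = suc (time c + time d)
time _             = 1

T-∧⁻ : ∀ x {y} → T (x ∧ y) → T x × T y
T-∧⁻ true t = tt , t

leaves≥1 : ∀ e → 1 ≤ leaves e
leaves≥1 (lit _)       = ≤-refl
leaves≥1 (read _ _)    = ≤-refl
leaves≥1 (binop _ e f) = ≤-trans (leaves≥1 e) (m≤m+n _ _)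

wf-leaves : ∀ e → T (wf e) → leaves e ≤ R
wf-leaves (lit _)       _ = s≤s z≤n
wf-leaves (read _ _)    _ = s≤s z≤n
wf-leaves (binop _ e f) t = ≤ᵇ⇒≤ _ _ (proj₂ (T-∧⁻ (wf f) (proj₂ (T-∧⁻ (wf e) t))))

+-<-* : ∀ {x y a b} → x < a → y < b → 2 ≤ a → 2 ≤ b → x + y < a * b
+-<-* {x} {y} {suc (suc a)} {suc (suc b)} (s≤s x<) (s≤s y<) (s≤s (s≤s _)) (s≤s (s≤s _)) = begin-strict
  x + y                         ≤⟨ +-mono-≤ x< y< ⟩
  suc a + suc b                 <⟨ n<1+n _ ⟩
  suc (suc a + suc b)           ≡⟨ cong suc (+-comm (suc a) (suc b)) ⟩
  suc (suc b) + suc a           ≤⟨ +-monoʳ-≤ (suc (suc b)) (m≤m*n (suc a) (suc (suc b))) ⟩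
  suc (suc a) * suc (suc b)     ∎
  where open ≤-Reasoning

_∈ᵇ_ : ℕ → List ℕ → Bool
a ∈ᵇ []       = false
a ∈ᵇ (x ∷ xs) = (a ≡ᵇ x) ∨ (a ∈ᵇ xs)

targets : Cmd → List ℕ → Bool
targets (write a _ _) as = a ∈ᵇ as
targets (c ⨾ d)       as = targets c as ∧ targets d as
targets _             _  = true

-- The frame condition: arrays outside `as` are untouched. As whole arrays are listed by their
-- numbers, membership is decided by evaluation and side conditions are proved by `tt`.
record Same (as : List ℕ) (s s' : Store) : Set where
  constructor agree
  field same : ∀ a i → T (not (a ∈ᵇ as)) → s' a i ≡ s a i
open Same public

same-trans : ∀ {as s s' s''} → Same as s s' → Same as s' s'' → Same as s s''
same-trans p q = agree λ a i t → trans (same q a i t) (same p a i t)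

same-post : ∀ as c → T (targets c as) → ∀ {s} → Same as s (post c s)
same-post as (write a i e) t {s} = agree outside
  where
  T-not : ∀ p → T p → ¬ T (not p)
  T-not true _ ()
  outside : ∀ b j → T (not (b ∈ᵇ as)) → post (write a i e) s b j ≡ s b j
  outside b j n with b ≡ᵇ a | ≡ᵇ⇒≡ b a
  ... | false | _ = refl
  ... | true  | eq with eq tt
  ... | refl = ⊥-elim (T-not (a ∈ᵇ as) t n)
same-post as (c ⨾ d) t with T-∧⁻ (targets c as) t
... | tc , td = same-trans (same-post as c tc) (same-post as d td)
same-post as skip t = agree λ _ _ _ → refl
same-post as (cond _ _ _) t = agree λ _ _ _ → refl
same-post as (while _ _) t = agree λ _ _ _ → refl

_⊆ᵇ_ : List ℕ → List ℕ → Bool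
[]       ⊆ᵇ bs = true
(a ∷ as) ⊆ᵇ bs = (a ∈ᵇ bs) ∧ (as ⊆ᵇ bs)

same-weaken : ∀ as bs → T (as ⊆ᵇ bs) → ∀ {s s'} → Same as s s' → Same bs s s'
same-weaken as bs sub p = agree λ a i t → same p a i (outside as sub a t)
  where
  outside : ∀ as → T (as ⊆ᵇ bs) → ∀ a → T (not (a ∈ᵇ bs)) → T (not (a ∈ᵇ as))
  outside [] _ _ _ = tt
  outside (b ∷ as) sub a t with T-∧⁻ (b ∈ᵇ bs) sub
  ... | b∈ , sub' with a ≡ᵇ b | ≡ᵇ⇒≡ a b
  ... | false | _ = outside as sub' a t
  ... | true  | eq with eq tt
  ... | refl with a ∈ᵇ bs
  ... | true = t

-- Word bounds, timed execution and amortised loops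

module Words (B : ℕ) (10≤B : 10 ≤ B) where

  private instance
    B≢0 : NonZero B
    B≢0 = >-nonZero (≤-trans (s≤s z≤n) 10≤B)

  W : ℕ
  W = B ^ R

  Small : Store → Set
  Small s = ∀ a i → s a i < B

  2≤B^ : ∀ {m} → 1 ≤ m → 2 ≤ B ^ m
  2≤B^ {m} 1≤m = begin
    2      ≤⟨ s≤s (s≤s z≤n) ⟩
    10     ≤⟨ 10≤B ⟩
    B      ≡⟨ sym (^-identityʳ B) ⟩
    B ^ 1  ≤⟨ ^-monoʳ-≤ B 1≤m ⟩
    B ^ m  ∎
    where open ≤-Reasoning

  op-small : ∀ o {x y a b} → x < a → y < b → 2 ≤ a → 2 ≤ b → ⟦ o ⟧ x y < a * b
  op-small plus x< y< 2≤a 2≤b = +-<-* x< y< 2≤a 2≤b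
  op-small monus {x} {y} {a} {b} x< y< 2≤a 2≤b = begin-strict
    x ∸ y   ≤⟨ m∸n≤m x y ⟩
    x       ≤⟨ m≤m+n x y ⟩
    x + y   <⟨ +-<-* x< y< 2≤a 2≤b ⟩
    a * b   ∎
    where open ≤-Reasoning
  op-small times x< y< 2≤a 2≤b = *-mono-< x< y<
  op-small leq {x} {y} {a} {b} x< y< 2≤a 2≤b = ≤-trans (bit< (x ≤ᵇ y)) (*-mono-≤ 2≤a (≤-trans (s≤s z≤n) 2≤b))
    where
    bit< : ∀ c → (if c then 1 else 0) < 2
    bit< true  = s≤s (s≤s z≤n)
    bit< false = s≤s z≤n

  eval-small : ∀ {s} → Small s → ∀ e → T (wf e) → eval e s < B ^ leaves e
  eval-small sm (lit c) t =
    ≤-trans (s≤s (≤ᵇ⇒≤ c 9 t)) (≤-trans 10≤B (≤-reflexive (sym (^-identityʳ B))))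
  eval-small sm (read a e) t = ≤-trans (sm a _) (≤-reflexive (sym (^-identityʳ B)))
  eval-small {s} sm (binop o e f) t with T-∧⁻ (wf e) t
  ... | te , t' with T-∧⁻ (wf f) t'
  ... | tf , _ = subst (⟦ o ⟧ (eval e s) (eval f s) <_) (sym (^-distribˡ-+-* B (leaves e) (leaves f)))
    (op-small o (eval-small sm e te) (eval-small sm f tf) (2≤B^ (leaves≥1 e)) (2≤B^ (leaves≥1 f)))

  eval-word : ∀ {s} → Small s → ∀ e → T (wf e) → eval e s < W
  eval-word sm e t = ≤-trans (eval-small sm e t) (^-monoʳ-≤ B (wf-leaves e t))

  fits : ∀ {s} → Small s → ∀ e → T (wf e) → Fits W e s
  fits sm e@(lit _) t       = eval-word sm e t
  fits sm e@(read _ i) t    = eval-word sm e t , fits sm i t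
  fits sm e@(binop _ f g) t with T-∧⁻ (wf f) t
  ... | tf , t' = eval-word sm e t , fits sm f tf , fits sm g (proj₁ (T-∧⁻ (wf g) t'))

  small-write : ∀ {s a i w} → Small s → w < B → Small (s [ a , i ↦ w ])
  small-write {s} {a} {i} sm w< b j with does (b Data.Nat.≟ a) ∧ does (j Data.Nat.≟ i)
  ... | true  = w<
  ... | false = sm b j

  -- Intermediate values may grow up to `B ^ R`, but every value that is stored must return below
  -- `B`; otherwise the bound would worsen from one command to the next.
  Safe : Cmd → Store → Set
  Safe (write a i e) s = eval e s < B
  Safe (c ⨾ d)       s = Safe c s × Safe d (post c s)
  Safe _             s = ⊤

  exec-straight : ∀ c → T (straight c) → ∀ {s} → Small s → Safe c s →
                  Exec W c s (post c s) (time c) × Small (post c s)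
  exec-straight skip t sm ok = skip , sm
  exec-straight (write a i e) t sm ok with T-∧⁻ (wf i) t
  ... | ti , te = write (fits sm i ti) (fits sm e te) , small-write sm ok
  exec-straight (c ⨾ d) t sm (okc , okd) with T-∧⁻ (straight c) t
  ... | tc , td with exec-straight c tc sm okc
  ... | ec , sm' with exec-straight d td sm' okd
  ... | ed , sm'' = ec ⨾ ed , sm''

  record Runs (c : Cmd) (s : Store) (t : ℕ) (Q : Store → Set) : Set where
    constructor runs
    field
      {final} : Store
      {taken} : ℕ
      exec  : Exec W c s final taken
      bound : taken ≤ t
      holds : Q final

  runs-straight : ∀ c → T (straight c) → ∀ {s Q} → Small s → Safe c s →
                  (Small (post c s) → Q (post c s)) → Runs c s (time c) Q
  runs-straight c tc sm ok q with exec-straight c tc sm ok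
  ... | e , sm' = runs e ≤-refl (q sm')

  runs-weaken : ∀ {c s t t' Q Q'} → Runs c s t Q → t ≤ t' → (∀ {s'} → Q s' → Q' s') → Runs c s t' Q'
  runs-weaken (runs e b h) t≤ q = runs e (≤-trans b t≤) (q h)

  runs-seq : ∀ {c d s t t' Q Q'} → Runs c s t Q → (∀ {s'} → Q s' → Runs d s' t' Q') →
             Runs (c ⨾ d) s (suc (t + t')) Q'
  runs-seq (runs e b h) k with k h
  ... | runs e' b' h' = runs (e ⨾ e') (s≤s (+-mono-≤ b b')) h'

  -- One turn of a loop: either the guard fails, or the body runs and gives up credits worth its own
  -- time and that of the guard. `Q` sees the credits that are left over, since the main loop hands
  -- them on as the potential for the next update.
  data Iterate (e : Exp) (c : Cmd) (I Q : ℕ → Store → Set) (m : ℕ) (s : Store) : Set where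
    stop : eval e s ≡ 0 → Q m s → Iterate e c I Q m s
    go   : ∀ t → eval e s ≢ 0 →
           Runs c s t (λ s' → ∃ λ m' → I m' s' × suc (cost e) + t + m' ≤ m) → Iterate e c I Q m s

  -- The index m of the invariant is a supply of time credits, which every iteration draws on.
  amortise : ∀ {e c} (I Q : ℕ → Store → Set) → T (wf e) →
             (∀ {m s} → I m s → Small s × Iterate e c I Q m s) → ∀ {m s} → I m s →
             ∃ λ s' → ∃ λ t → ∃ λ m' → Exec W (while e c) s s' t × t + m' ≤ m + suc (cost e) × Q m' s'
  amortise {e} {c} I Q te body {m} i = loop m (<-wellFounded m) i
    where
    loop : ∀ m → Acc _<_ m → ∀ {s} → I m s →
           ∃ λ s' → ∃ λ t → ∃ λ m' → Exec W (while e c) s s' t × t + m' ≤ m + suc (cost e) × Q m' s'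
    -- Each turn spends at least the cost of the guard, so the credits also prove termination.
    loop m (acc rec) i with body i
    ... | sm , stop z q = _ , _ , m , while-false (fits sm e te) z , ≤-reflexive (+-comm (suc (cost e)) m) , q
    ... | sm , go t nz (runs {taken = t₀} ex b (m' , i' , le))
      with loop m' (rec (≤-trans (s≤s (m≤n+m m' (cost e + t))) le)) i'
    ... | s'' , t' , m'' , ex' , b' , q = _ , _ , m'' , while-true (fits sm e te) nz ex ex' , time≤ , q
      where
      open ≤-Reasoning
      time≤ : suc (cost e) + t₀ + t' + m'' ≤ m + suc (cost e)
      time≤ = begin
        suc (cost e) + t₀ + t' + m''                  ≡⟨ +-assoc (suc (cost e) + t₀) t' m'' ⟩
        suc (cost e) + t₀ + (t' + m'')                ≤⟨ +-mono-≤ (+-monoʳ-≤ (suc (cost e)) b) b' ⟩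
        suc (cost e) + t + (m' + suc (cost e))        ≡⟨ sym (+-assoc (suc (cost e) + t) m' _) ⟩
        suc (cost e) + t + m' + suc (cost e)          ≤⟨ +-monoˡ-≤ _ le ⟩
        m + suc (cost e)                              ∎

  runs-while : ∀ {e c} (I : ℕ → Store → Set) {Q : Store → Set} → T (wf e) →
               (∀ {m s} → I m s → Small s × Iterate e c I (λ _ → Q) m s) →
               ∀ {m s} → I m s → Runs (while e c) s (m + suc (cost e)) Q
  runs-while I te body i with amortise I _ te body i
  ... | s' , t , m' , ex , b , q = runs ex (≤-trans (m≤m+n t m') b) q

-- Buckets with constant-time insertion and deletion

-- Row u partitions the vertices v with b u v ≢ 0 into buckets numbered 1, …, L, kept as arrays:
-- bucket j of row u is lst u j 0, …, lst u j (cnt u j ∸ 1), and pos u v is the place of v in its bucket.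
record Buckets {n} (L : ℕ) (pos : Fin n → Fin n → ℕ) (cnt : Fin n → ℕ → ℕ)
               (lst : Fin n → ℕ → ℕ → ℕ) (b : Fin n → Fin n → ℕ) : Set where
  field
    bounded : ∀ u v → b u v ≤ L
    into    : ∀ u v {j} → b u v ≡ j → 1 ≤ j → pos u v < cnt u j × lst u j (pos u v) ≡ toℕ v
    from    : ∀ u {j p} → 1 ≤ j → j ≤ L → p < cnt u j →
              ∃ λ v → lst u j p ≡ toℕ v × b u v ≡ j × pos u v ≡ p

module _ {n L} {pos : Fin n → Fin n → ℕ} {cnt lst b} (bs : Buckets L pos cnt lst b) where
  open Buckets bs

  -- The state of a traversal that has passed p cells of bucket j. As membership is expressed by
  -- `pos`, a new cell cannot repeat an element.
  record Prefix (u : Fin n) (j p : ℕ) (ys : List (Fin n)) : Set where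
    field
      unique   : Unique ys
      size     : length ys ≡ p
      sound    : ∀ {y} → y ∈ ys → b u y ≡ j × pos u y < p
      complete : ∀ {y} → b u y ≡ j → pos u y < p → y ∈ ys

  prefix-zero : ∀ {u j} → Prefix u j 0 []
  prefix-zero = record { unique = [] ; size = refl ; sound = λ () ; complete = λ _ () }

  prefix-suc : ∀ {u j p y ys} → 1 ≤ j → Prefix u j p ys → b u y ≡ j → pos u y ≡ p → Prefix u j (suc p) (y ∷ ys)
  prefix-suc {u} {j} {p} {y} {ys} 1≤j pre by py = record
    { unique = All.tabulate (λ { x∈ refl → <⇒≢ (proj₂ (P.sound x∈)) py }) ∷ P.unique
    ; size = cong suc P.size
    ; sound = λ { (here refl) → by , s≤s (≤-reflexive py)
                ; (there x∈) → proj₁ (P.sound x∈) , m<n⇒m<1+n (proj₂ (P.sound x∈)) }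
    ; complete = compl
    }
    where
    module P = Prefix pre
    compl : ∀ {x} → b u x ≡ j → pos u x < suc p → x ∈ y ∷ ys
    compl {x} bx (s≤s px) with m≤n⇒m<n∨m≡n px
    ... | inj₁ lt = there (P.complete bx lt)
    ... | inj₂ eq = here (Fin.toℕ-injective (trans (sym (proj₂ (into u x bx 1≤j)))
      (trans (cong (lst u j) (trans eq (sym py))) (proj₂ (into u y by 1≤j)))))

  bucket-prefix : ∀ u {j} → 1 ≤ j → j ≤ L → ∀ p → p ≤ cnt u j → ∃ (Prefix u j p)
  bucket-prefix u 1≤j j≤L zero    _  = [] , prefix-zero
  bucket-prefix u 1≤j j≤L (suc p) p< with bucket-prefix u 1≤j j≤L p (<⇒≤ p<) | from u 1≤j j≤L p<
  ... | ys , pre | v , _ , bv , pv = v ∷ ys , prefix-suc 1≤j pre bv pv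

  cnt-# : ∀ u {j} → 1 ≤ j → j ≤ L → cnt u j ≡ # λ x → b u x ≡ᵇ j
  cnt-# u {j} 1≤j j≤L with bucket-prefix u 1≤j j≤L (cnt u j) ≤-refl
  ... | ys , pre = trans (sym size) (unique-# _ ys unique
      (λ {y} y∈ → T⇒≡ (≡⇒≡ᵇ _ _ (proj₁ (sound y∈))))
      (λ {y} e → let by = ≡ᵇ⇒≡ (b u y) j (≡⇒T e) in complete by (proj₁ (into u y by 1≤j))))
    where
    open Prefix pre
    T⇒≡ : ∀ {c} → T c → c ≡ true
    T⇒≡ {true} _ = refl
    ≡⇒T : ∀ {c} → c ≡ true → T c
    ≡⇒T refl = tt

  cnt-≤ : ∀ u {j} → 1 ≤ j → j ≤ L → cnt u j ≤ n
  cnt-≤ u 1≤j j≤L = ≤-trans (≤-reflexive (cnt-# u 1≤j j≤L)) (#-≤ _)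

abstract
  upd : ∀ {n} → (Fin n → Fin n → ℕ) → Fin n → Fin n → ℕ → Fin n → Fin n → ℕ
  upd b u v j x y = if does (x Fin.≟ u) ∧ does (y Fin.≟ v) then j else b x y

  upd-same : ∀ {n} (b : Fin n → Fin n → ℕ) u v j → upd b u v j u v ≡ j
  upd-same b u v j with u Fin.≟ u | v Fin.≟ v
  ... | yes _ | yes _ = refl
  ... | no ≢  | _     = contradiction refl ≢
  ... | yes _ | no ≢  = contradiction refl ≢

  upd-diff : ∀ {n} (b : Fin n → Fin n → ℕ) u v j {x y} → ¬ (x ≡ u × y ≡ v) → upd b u v j x y ≡ b x y
  upd-diff b u v j {x} {y} ≢ with x Fin.≟ u | y Fin.≟ v
  ... | yes e | yes e' = contradiction (e , e') ≢
  ... | yes _ | no _   = refl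
  ... | no _  | _      = refl

same? : ∀ {n} (x u y v : Fin n) → Dec (x ≡ u × y ≡ v)
same? x u y v with x Fin.≟ u | y Fin.≟ v
... | yes e | yes e' = yes (e , e')
... | yes _ | no ≢   = no (≢ ∘ proj₂)
... | no ≢  | _      = no (≢ ∘ proj₁)

module _ {n L} {pos pos' : Fin n → Fin n → ℕ} {cnt cnt' : Fin n → ℕ → ℕ} {lst lst' : Fin n → ℕ → ℕ → ℕ}
         {b : Fin n → Fin n → ℕ} (bs : Buckets L pos cnt lst b)
         (u v : Fin n) {j} (1≤j : 1 ≤ j) (j≤L : j ≤ L) where
  open Buckets bs

  buckets-add :
    b u v ≡ 0 →
    pos' u v ≡ cnt u j →
    (∀ x y → ¬ (x ≡ u × y ≡ v) → pos' x y ≡ pos x y) →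
    cnt' u j ≡ suc (cnt u j) →
    (∀ x i → i ≤ L → ¬ (x ≡ u × i ≡ j) → cnt' x i ≡ cnt x i) →
    lst' u j (cnt u j) ≡ toℕ v →
    (∀ x i p → 1 ≤ i → i ≤ L → p < cnt x i → lst' x i p ≡ lst x i p) →
    Buckets L pos' cnt' lst' (upd b u v j)
  buckets-add buv pos-v pos-o cnt-j cnt-o lst-v lst-o = record { bounded = bounded' ; into = into' ; from = from' }
    where
    b' = upd b u v j
    bounded' : ∀ x y → b' x y ≤ L
    bounded' x y with same? x u y v
    ... | yes (refl , refl) rewrite upd-same b u v j = j≤L
    ... | no ≢ rewrite upd-diff b u v j ≢ = bounded x y
    grows : ∀ x i → i ≤ L → cnt x i ≤ cnt' x i
    grows x i i≤L with x Fin.≟ u | i Data.Nat.≟ j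
    ... | yes refl | yes refl rewrite cnt-j = n≤1+n _
    ... | yes refl | no ≢ = ≤-reflexive (sym (cnt-o x i i≤L (≢ ∘ proj₂)))
    ... | no ≢ | _ = ≤-reflexive (sym (cnt-o x i i≤L (≢ ∘ proj₁)))
    into' : ∀ x y {i} → b' x y ≡ i → 1 ≤ i → pos' x y < cnt' x i × lst' x i (pos' x y) ≡ toℕ y
    into' x y {i} e 1≤i with same? x u y v
    into' x y {i} e 1≤i | yes (refl , refl) with trans (sym (upd-same b u v j)) e
    ... | refl rewrite pos-v | cnt-j = ≤-refl , lst-v
    into' x y {i} e 1≤i | no ≢ with trans (sym (upd-diff b u v j ≢)) e
    ... | refl rewrite pos-o x y ≢ with into x y refl 1≤i
    ... | lt , eq = ≤-trans lt (grows x (b x y) (bounded x y)) , trans (lst-o x _ _ 1≤i (bounded x y) lt) eq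
    old : ∀ x {i p} → 1 ≤ i → i ≤ L → p < cnt x i → ∃ λ y → lst' x i p ≡ toℕ y × b' x y ≡ i × pos' x y ≡ p
    old x {i} {p} 1≤i i≤L p< with from x 1≤i i≤L p<
    ... | y , ly , by , py = y , trans (lst-o x i p 1≤i i≤L p<) ly , trans (upd-diff b u v j ≢) by , trans (pos-o x y ≢) py
      where
      ≢ : ¬ (x ≡ u × y ≡ v)
      ≢ (refl , refl) = contradiction (trans (sym buv) by) (<⇒≢ 1≤i)
    from' : ∀ x {i p} → 1 ≤ i → i ≤ L → p < cnt' x i → ∃ λ y → lst' x i p ≡ toℕ y × b' x y ≡ i × pos' x y ≡ p
    from' x {i} {p} 1≤i i≤L p< with x Fin.≟ u | i Data.Nat.≟ j
    ... | no ≢ | _ = old x 1≤i i≤L (subst (p <_) (cnt-o x i i≤L (≢ ∘ proj₁)) p<)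
    ... | yes refl | no ≢ = old x 1≤i i≤L (subst (p <_) (cnt-o x i i≤L (≢ ∘ proj₂)) p<)
    ... | yes refl | yes refl with m≤n⇒m<n∨m≡n (≤-pred (subst (p <_) cnt-j p<))
    ... | inj₁ lt = old x 1≤i i≤L lt
    ... | inj₂ refl = v , lst-v , upd-same b u v j , pos-v

  -- The last element `w` of the bucket fills the gap left by `v`. The case `w` = `v` is included:
  -- then the two writes change nothing, and shortening the bucket removes `v`.
  buckets-remove : ∀ {w} →
    b u v ≡ j →
    lst u j (cnt u j ∸ 1) ≡ toℕ w →
    pos' u w ≡ pos u v →
    (∀ x y → ¬ (x ≡ u × y ≡ w) → pos' x y ≡ pos x y) →
    cnt' u j ≡ cnt u j ∸ 1 →
    (∀ x i → i ≤ L → ¬ (x ≡ u × i ≡ j) → cnt' x i ≡ cnt x i) →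
    lst' u j (pos u v) ≡ toℕ w →
    (∀ x i p → 1 ≤ i → i ≤ L → p < cnt x i → ¬ (x ≡ u × i ≡ j × p ≡ pos u v) → lst' x i p ≡ lst x i p) →
    Buckets L pos' cnt' lst' (upd b u v 0)
  buckets-remove {w} buv last pos-w pos-o cnt-j cnt-o lst-p lst-o = record
      { bounded = bounded' ; into = into' ; from = from' }
    where
    b' = upd b u v 0
    p₀ = pos u v
    v-in = into u v buv 1≤j
    c = cnt u j ∸ 1
    c< : suc c ≡ cnt u j
    c< = suc-∸1 (proj₁ v-in)
    bw : b u w ≡ j × pos u w ≡ c
    bw with from u 1≤j j≤L (≤-reflexive c<)
    ... | w' , lw , bw' , pw with Fin.toℕ-injective (trans (sym lw) last)
    ... | refl = bw' , pw
    bounded' : ∀ x y → b' x y ≤ L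
    bounded' x y with same? x u y v
    ... | yes (refl , refl) rewrite upd-same b u v 0 = z≤n
    ... | no ≢ rewrite upd-diff b u v 0 ≢ = bounded x y
    into' : ∀ x y {i} → b' x y ≡ i → 1 ≤ i → pos' x y < cnt' x i × lst' x i (pos' x y) ≡ toℕ y
    into' x y {i} e 1≤i with same? x u y v
    into' x y {i} e 1≤i | yes (refl , refl) =
      contradiction (trans (sym (upd-same b u v 0)) e) (<⇒≢ 1≤i)
    into' x y {i} e 1≤i | no ≢v with same? x u y w
    into' x y {i} e 1≤i | no ≢v | yes (refl , refl)
      with trans (sym (proj₁ bw)) (trans (sym (upd-diff b u v 0 ≢v)) e)
    ... | refl rewrite pos-w | cnt-j = ≤∧≢⇒< (≤-pred (≤-trans (proj₁ v-in) (≤-reflexive (sym c<)))) p₀≢c , lst-p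
      where
      p₀≢c : p₀ ≢ c
      p₀≢c p₀≡c = ≢v (refl , Fin.toℕ-injective (trans (sym last) (trans (cong (lst u j) (sym p₀≡c)) (proj₂ v-in))))
    into' x y {i} e 1≤i | no ≢v | no ≢w with trans (sym (upd-diff b u v 0 ≢v)) e
    ... | refl rewrite pos-o x y ≢w with into x y refl 1≤i
    ... | lt , eq = lt' , trans (lst-o x _ _ 1≤i (bounded x y) lt hit) eq
      where
      hit : ¬ (x ≡ u × b x y ≡ j × pos x y ≡ p₀)
      hit (refl , bj , pe) = ≢v (refl , Fin.toℕ-injective
        (trans (sym eq) (trans (cong₂ (lst u) bj pe) (proj₂ v-in))))
      lt' : pos x y < cnt' x (b x y)
      lt' with x Fin.≟ u | b x y Data.Nat.≟ j
      ... | no ≢ | _ rewrite cnt-o x (b x y) (bounded x y) (≢ ∘ proj₁) = lt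
      ... | yes refl | no ≢ rewrite cnt-o x (b x y) (bounded x y) (≢ ∘ proj₂) = lt
      ... | yes refl | yes bj = subst (pos x y <_) (sym (trans (cong (cnt' x) bj) cnt-j))
        (≤∧≢⇒< (≤-pred (≤-trans lt (≤-reflexive (trans (cong (cnt x) bj) (sym c<))))) λ pc →
          ≢w (refl , Fin.toℕ-injective (trans (sym eq) (trans (cong₂ (lst u) bj pc) last))))
    from' : ∀ x {i p} → 1 ≤ i → i ≤ L → p < cnt' x i → ∃ λ y → lst' x i p ≡ toℕ y × b' x y ≡ i × pos' x y ≡ p
    from' x {i} {p} 1≤i i≤L p< with x Fin.≟ u | i Data.Nat.≟ j
    ... | no x≢ | _ with from x 1≤i i≤L (subst (p <_) (cnt-o x i i≤L (x≢ ∘ proj₁)) p<)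
    ... | y , ly , by , py = y , trans (lst-o x i p 1≤i i≤L (subst (p <_) (cnt-o x i i≤L (x≢ ∘ proj₁)) p<) (x≢ ∘ proj₁)) ly
      , trans (upd-diff b u v 0 (x≢ ∘ proj₁)) by , trans (pos-o x y (x≢ ∘ proj₁)) py
    from' x {i} {p} 1≤i i≤L p< | yes refl | no i≢
      with from x 1≤i i≤L (subst (p <_) (cnt-o x i i≤L (i≢ ∘ proj₂)) p<)
    ... | y , ly , by , py = y , trans
        (lst-o x i p 1≤i i≤L (subst (p <_) (cnt-o x i i≤L (i≢ ∘ proj₂)) p<) (i≢ ∘ proj₁ ∘ proj₂)) ly
      , trans (upd-diff b u v 0 λ { (_ , refl) → i≢ (trans (sym by) buv) }) by
      , trans (pos-o x y λ { (_ , refl) → i≢ (trans (sym by) (proj₁ bw)) }) py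
    from' x {i} {p} 1≤i i≤L p< | yes refl | yes refl with p Data.Nat.≟ p₀
    ... | yes refl = w , lst-p , trans (upd-diff b u v 0 w≢v) (proj₁ bw) , pos-w
      where
      w≢v : ¬ (u ≡ u × w ≡ v)
      w≢v (_ , refl) = <⇒≢ (subst (p <_) cnt-j p<) (proj₂ bw)
    ... | no p≢ with from x 1≤i i≤L p<'
      where
      p<' : p < cnt u j
      p<' = ≤-trans (subst (p <_) cnt-j p<) (m∸n≤m _ 1)
    ... | y , ly , by , py = y , trans (lst-o x i p 1≤i i≤L p<' (p≢ ∘ proj₂ ∘ proj₂)) ly
      , trans (upd-diff b u v 0 λ { (_ , refl) → p≢ (sym py) }) by
      , trans (pos-o x y λ { (_ , refl) → <⇒≢ (subst (p <_) cnt-j p<) (trans (sym py) (proj₂ bw)) }) py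
      where
      p<' : p < cnt u j
      p<' = ≤-trans (subst (p <_) cnt-j p<) (m∸n≤m _ 1)

-- Buckets in memory

posA cntA lstA stkA hVar vVar iVar kVar oVar qVar xVar pVar uArg wArg jArg newArg lastVar placeVar : ℕ
posA = 6
cntA = 7
lstA = 8
stkA = 9
hVar = 10
vVar = 11
iVar = 12
kVar = 13
oVar = 14
qVar = 15
xVar = 16
pVar = 17
uArg = 20
wArg = 21
jArg = 22
newArg = 23
lastVar = 24
placeVar = 25

infix 6 _≔_
infixl 7 _⊕_
infixl 8 _⊗_

var : ℕ → Exp
var a = read a (lit 0)

_≔_ : ℕ → Exp → Cmd
a ≔ e = write a (lit 0) e

_⊕_ _⊖_ _⊗_ _⊴_ : Exp → Exp → Exp
e ⊕ f = binop plus e f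
e ⊖ f = binop monus e f
e ⊗ f = binop times e f
e ⊴ f = binop leq e f

-- Matrices are stored row by row with row length n + Δ, which exceeds n and L.
entry : Exp → Exp → Exp
entry e f = e ⊗ (read params (lit 0) ⊕ read params (lit 1)) ⊕ f

rowE : Exp
rowE = entry (var uArg) (var jArg)

add remove rebucket : Cmd
add =
  write lstA (entry rowE (read cntA rowE)) (var wArg) ⨾
  write posA (entry (var uArg) (var wArg)) (read cntA rowE) ⨾
  write cntA rowE (read cntA rowE ⊕ lit 1)
remove =
  lastVar ≔ read lstA (entry rowE (read cntA rowE ⊖ lit 1)) ⨾
  placeVar ≔ read posA (entry (var uArg) (var wArg)) ⨾
  write lstA (entry rowE (var placeVar)) (var lastVar) ⨾
  write posA (entry (var uArg) (var lastVar)) (var placeVar) ⨾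
  write cntA rowE (read cntA rowE ⊖ lit 1)
rebucket = remove ⨾ jArg ≔ var newArg ⨾ add

bucketArrays : List ℕ
bucketArrays = posA ∷ cntA ∷ lstA ∷ jArg ∷ lastVar ∷ placeVar ∷ []

entry-< : ∀ M {x y u v} → y < M → x < u → x * M + y < u * M + v
entry-< M {x} {y} {u} {v} y< x<u = begin-strict
  x * M + y   <⟨ +-monoʳ-< (x * M) y< ⟩
  x * M + M   ≡⟨ +-comm (x * M) M ⟩
  suc x * M   ≤⟨ *-monoˡ-≤ M x<u ⟩
  u * M       ≤⟨ m≤m+n _ v ⟩
  u * M + v   ∎
  where open ≤-Reasoning

entry-injective : ∀ M {x y u v} → y < M → v < M → x * M + y ≡ u * M + v → x ≡ u × y ≡ v
entry-injective M {x} {y} {u} {v} y< v< eq with <-cmp x u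
... | tri≈ _ refl _ = refl , +-cancelˡ-≡ (x * M) y v eq
... | tri< x<u _ _  = contradiction eq (<⇒≢ (entry-< M y< x<u))
... | tri> _ _ u<x  = contradiction (sym eq) (<⇒≢ (entry-< M v< u<x))

record Layout (n Δ L B : ℕ) : Set where
  field
    10≤B : 10 ≤ B
    M<B  : n + Δ < B
    n<M  : n < n + Δ
    L<M  : L < n + Δ

module Memory (n Δ L B : ℕ) (F C : ℕ → ℕ) (layout : Layout n Δ L B) where
  open Layout layout public
  open Words B 10≤B public

  M : ℕ
  M = n + Δ

  vertex<M : (u : Fin n) → toℕ u < M
  vertex<M u = <-trans (Fin.toℕ<n u) n<M

  record Core (s : Store) : Set where
    field
      small    : Small s
      order    : s params 0 ≡ n
      maxdeg   : s params 1 ≡ Δ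
      floors≡  : ∀ k → k ≤ L → s floors k ≡ F k
      ceiling≡ : ∀ k → k ≤ L → s ceilings k ≡ C k
    width : s params 0 + s params 1 ≡ M
    width = cong₂ _+_ order maxdeg
  open Core public

  core-same : ∀ as → T (not (params ∈ᵇ as) ∧ not (floors ∈ᵇ as) ∧ not (ceilings ∈ᵇ as)) →
              ∀ {s s'} → Core s → Small s' → Same as s s' → Core s'
  core-same as t c sm q with T-∧⁻ (not (params ∈ᵇ as)) t
  ... | t₀ , t' with T-∧⁻ (not (floors ∈ᵇ as)) t'
  ... | t₁ , t₂ = record
    { small    = sm
    ; order    = trans (same q params 0 t₀) (order c)
    ; maxdeg   = trans (same q params 1 t₀) (maxdeg c)
    ; floors≡  = λ k k≤ → trans (same q floors k t₁) (floors≡ c k k≤)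
    ; ceiling≡ = λ k k≤ → trans (same q ceilings k t₂) (ceiling≡ c k k≤)
    }

  posOf : Store → Fin n → Fin n → ℕ
  posOf s u v = s posA (toℕ u * M + toℕ v)

  cntOf : Store → Fin n → ℕ → ℕ
  cntOf s u j = s cntA (toℕ u * M + j)

  lstOf : Store → Fin n → ℕ → ℕ → ℕ
  lstOf s u j p = s lstA ((toℕ u * M + j) * M + p)

  BucketsAt : Store → (Fin n → Fin n → ℕ) → Set
  BucketsAt s = Buckets L (posOf s) (cntOf s) (lstOf s)

  buckets-same : ∀ as → T (not (posA ∈ᵇ as) ∧ not (cntA ∈ᵇ as) ∧ not (lstA ∈ᵇ as)) →
                 ∀ {s s' b b'} → Same as s s' → (∀ u v → b' u v ≡ b u v) → BucketsAt s b → BucketsAt s' b'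
  buckets-same as t {s} {s'} {b} {b'} q b≡ bs with T-∧⁻ (not (posA ∈ᵇ as)) t
  ... | t₀ , t' with T-∧⁻ (not (cntA ∈ᵇ as)) t'
  ... | t₁ , t₂ = record
    { bounded = λ u v → subst (_≤ L) (sym (b≡ u v)) (bounded u v)
    ; into = λ u v {j} e 1≤j → let (lt , eq) = into u v (trans (sym (b≡ u v)) e) 1≤j in
        subst₂ _<_ (sym (same q posA _ t₀)) (sym (same q cntA _ t₁)) lt ,
        trans (same q lstA _ t₂) (trans (cong (lstOf s u j) (same q posA _ t₀)) eq)
    ; from = λ u 1≤j j≤L p< → let (v , lv , bv , pv) = from u 1≤j j≤L (subst (_ <_) (same q cntA _ t₁) p<) in
        v , trans (same q lstA _ t₂) lv , trans (b≡ u v) bv , trans (same q posA _ t₀) pv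
    }
    where open Buckets bs

  record Args (s : Store) (u v : Fin n) (j : ℕ) : Set where
    field
      arg-u : s uArg 0 ≡ toℕ u
      arg-v : s wArg 0 ≡ toℕ v
      arg-j : s jArg 0 ≡ j

  module _ (u v : Fin n) {j} (1≤j : 1 ≤ j) (j≤L : j ≤ L) where

    pos-miss : ∀ {x y : Fin n} {u v : Fin n} → ¬ (x ≡ u × y ≡ v) → toℕ x * M + toℕ y ≢ toℕ u * M + toℕ v
    pos-miss {x} {y} {u} {v} ne eq with entry-injective M (vertex<M y) (vertex<M v) eq
    ... | e , e' = ne (Fin.toℕ-injective e , Fin.toℕ-injective e')

    cnt-miss : ∀ {x i} → i ≤ L → ¬ (x ≡ u × i ≡ j) → toℕ x * M + i ≢ toℕ u * M + j
    cnt-miss i≤L ne eq with entry-injective M (≤-<-trans i≤L L<M) (≤-<-trans j≤L L<M) eq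
    ... | e , e' = ne (Fin.toℕ-injective e , e')

    lst-miss : ∀ {x i p p'} → i ≤ L → p < M → p' < M → ¬ (x ≡ u × i ≡ j × p ≡ p') →
               (toℕ x * M + i) * M + p ≢ (toℕ u * M + j) * M + p'
    lst-miss i≤L p< p'< ne eq with entry-injective M p< p'< eq
    ... | e , refl with entry-injective M (≤-<-trans i≤L L<M) (≤-<-trans j≤L L<M) e
    ... | e₁ , e₂ = ne (Fin.toℕ-injective e₁ , e₂ , refl)

    addStore : Store → ℕ → ℕ → ℕ → ℕ → Store
    addStore s U V J N = let r = U * N + J ; c = s cntA r in
      ((s [ lstA , r * N + c ↦ V ]) [ posA , U * N + V ↦ c ]) [ cntA , r ↦ c + 1 ]

    removeStore : Store → ℕ → ℕ → ℕ → ℕ → Store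
    removeStore s U V J N = let r = U * N + J ; c = s cntA r ∸ 1 ; w = s lstA (r * N + c) ; p = s posA (U * N + V) in
      ((((s [ lastVar , 0 ↦ w ]) [ placeVar , 0 ↦ p ]) [ lstA , r * N + p ↦ w ]) [ posA , U * N + w ↦ p ]) [ cntA , r ↦ c ]

    -- A program finds its addresses in variables. Treating the resulting store as a function of
    -- these values replaces all occurrences at once by the mathematical indices.
    cong-store : (f : ℕ → ℕ → ℕ → ℕ → Store) → ∀ {s} → Core s → Args s u v j →
                 f (s uArg 0) (s wArg 0) (s jArg 0) (s params 0 + s params 1) ≡ f (toℕ u) (toℕ v) j M
    cong-store f core args = lem (Args.arg-u args) (Args.arg-v args) (Args.arg-j args) (width core)
      where
      lem : ∀ {a a' b b' c c' d d'} → a ≡ a' → b ≡ b' → c ≡ c' → d ≡ d' → f a b c d ≡ f a' b' c' d'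
      lem refl refl refl refl = refl

    module _ {s b} (core : Core s) (args : Args s u v j) (bs : BucketsAt s b) where
      private
        r = toℕ u * M + j
        c = cntOf s u j

      add-buckets : b u v ≡ 0 → BucketsAt (addStore s (toℕ u) (toℕ v) j M) (upd b u v j)
      add-buckets buv = buckets-add bs u v 1≤j j≤L buv
        (get-same s posA (toℕ u * M + toℕ v) c)
        (λ x y ne → get-diff s posA (toℕ u * M + toℕ v) c (pos-miss {x} {y} {u} {v} ne))
        (trans (get-same s cntA r (c + 1)) (+-comm c 1))
        (λ x i i≤L ne → get-diff s cntA r (c + 1) (cnt-miss {x} i≤L ne))
        (get-same s lstA (r * M + c) (toℕ v))
        λ x i p 1≤i i≤L p< → get-diff s lstA (r * M + c) (toℕ v) (lst-miss {x} i≤L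
          (<-trans (≤-trans p< (cnt-≤ bs x 1≤i i≤L)) n<M) cnt<M λ { (refl , refl , refl) → <-irrefl refl p< })
        where
        cnt<M : cntOf s u j < M
        cnt<M = ≤-<-trans (cnt-≤ bs u 1≤j j≤L) n<M

      remove-buckets : b u v ≡ j → BucketsAt (removeStore s (toℕ u) (toℕ v) j M) (upd b u v 0)
      remove-buckets buv with Buckets.into bs u v buv 1≤j
      ... | p< , lst-v with Buckets.from bs u 1≤j j≤L (≤-reflexive (suc-∸1 p<))
      ... | w , lst-w , _ , _ = buckets-remove bs u v 1≤j j≤L {w = w} buv lst-w
        (trans (cong (λ z → s' posA (toℕ u * M + z)) (sym lst-w)) (get-same s posA (toℕ u * M + last) place))
        (λ x y ne → get-diff s posA (toℕ u * M + last) place λ e → pos-miss {x} {y} {u} {w} ne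
            (trans e (cong (toℕ u * M +_) lst-w)))
        (get-same s cntA r (c ∸ 1))
        (λ x i i≤L ne → get-diff s cntA r (c ∸ 1) (cnt-miss {x} i≤L ne))
        (trans (get-same s lstA (r * M + place) last) lst-w)
        λ x i p 1≤i i≤L p<' ne → get-diff s lstA (r * M + place) last (lst-miss {x} i≤L
          (<-trans (≤-trans p<' (cnt-≤ bs x 1≤i i≤L)) n<M) (<-trans (≤-trans p< (cnt-≤ bs u 1≤j j≤L)) n<M) ne)
        where
        s' = removeStore s (toℕ u) (toℕ v) j M
        last = lstOf s u j (c ∸ 1)
        place = posOf s u v

      runs-add : b u v ≡ 0 → Runs add s (time add) λ s' →
                 Small s' × Same bucketArrays s s' × BucketsAt s' (upd b u v j)
      runs-add buv = runs-straight add tt (small core)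
        (small core wArg 0 , small core cntA _ , subst (_< B) (sym count≡)
            (≤-<-trans (≤-trans (≤-reflexive (+-comm _ 1)) count<) M<B))
        λ sm → sm , same-post bucketArrays add tt ,
          subst (λ s' → BucketsAt s' (upd b u v j)) (sym (cong-store (addStore s) core args)) (add-buckets buv)
        where
        count< : suc (cntOf s u j) ≤ M
        count< = ≤-<-trans (cnt-≤ bs u 1≤j j≤L) n<M
        count≡ : s cntA (s uArg 0 * (s params 0 + s params 1) + s jArg 0) + 1 ≡ cntOf s u j + 1
        count≡ = cong (λ z → s cntA z + 1) (cong₂ _+_ (cong₂ _*_ (Args.arg-u args) (width core)) (Args.arg-j args))

      runs-remove : b u v ≡ j → Runs remove s (time remove) λ s' →
                    Small s' × Same bucketArrays s s' × BucketsAt s' (upd b u v 0)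
      runs-remove buv = runs-straight remove tt (small core)
        (small core lstA _ , small core posA _ , small core lstA _ , small core posA _ , ≤-<-trans (m∸n≤m _ 1)
            (small core cntA _))
        λ sm → sm , same-post bucketArrays remove tt ,
          subst (λ s' → BucketsAt s' (upd b u v 0)) (sym (cong-store (removeStore s) core args)) (remove-buckets buv)

  runs-rebucket : ∀ {s b b'} u v {j j'} → Core s → Args s u v j → s newArg 0 ≡ j' →
                  1 ≤ j → j ≤ L → 1 ≤ j' → j' ≤ L → b u v ≡ j →
                  b' u v ≡ j' → (∀ x y → ¬ (x ≡ u × y ≡ v) → b' x y ≡ b x y) →
                  BucketsAt s b → Runs rebucket s (time rebucket) λ s' →
                  Small s' × Same bucketArrays s s' × BucketsAt s' b'
  runs-rebucket {s} {b} {b'} u v {j} {j'} core args new 1≤j j≤L 1≤j' j'≤L buv b'uv b'o bs =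
    runs-seq (runs-remove u v 1≤j j≤L core args bs buv) λ { {s₁} (sm₁ , q₁ , bs₁) →
    runs-seq (runs-straight (jArg ≔ var newArg) tt
      {Q = λ s₂ → Small s₂ × Same (jArg ∷ []) s₁ s₂ × s₂ jArg 0 ≡ j'} sm₁ (sm₁ newArg 0)
      λ sm₂ → sm₂ , same-post (jArg ∷ []) (jArg ≔ var newArg) tt , trans (same q₁ newArg 0 tt) new)
      λ { {s₂} (sm₂ , q₂ , j₂) →
    let q₁₂ = same-trans q₁ (same-weaken (jArg ∷ []) bucketArrays tt q₂)
        core₂ = core-same bucketArrays tt core sm₂ q₁₂ in
    runs-weaken (runs-add u v 1≤j' j'≤L core₂
      (record { arg-u = trans (same q₁₂ uArg 0 tt) (Args.arg-u args)
              ; arg-v = trans (same q₁₂ wArg 0 tt) (Args.arg-v args) ; arg-j = j₂ })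
      (buckets-same (jArg ∷ []) tt q₂ (λ _ _ → refl) bs₁) (upd-same b u v 0))
      ≤-refl λ { {s₃} (sm₃ , q₃ , bs₃) → sm₃ , same-trans q₁₂ q₃ , buckets-same [] tt {s₃} {s₃} (agree λ _ _ _ → refl)
          agrees bs₃ } } }
    where
    agrees : ∀ x y → b' x y ≡ upd (upd b u v 0) u v j' x y
    agrees x y with same? x u y v
    ... | yes (refl , refl) = trans b'uv (sym (upd-same _ u v j'))
    ... | no ne = trans (b'o x y ne) (sym (trans (upd-diff _ u v j' ne) (upd-diff b u v 0 ne)))

-- Collecting the neighbours up to a given level

copyGuard : Exp
copyGuard = (var pVar ⊕ lit 1) ⊴ read cntA (entry (var vVar) (var jArg))

-- Neighbours are collected directly on the stack of suspects. `oVar` keeps the old height, so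
-- `hVar` minus `oVar` is the degree up to the current level `kVar`, which `climbGuard` compares
-- with the floor of β^k.
copyBody copy climb scan : Cmd
copyBody =
  write stkA (var hVar) (read lstA (entry (entry (var vVar) (var jArg)) (var pVar))) ⨾
  hVar ≔ var hVar ⊕ lit 1 ⨾
  pVar ≔ var pVar ⊕ lit 1
copy = pVar ≔ lit 0 ⨾ while copyGuard copyBody

climbGuard : Exp
climbGuard = (read floors (var kVar) ⊕ lit 1) ⊴ (var hVar ⊖ var oVar)

climbStep : Cmd
climbStep = kVar ≔ var kVar ⊕ lit 1 ⨾ jArg ≔ var kVar

climb = while climbGuard (climbStep ⨾ copy)

scan =
  (oVar ≔ var hVar ⨾ jArg ≔ lit 1) ⨾ copy ⨾ jArg ≔ var iVar ⨾ copy ⨾ kVar ≔ var iVar ⨾ climb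

copyArrays scanArrays : List ℕ
copyArrays = stkA ∷ hVar ∷ pVar ∷ []
scanArrays = stkA ∷ hVar ∷ pVar ∷ oVar ∷ jArg ∷ kVar ∷ []

iterCost copyCost climbCost : ℕ
iterCost  = suc (cost copyGuard) + time copyBody
copyCost  = suc (time (pVar ≔ lit 0) + suc (cost copyGuard))
climbCost = suc (cost climbGuard) + suc (time climbStep + copyCost)

leq-true : ∀ {x y} → x ≤ y → ⟦ leq ⟧ x y ≡ 1
leq-true x≤y rewrite ≤ᵇ⁺ x≤y = refl

leq-false : ∀ {x y} → y < x → ⟦ leq ⟧ x y ≡ 0
leq-false y<x rewrite ≤ᵇ-false y<x = refl

1≢0 : ∀ {x} → x ≡ 1 → x ≢ 0
1≢0 refl ()

-- This is y if x ≤ y and 1 otherwise, in the arithmetic that `codeE` performs. The value 1 can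
-- stand for all lower levels because no level is 1.
code : ℕ → ℕ → ℕ
code x y = ⟦ leq ⟧ x y * y + (1 ∸ ⟦ leq ⟧ x y)

code-below : ∀ {x y} → y < x → code x y ≡ 1
code-below y<x rewrite ≤ᵇ-false y<x = refl

code-above : ∀ {x y} → x ≤ y → code x y ≡ y
code-above {y = y} x≤y rewrite ≤ᵇ⁺ x≤y = trans (+-identityʳ _) (+-identityʳ y)

-- The bucket of row x that holds its neighbour y: lower neighbours share bucket 1, the others are
-- sorted by their level.  Only neighbours up to the larger of the two levels of y notice a move of y.
bucket : ∀ {n} → Graph n → (Fin n → ℕ) → Fin n → Fin n → ℕ
bucket G ℓ x y = if G x y then code (ℓ x) (ℓ y) else 0

bucket-edge : ∀ {n} (G : Graph n) ℓ x y → G x y ≡ true → bucket G ℓ x y ≡ code (ℓ x) (ℓ y)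
bucket-edge G ℓ x y g rewrite g = refl

bucket-none : ∀ {n} (G : Graph n) ℓ x y → G x y ≡ false → bucket G ℓ x y ≡ 0
bucket-none G ℓ x y g rewrite g = refl

record Enum {n} (G : Graph n) (ℓ : Fin n → ℕ) (v : Fin n) (j : ℕ) (us : List (Fin n)) : Set where
  field
    unique   : Unique us
    sound    : ∀ {x} → x ∈ us → G x v ≡ true × ℓ x ≤ j
    complete : ∀ {x} → G x v ≡ true → ℓ x ≤ j → x ∈ us

enum-deg : ∀ {n} {G : Graph n} {ℓ v j us} → Enum G ℓ v j us → length us ≡ deg G ℓ v j
enum-deg {us = us} e = unique-# _ us unique (λ x∈ → ∧⁺ (proj₁ (sound x∈)) (≤ᵇ⁺ (proj₂ (sound x∈))))
  (λ t → complete (proj₁ (∧⁻ t)) (≤ᵇ⁻ (proj₂ (∧⁻ t))))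
  where open Enum e

deg-≤-n : ∀ {n} {G : Graph n} {ℓ v j} → deg G ℓ v j ≤ n
deg-≤-n = #-≤ _

deg-levels : ∀ {n} (G : Graph n) ℓ v {i j} → i ≤ j → deg G ℓ v i ≤ deg G ℓ v j
deg-levels G ℓ v i≤j = deg-mono {G = G} {G} {ℓ} {ℓ} {v} λ y g le → g , ≤-trans le i≤j

module _ {n} {G : Graph n} (simple : Simple G) {ℓ : Fin n → ℕ} (4≤ℓ : ∀ x → 4 ≤ ℓ x) {L pos cnt lst}
         (bs : Buckets L pos cnt lst (bucket G ℓ)) (v : Fin n) where
  open Simple simple
  open Buckets bs

  -- As levels are at least 4, bucket 1 of row `v` holds the lower neighbours and nothing else.
  enum-start : ∀ {ys} → Prefix bs v 1 (cnt v 1) ys → Enum G ℓ v (ℓ v ∸ 1) ys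
  enum-start {ys} pre = record { unique = P.unique ; sound = sound ; complete = complete }
    where
    module P = Prefix pre
    sound : ∀ {x} → x ∈ ys → G x v ≡ true × ℓ x ≤ ℓ v ∸ 1
    sound {x} x∈ with P.sound x∈
    ... | e , _ with G v x in g
    ... | true = trans (symmetric x v) g , ∸-monoˡ-≤ 1 lower
      where
      lower : ℓ x < ℓ v
      lower = ≰⇒> λ le → contradiction (trans (sym e) (code-above le)) (<⇒≢ (≤-trans (s≤s (s≤s z≤n)) (4≤ℓ x)))
    complete : ∀ {x} → G x v ≡ true → ℓ x ≤ ℓ v ∸ 1 → x ∈ ys
    complete {x} g le = P.complete e (proj₁ (into v x e ≤-refl))
      where
      e : bucket G ℓ v x ≡ 1
      e = trans (bucket-edge G ℓ v x (trans (symmetric v x) g)) (code-below (≤-<-trans le (≤-reflexive (suc-∸1 (4≤ℓ v)))))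

  -- From `ℓ v` upwards the number of a bucket is the level of its members. Hence the new neighbours
  -- differ in level from those already collected, and no vertex occurs twice.
  enum-extend : ∀ {j us ys} → ℓ v ≤ suc j → Enum G ℓ v j us → Prefix bs v (suc j) (cnt v (suc j)) ys →
                Enum G ℓ v (suc j) (ys ++ us)
  enum-extend {j} {us} {ys} ℓv≤ enum pre = record
    { unique = ++⁺ P.unique E.unique λ { (x∈ys , x∈us) → <⇒≢ (s≤s (proj₂ (E.sound x∈us))) (proj₂ (sound-new x∈ys)) }
    ; sound = λ x∈ → [ (λ x∈ys → proj₁ (sound-new x∈ys) , ≤-reflexive (proj₂ (sound-new x∈ys)))
                     , (λ x∈us → proj₁ (E.sound x∈us) , m≤n⇒m≤1+n (proj₂ (E.sound x∈us))) ]′ (∈-++⁻ ys x∈)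
    ; complete = complete
    }
    where
    module P = Prefix pre
    module E = Enum enum
    4≤j : 4 ≤ suc j
    4≤j = ≤-trans (4≤ℓ v) ℓv≤
    sound-new : ∀ {x} → x ∈ ys → G x v ≡ true × ℓ x ≡ suc j
    sound-new {x} x∈ with P.sound x∈
    ... | e , _ with G v x in g | ℓ v ≤? ℓ x
    ... | true | yes le = trans (symmetric x v) g , trans (sym (code-above le)) e
    ... | true | no ne  = contradiction (trans (sym (code-below (≰⇒> ne))) e) (<⇒≢ (≤-trans (s≤s (s≤s z≤n)) 4≤j))
    complete : ∀ {x} → G x v ≡ true → ℓ x ≤ suc j → x ∈ ys ++ us
    complete {x} g le with m≤n⇒m<n∨m≡n le
    ... | inj₁ lt = ∈-++⁺ʳ ys (E.complete g (≤-pred lt))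
    ... | inj₂ eq = ∈-++⁺ˡ (P.complete e (proj₁ (into v x e (s≤s z≤n))))
      where
      e : bucket G ℓ v x ≡ suc j
      e = trans (bucket-edge G ℓ v x (trans (symmetric v x) g)) (trans (code-above (≤-trans ℓv≤ (≤-reflexive (sym eq)))) eq)

module Scanning (n Δ L B : ℕ) (F C : ℕ → ℕ) (layout : Layout n Δ L B) where
  open Memory n Δ L B F C layout public

  StackAt : Store → List (Fin n) → Set
  StackAt s []       = ⊤
  StackAt s (x ∷ xs) = s stkA (length xs) ≡ toℕ x × StackAt s xs

  Stack : Store → List (Fin n) → Set
  Stack s xs = s hVar 0 ≡ length xs × StackAt s xs

  stackAt-agree : ∀ {s s'} xs → (∀ p → p < length xs → s' stkA p ≡ s stkA p) → StackAt s xs → StackAt s' xs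
  stackAt-agree [] _ _ = tt
  stackAt-agree (x ∷ xs) h (e , st) = trans (h _ ≤-refl) e , stackAt-agree xs (λ p p< → h p (m<n⇒m<1+n p<)) st

  stackAt-same : ∀ as → T (not (stkA ∈ᵇ as)) → ∀ {s s'} xs → Same as s s' → StackAt s xs → StackAt s' xs
  stackAt-same as t xs q = stackAt-agree xs λ p _ → same q stkA p t

  stackAt-push : ∀ {s w} xs {h} → h ≡ length xs → StackAt s xs → StackAt (s [ stkA , h ↦ w ]) xs
  stackAt-push {s} {w} xs {h} e = stackAt-agree xs λ p p< →
    get-diff s stkA h w λ { refl → <-irrefl (trans e refl) p< }

  module _ {s₀ b} (core : Core s₀) (v : Fin n) {j} (1≤j : 1 ≤ j) (j≤L : j ≤ L)
           (v≡ : s₀ vVar 0 ≡ toℕ v) (j≡ : s₀ jArg 0 ≡ j) (bs : BucketsAt s₀ b)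
           (zs : List (Fin n)) (room : length zs + n < B) where

    private
      c = cntOf s₀ v j
      c≤n : c ≤ n
      c≤n = cnt-≤ bs v 1≤j j≤L

    record Copied (p : ℕ) (s : Store) : Set where
      field
        small-s : Small s
        frame   : Same copyArrays s₀ s
        ys      : List (Fin n)
        prefix  : Prefix bs v j p ys
        stack   : Stack s (ys ++ zs)

    private
      I : ℕ → Store → Set
      I m s = ∃ λ p → p ≤ c × s pVar 0 ≡ p × m ≡ (c ∸ p) * iterCost × Copied p s

      width-same : ∀ {s} → Same copyArrays s₀ s → s params 0 + s params 1 ≡ M
      width-same q = trans (cong₂ _+_ (same q params 0 tt) (same q params 1 tt)) (width core)

      index≡ : ∀ {s} → Same copyArrays s₀ s → s vVar 0 * (s params 0 + s params 1) + s jArg 0 ≡ toℕ v * M + j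
      index≡ q = cong₂ _+_ (cong₂ _*_ (trans (same q vVar 0 tt) v≡) (width-same q)) (trans (same q jArg 0 tt) j≡)

      copy-test : ∀ {p s} → Copied p s → s pVar 0 ≡ p → eval copyGuard s ≡ ⟦ leq ⟧ (p + 1) c
      copy-test cp p≡ = cong₂ ⟦ leq ⟧ (cong (_+ 1) p≡) (trans (same frame cntA _ tt) (cong (s₀ cntA) (index≡ frame)))
        where open Copied cp

      copy-round : ∀ {m s} → I m s → Small s × Iterate copyGuard copyBody I (λ _ → Copied c) m s
      copy-round {m} {s} (p , p≤c , p≡ , m≡ , cp) with m≤n⇒m<n∨m≡n p≤c
      ... | inj₂ refl = small-s , stop (trans (copy-test cp p≡) (leq-false (≤-reflexive (+-comm 1 c)))) cp
        where open Copied cp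
      ... | inj₁ p<c = small-s , go (time copyBody)
          (1≢0 (trans (copy-test cp p≡) (leq-true (≤-trans (≤-reflexive (+-comm p 1)) p<c))))
        (runs-straight copyBody tt small-s (small-s lstA _ , h< , p<B) λ sm →
          (c ∸ suc p) * iterCost ,
          (suc p , p<c , trans (+-comm _ 1) (cong suc p≡) , refl , record
            { small-s = sm
            ; frame = same-trans frame (same-post copyArrays copyBody tt)
            ; ys = y ∷ ys
            ; prefix = prefix-suc bs 1≤j prefix by py
            ; stack = trans (+-comm _ 1) (cong suc (proj₁ stack)) ,
                trans (trans (cong (λ z → (s [ stkA , s hVar 0 ↦ eval cell s ]) stkA z) (sym (proj₁ stack)))
                  (get-same s stkA (s hVar 0) (eval cell s))) cell≡ ,
                stackAt-agree {s [ stkA , s hVar 0 ↦ eval cell s ]} (ys ++ zs) (λ _ _ → refl)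
                  (stackAt-push (ys ++ zs) (proj₁ stack) (proj₂ stack))
            }) ,
          ≤-reflexive (trans one-less (sym m≡)))
        where
        one-less : iterCost + (c ∸ suc p) * iterCost ≡ (c ∸ p) * iterCost
        one-less = cong (_* iterCost) (sym (+-∸-assoc 1 p<c))
        open Copied cp
        cell = read lstA (entry (entry (var vVar) (var jArg)) (var pVar))
        elem = Buckets.from bs v 1≤j j≤L p<c
        y = proj₁ elem
        by = proj₁ (proj₂ (proj₂ elem))
        py = proj₂ (proj₂ (proj₂ elem))
        cell≡ : eval cell s ≡ toℕ y
        cell≡ = trans (same frame lstA _ tt) (trans (cong (s₀ lstA) (cong₂ _+_ (cong₂ _*_ (index≡ frame)
          (width-same frame)) p≡)) (proj₁ (proj₂ elem)))
        h< : s hVar 0 + 1 < B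
        h< = begin-strict
          s hVar 0 + 1               ≡⟨ cong (_+ 1) (trans (proj₁ stack) (length-++ ys)) ⟩
          length ys + length zs + 1  ≡⟨ cong (λ z → z + length zs + 1) (Prefix.size prefix) ⟩
          p + length zs + 1          ≡⟨ trans (+-comm _ 1) (cong suc (+-comm p _)) ⟩
          suc (length zs + p)        ≡⟨ sym (+-suc (length zs) p) ⟩
          length zs + suc p          ≤⟨ +-monoʳ-≤ (length zs) (≤-trans p<c c≤n) ⟩
          length zs + n              <⟨ room ⟩
          B                          ∎
          where open ≤-Reasoning
        p<B : s pVar 0 + 1 < B
        p<B = begin-strict
          s pVar 0 + 1   ≡⟨ trans (cong (_+ 1) p≡) (+-comm p 1) ⟩
          suc p          ≤⟨ ≤-trans p<c c≤n ⟩
          n              <⟨ <-trans n<M M<B ⟩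
          B              ∎
          where open ≤-Reasoning

    runs-copy : StackAt s₀ zs → s₀ hVar 0 ≡ length zs → Runs copy s₀ (copyCost + c * iterCost) (Copied c)
    runs-copy st h≡ = runs-weaken
      (runs-seq (runs-straight (pVar ≔ lit 0) tt {Q = I (c * iterCost)} (small core) (≤-trans (s≤s z≤n) 10≤B)
          λ sm → 0 , z≤n , refl , refl , record
            { small-s = sm
            ; frame = same-post copyArrays (pVar ≔ lit 0) tt
            ; ys = []
            ; prefix = prefix-zero bs
            ; stack = h≡ , stackAt-agree zs (λ _ _ → refl) st })
        (runs-while I tt copy-round))
      (≤-reflexive (lem (c * iterCost) (suc (cost copyGuard)) (time (pVar ≔ lit 0)))) id
      where
      lem : ∀ x y z → suc (z + (x + y)) ≡ suc (z + y) + x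
      lem = solve-∀

record Target {n} (F : ℕ → ℕ) (L : ℕ) (G : Graph n) (ℓ : Fin n → ℕ) (v : Fin n) (k : ℕ) : Set where
  field
    above   : ℓ v ≤ k
    within  : k ≤ L
    settled : deg G ℓ v k ≤ F k
    crowded : ∀ {j} → ℓ v ≤ j → j < k → F j < deg G ℓ v j

scanBase : ℕ
scanBase = suc (time (oVar ≔ var hVar ⨾ jArg ≔ lit 1) + suc (copyCost + suc (time (jArg ≔ var iVar) +
  suc (copyCost + suc (time (kVar ≔ var iVar) + suc (cost climbGuard))))))

module Climbing (n Δ L B : ℕ) (F C : ℕ → ℕ) (layout : Layout n Δ L B) where
  open Scanning n Δ L B F C layout public

  module _ {G : Graph n} (simple : Simple G) {ℓ : Fin n → ℕ} (4≤ℓ : ∀ x → 4 ≤ ℓ x) (ℓ≤L : ∀ x → ℓ x ≤ L)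
           {s₀} (core : Core s₀) (bs : BucketsAt s₀ (bucket G ℓ)) (v : Fin n) (v≡ : s₀ vVar 0 ≡ toℕ v)
           (i≡ : s₀ iVar 0 ≡ ℓ v) (zs : List (Fin n)) (room : length zs + n + n < B) where

    private
      D : ℕ → ℕ
      D = deg G ℓ v

      gap : ℕ → ℕ → ℕ
      gap i j = (D j ∸ D i) * iterCost

    record Scanned (k : ℕ) (s : Store) : Set where
      field
        small-s : Small s
        frame   : Same scanArrays s₀ s
        o≡      : s oVar 0 ≡ length zs
        us      : List (Fin n)
        enum    : Enum G ℓ v k us
        stack   : Stack s (us ++ zs)

    scanned-step : ∀ {k s} c → T (targets c (jArg ∷ kVar ∷ [])) → Scanned k s →
                   Small (post c s) → Scanned k (post c s)
    scanned-step {k} {s} c t sc sm = record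
      { small-s = sm
      ; frame = same-trans frame (same-weaken (jArg ∷ kVar ∷ []) scanArrays tt q)
      ; o≡ = trans (same q oVar 0 tt) o≡
      ; us = us
      ; enum = enum
      ; stack = trans (same q hVar 0 tt) (proj₁ stack) , stackAt-same (jArg ∷ kVar ∷ []) tt (us ++ zs) q (proj₂ stack)
      }
      where
      open Scanned sc
      q = same-post (jArg ∷ kVar ∷ []) c t

    room-us : ∀ {k us} → Enum G ℓ v k us → length (us ++ zs) + n < B
    room-us {k} {us} e = begin-strict
      length (us ++ zs) + n         ≡⟨ cong (_+ n) (length-++ us) ⟩
      length us + length zs + n     ≤⟨ +-monoˡ-≤ n
          (+-monoˡ-≤ (length zs) (≤-trans (≤-reflexive (enum-deg e)) (deg-≤-n {G = G} {ℓ} {v} {k}))) ⟩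
      n + length zs + n             ≡⟨ cong (_+ n) (+-comm n _) ⟩
      length zs + n + n             <⟨ room ⟩
      B                             ∎
      where open ≤-Reasoning

    extend : ∀ {k s} → Scanned k s → s jArg 0 ≡ suc k → ℓ v ≤ suc k → suc k ≤ L →
             Runs copy s (copyCost + gap k (suc k)) λ s' → Scanned (suc k) s' × s' kVar 0 ≡ s kVar 0
    extend {k} {s} sc j≡ ℓv≤ k≤L = runs-weaken
      (runs-copy core' v (s≤s z≤n) k≤L (trans (same frame vVar 0 tt) v≡) j≡ bs' (us ++ zs)
        (room-us enum) (proj₂ stack) (proj₁ stack))
      (≤-reflexive (cong (λ z → copyCost + z * iterCost) count))
      λ { {s'} cp → record
        { small-s = Copied.small-s cp
        ; frame = same-trans frame (same-weaken copyArrays scanArrays tt (Copied.frame cp))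
        ; o≡ = trans (same (Copied.frame cp) oVar 0 tt) o≡
        ; us = Copied.ys cp ++ us
        ; enum = enum-extend simple 4≤ℓ bs' v ℓv≤ enum (Copied.prefix cp)
        ; stack = subst (Stack s') (sym (++-assoc (Copied.ys cp) us zs)) (Copied.stack cp)
        } , same (Copied.frame cp) kVar 0 tt }
      where
      open Scanned sc
      core' = core-same scanArrays tt core small-s frame
      bs' = buckets-same scanArrays tt frame (λ _ _ → refl) bs
      count : cntOf s v (suc k) ≡ D (suc k) ∸ D k
      count with bucket-prefix bs' v (s≤s z≤n) k≤L (cntOf s v (suc k)) ≤-refl
      ... | ys , pre = sym (begin
        D (suc k) ∸ D k                        ≡⟨ cong₂ _∸_
            (sym (enum-deg (enum-extend simple 4≤ℓ bs' v ℓv≤ enum pre))) (sym (enum-deg enum)) ⟩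
        length (ys ++ us) ∸ length us          ≡⟨ cong (_∸ length us) (length-++ ys) ⟩
        length ys + length us ∸ length us      ≡⟨ m+n∸n≡m _ (length us) ⟩
        length ys                              ≡⟨ Prefix.size pre ⟩
        cntOf s v (suc k)                      ∎)
        where open ≡-Reasoning

    module _ {k*} (target : Target F L G ℓ v k*) where
      open Target target

      private
        credits : ℕ → ℕ
        credits k = (k* ∸ k) * climbCost + gap k k*

        I : ℕ → Store → Set
        I m s = ∃ λ k → ℓ v ≤ k × k ≤ k* × s kVar 0 ≡ k × m ≡ credits k × Scanned k s

        Reached : Store → Set
        Reached s = s kVar 0 ≡ k* × Scanned k* s

        -- The copying costs of successive levels telescope, so a climb through many levels still
        -- pays for each collected neighbour only once.
        gap-add : ∀ {i j k} → i ≤ j → j ≤ k → gap i j + gap j k ≡ gap i k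
        gap-add {i} {j} {k} i≤j j≤k = trans (sym (*-distribʳ-+ iterCost (D j ∸ D i) (D k ∸ D j)))
          (cong (_* iterCost) (trans (+-comm (D j ∸ D i) _) (trans (sym (+-∸-assoc (D k ∸ D j) (deg-levels G ℓ v i≤j)))
            (cong (_∸ D i) (m∸n+n≡m (deg-levels G ℓ v j≤k))))))

        climb-test : ∀ {k s} → k ≤ k* → s kVar 0 ≡ k → Scanned k s → eval climbGuard s ≡ ⟦ leq ⟧ (F k + 1) (D k)
        climb-test {k} k≤k* k≡ sc = cong₂ ⟦ leq ⟧
          (cong (_+ 1) (trans (same frame floors _ tt) (trans (cong (s₀ floors) k≡) (floors≡ core k (≤-trans k≤k* within)))))
          (trans (cong₂ _∸_ (trans (proj₁ stack) (length-++ us)) o≡) (trans (m+n∸n≡m _ (length zs)) (enum-deg enum)))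
          where open Scanned sc

        climb-round : ∀ {m s} → I m s → Small s × Iterate climbGuard (climbStep ⨾ copy) I (λ _ → Reached) m s
        climb-round {m} {s} (k , ℓv≤k , k≤k* , k≡ , m≡ , sc) with m≤n⇒m<n∨m≡n k≤k*
        ... | inj₂ refl = Scanned.small-s sc , stop
            (trans (climb-test k≤k* k≡ sc) (leq-false (≤-<-trans settled (≤-reflexive (+-comm 1 (F k)))))) (k≡ , sc)
        ... | inj₁ k<k* = Scanned.small-s sc , go (suc (time climbStep + (copyCost + gap k (suc k))))
          (1≢0 (trans (climb-test k≤k* k≡ sc) (leq-true (≤-trans (≤-reflexive (+-comm (F k) 1)) (crowded ℓv≤k k<k*)))))
          (runs-seq (runs-straight climbStep tt {Q = λ s' → Scanned k s' × s' kVar 0 ≡ suc k × s' jArg 0 ≡ suc k}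
              small-s (k<B , k<B) λ sm → scanned-step climbStep tt sc sm , k'≡ , k'≡)
            λ { {s₁} (sc₁ , k₁ , j₁) → runs-weaken
              (extend sc₁ j₁ (m≤n⇒m≤1+n ℓv≤k) (≤-trans k<k* within)) ≤-refl
              λ { (sc₂ , k₂) → credits (suc k) ,
                (suc k , m≤n⇒m≤1+n ℓv≤k , k<k* , trans k₂ k₁ , refl , sc₂) , ≤-reflexive pays } })
          where
          open Scanned sc
          k'≡ : s kVar 0 + 1 ≡ suc k
          k'≡ = trans (cong (_+ 1) k≡) (+-comm k 1)
          k<B : s kVar 0 + 1 < B
          k<B = subst (_< B) (sym k'≡) (≤-<-trans (≤-trans k<k* within) (<-trans L<M M<B))
          pays : suc (cost climbGuard) + suc (time climbStep + (copyCost + gap k (suc k))) + credits (suc k) ≡ m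
          pays = trans (lem (suc (cost climbGuard)) (time climbStep) copyCost (gap k (suc k))
              ((k* ∸ suc k) * climbCost) (gap (suc k) k*))
            (trans (cong₂ (λ x y → x * climbCost + y) (sym (+-∸-assoc 1 k<k*)) (gap-add (n≤1+n k) k<k*)) (sym m≡))
            where
            lem : ∀ g t c x y z → g + suc (t + (c + x)) + (y + z) ≡ (g + suc (t + c) + y) + (x + z)
            lem = solve-∀

      runs-scan : StackAt s₀ zs → s₀ hVar 0 ≡ length zs →
                  Runs scan s₀ (scanBase + (D k* * iterCost + (k* ∸ ℓ v) * climbCost)) Reached
      runs-scan st h≡ = runs-weaken
        (runs-seq (runs-straight first tt
            {Q = λ s → Small s × Same (oVar ∷ jArg ∷ []) s₀ s × s oVar 0 ≡ length zs × s jArg 0 ≡ 1}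
            (small core) (small core hVar 0 , ≤-trans (s≤s (s≤s z≤n)) 10≤B)
            λ sm → sm , same-post (oVar ∷ jArg ∷ []) first tt , h≡ , refl)
          λ { {s₁} (sm₁ , q₁ , o₁ , j₁) → runs-seq (copy-lower sm₁ q₁ o₁ j₁)
          λ { {s₂} sc₂ → runs-seq (runs-straight (jArg ≔ var iVar) tt
              {Q = λ s → Scanned (ℓ v ∸ 1) s × s jArg 0 ≡ suc (ℓ v ∸ 1)} (Scanned.small-s sc₂) (Scanned.small-s sc₂ iVar 0)
              λ sm → scanned-step (jArg ≔ var iVar) tt sc₂ sm , trans (same (Scanned.frame sc₂) iVar 0 tt)
                  (trans i≡ (sym ℓv≡)))
          λ { {s₃} (sc₃ , j₃) → runs-seq (extend sc₃ j₃ (≤-reflexive (sym ℓv≡)) (≤-trans (≤-reflexive ℓv≡) (ℓ≤L v)))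
          λ { {s₄} (sc₄ , _) → runs-seq (runs-straight (kVar ≔ var iVar) tt
              {Q = I (credits (ℓ v))} (Scanned.small-s sc₄) (Scanned.small-s sc₄ iVar 0)
              λ sm → ℓ v , ≤-refl , above , trans (same (Scanned.frame sc₄) iVar 0 tt) i≡ , refl ,
                scanned-step (kVar ≔ var iVar) tt (subst (λ j → Scanned j s₄) ℓv≡ sc₄) sm)
          (runs-while I tt climb-round) } } } })
        (≤-reflexive total) id
        where
        first = oVar ≔ var hVar ⨾ jArg ≔ lit 1
        ℓv≡ : suc (ℓ v ∸ 1) ≡ ℓ v
        ℓv≡ = suc-∸1 (4≤ℓ v)
        copy-lower : ∀ {s} → Small s → Same (oVar ∷ jArg ∷ []) s₀ s → s oVar 0 ≡ length zs → s jArg 0 ≡ 1 →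
                     Runs copy s (copyCost + D (ℓ v ∸ 1) * iterCost) (Scanned (ℓ v ∸ 1))
        copy-lower {s} sm q o≡ j≡ = runs-weaken
          (runs-copy (core-same (oVar ∷ jArg ∷ []) tt core sm q) v ≤-refl (≤-trans (s≤s z≤n) (≤-trans (4≤ℓ v) (ℓ≤L v)))
            (trans (same q vVar 0 tt) v≡) j≡ bs' zs (≤-<-trans (m≤m+n _ n) room)
            (stackAt-same (oVar ∷ jArg ∷ []) tt zs q st) (trans (same q hVar 0 tt) h≡))
          (≤-reflexive (cong (λ z → copyCost + z * iterCost) count))
          λ cp → record
            { small-s = Copied.small-s cp
            ; frame = same-trans (same-weaken (oVar ∷ jArg ∷ []) scanArrays tt q)
                (same-weaken copyArrays scanArrays tt (Copied.frame cp))
            ; o≡ = trans (same (Copied.frame cp) oVar 0 tt) o≡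
            ; us = Copied.ys cp
            ; enum = enum-start simple 4≤ℓ bs' v (Copied.prefix cp)
            ; stack = Copied.stack cp
            }
          where
          bs' = buckets-same (oVar ∷ jArg ∷ []) tt q (λ _ _ → refl) bs
          count : cntOf s v 1 ≡ D (ℓ v ∸ 1)
          count with bucket-prefix bs' v ≤-refl (≤-trans (s≤s z≤n) (≤-trans (4≤ℓ v) (ℓ≤L v))) (cntOf s v 1) ≤-refl
          ... | ys , pre = trans (sym (Prefix.size pre)) (enum-deg (enum-start simple 4≤ℓ bs' v pre))
        total : suc (time first + suc (copyCost + D (ℓ v ∸ 1) * iterCost + suc (time (jArg ≔ var iVar) +
                  suc (copyCost + gap (ℓ v ∸ 1) (suc (ℓ v ∸ 1)) + suc
                      (time (kVar ≔ var iVar) + (credits (ℓ v) + suc (cost climbGuard)))))))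
                ≡ scanBase + (D k* * iterCost + (k* ∸ ℓ v) * climbCost)
        total = begin
          _ ≡⟨ lem (time first) copyCost (D (ℓ v ∸ 1) * iterCost) (time (jArg ≔ var iVar)) (gap (ℓ v ∸ 1) (suc (ℓ v ∸ 1)))
                (time (kVar ≔ var iVar)) ((k* ∸ ℓ v) * climbCost) (gap (ℓ v) k*) (suc (cost climbGuard)) ⟩
          scanBase + (D (ℓ v ∸ 1) * iterCost + (gap (ℓ v ∸ 1) (suc (ℓ v ∸ 1)) + gap (ℓ v) k*) + (k* ∸ ℓ v) * climbCost)
            ≡⟨ cong (λ z → scanBase + (D (ℓ v ∸ 1) * iterCost + z + (k* ∸ ℓ v) * climbCost))
                 (trans (cong (λ z → gap (ℓ v ∸ 1) z + gap (ℓ v) k*) ℓv≡) (gap-add (m∸n≤m (ℓ v) 1) above)) ⟩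
          scanBase + (D (ℓ v ∸ 1) * iterCost + gap (ℓ v ∸ 1) k* + (k* ∸ ℓ v) * climbCost)
            ≡⟨ cong (λ z → scanBase + (z + (k* ∸ ℓ v) * climbCost))
                 (trans (sym (*-distribʳ-+ iterCost (D (ℓ v ∸ 1)) (D k* ∸ D (ℓ v ∸ 1)))) (cong (_* iterCost)
                   (m+[n∸m]≡n (deg-levels G ℓ v (≤-trans (m∸n≤m (ℓ v) 1) above))))) ⟩
          scanBase + (D k* * iterCost + (k* ∸ ℓ v) * climbCost) ∎
          where
          open ≡-Reasoning
          lem : ∀ a c d b g e k h w → suc (a + suc (c + d + suc (b + suc (c + g + suc (e + (k + h + w))))))
                ≡ suc (a + suc (c + suc (b + suc (c + suc (e + w))))) + (d + (g + h) + k)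
          lem = solve-∀

-- Assigning a new level

codeE : Exp → Exp → Exp
codeE e f = (e ⊴ f) ⊗ f ⊕ (lit 1 ⊖ (e ⊴ f))

levelE : Exp → Exp
levelE e = read levels e

-- The loop walks down the collected neighbours with `qVar` and leaves `hVar` alone: the relabelled
-- neighbours stay on the stack, because the move of `v` may have made them dirty.
relabelGuard : Exp
relabelGuard = (var oVar ⊕ lit 1) ⊴ var qVar

fetch reverse relabelBody adjust publish relevel : Cmd
fetch =
  qVar ≔ var qVar ⊖ lit 1 ⨾
  xVar ≔ read stkA (var qVar) ⨾
  uArg ≔ var xVar ⨾
  wArg ≔ var vVar ⨾
  jArg ≔ codeE (levelE (var xVar)) (var iVar) ⨾
  newArg ≔ codeE (levelE (var xVar)) (var kVar)
reverse =
  uArg ≔ var vVar ⨾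
  wArg ≔ var xVar ⨾
  jArg ≔ codeE (var iVar) (levelE (var xVar)) ⨾
  newArg ≔ codeE (var kVar) (levelE (var xVar))
relabelBody = fetch ⨾ rebucket ⨾ reverse ⨾ rebucket
adjust = kVar ≔ var kVar ⊖ (var kVar ⊴ var iVar) ⨾ qVar ≔ var hVar
publish = write levels (var vVar) (var kVar)
relevel = scan ⨾ adjust ⨾ while relabelGuard relabelBody ⨾ publish

relabelArrays : List ℕ
relabelArrays = posA ∷ cntA ∷ lstA ∷ jArg ∷ lastVar ∷ placeVar ∷ qVar ∷ xVar ∷ uArg ∷ wArg ∷ newArg ∷ []

relabelTime relabelCost relevelBase : ℕ
relabelTime = suc (time fetch + suc (time rebucket + suc (time reverse + time rebucket)))
relabelCost = suc (cost relabelGuard) + relabelTime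
relevelBase = suc (scanBase + suc (time adjust + suc (suc (cost relabelGuard) + time publish)))

code-≤ : ∀ x {y m} → y ≤ m → 1 ≤ m → code x y ≤ m
code-≤ x {y} y≤m 1≤m with x ≤? y
... | yes le = ≤-trans (≤-reflexive (code-above le)) y≤m
... | no ne  = ≤-trans (≤-reflexive (code-below (≰⇒> ne))) 1≤m

code-≥ : ∀ x {y} → 1 ≤ y → 1 ≤ code x y
code-≥ x {y} 1≤y with x ≤? y
... | yes le = ≤-trans 1≤y (≤-reflexive (sym (code-above le)))
... | no ne  = ≤-reflexive (sym (code-below (≰⇒> ne)))

module Relabelling (n Δ L B : ℕ) (F C : ℕ → ℕ) (layout : Layout n Δ L B) where
  open Climbing n Δ L B F C layout public

  L<B : L < B
  L<B = <-trans L<M M<B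

  record Mem (G : Graph n) (ℓ : Fin n → ℕ) (xs : List (Fin n)) (s : Store) : Set where
    field
      core    : Core s
      level   : ∀ x → s levels (toℕ x) ≡ ℓ x
      buckets : BucketsAt s (bucket G ℓ)
      stack   : Stack s xs

  module _ {G : Graph n} (simple : Simple G) {ℓ ℓ' : Fin n → ℕ}
           (4≤ℓ : ∀ x → 4 ≤ ℓ x) (ℓ≤L : ∀ x → ℓ x ≤ L) (4≤ℓ' : ∀ x → 4 ≤ ℓ' x) (ℓ'≤L : ∀ x → ℓ' x ≤ L)
           (v : Fin n) (others : ∀ x → x ≢ v → ℓ' x ≡ ℓ x) {k*} (ℓ≤k* : ℓ v ≤ k*) (ℓ'≤k* : ℓ' v ≤ k*) where
    open Simple simple

    Touched : List (Fin n) → Fin n → Fin n → Set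
    Touched rest x y = (y ≡ v × x ∈ rest) ⊎ (x ≡ v × y ∈ rest)

    -- `k*` bounds the old and the new level of `v`. For a neighbour beyond `k*`, `v` is in the
    -- bucket of lower vertices both times, and in the row of `v` that neighbour is filed under its
    -- own unchanged level both times.
    untouched : ∀ {us} → Enum G ℓ v k* us → ∀ x y → ¬ Touched us x y → bucket G ℓ x y ≡ bucket G ℓ' x y
    untouched {us} enum x y ne with G x y in g
    ... | false = refl
    ... | true with x Fin.≟ v | y Fin.≟ v
    ... | no x≢ | no y≢ rewrite others x x≢ | others y y≢ = refl
    ... | yes refl | yes refl = contradiction (trans (sym g) (irreflexive v)) λ ()
    ... | yes refl | no y≢ rewrite others y y≢ =
      trans (code-above (<⇒≤ (≤-<-trans ℓ≤k* k*<))) (sym (code-above (<⇒≤ (≤-<-trans ℓ'≤k* k*<))))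
      where
      k*< : k* < ℓ y
      k*< = ≰⇒> λ le → ne (inj₂ (refl , Enum.complete enum (trans (symmetric y v) g) le))
    ... | no x≢ | yes refl rewrite others x x≢ =
      trans (code-below (≤-<-trans ℓ≤k* k*<)) (sym (code-below (≤-<-trans ℓ'≤k* k*<)))
      where
      k*< : k* < ℓ x
      k*< = ≰⇒> λ le → ne (inj₁ (refl , Enum.complete enum g le))

    module _ {s₀ us zs} (core : Core s₀) (level : ∀ x → s₀ levels (toℕ x) ≡ ℓ x) (bs : BucketsAt s₀ (bucket G ℓ))
             (v≡ : s₀ vVar 0 ≡ toℕ v) (i≡ : s₀ iVar 0 ≡ ℓ v) (k≡ : s₀ kVar 0 ≡ ℓ' v) (o≡ : s₀ oVar 0 ≡ length zs)
             (q≡ : s₀ qVar 0 ≡ length (us ++ zs)) (enum : Enum G ℓ v k* us) (st : StackAt s₀ (us ++ zs)) where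

      -- During the loop the table `b` belongs to neither assignment: the two entries of each edge
      -- from `v` to `rest` still have their old codes, all other entries are already those of `ℓ'`.
      record Pending (rest : List (Fin n)) (s : Store) : Set where
        field
          small-s : Small s
          frame   : Same relabelArrays s₀ s
          unique  : Unique rest
          edges   : ∀ {x} → x ∈ rest → G x v ≡ true
          q≡-s    : s qVar 0 ≡ length (rest ++ zs)
          st-s    : StackAt s (rest ++ zs)
          {b}     : Fin n → Fin n → ℕ
          bs-s    : BucketsAt s b
          old     : ∀ {x} → x ∈ rest → b x v ≡ code (ℓ x) (ℓ v) × b v x ≡ code (ℓ v) (ℓ x)
          new     : ∀ x y → ¬ Touched rest x y → b x y ≡ bucket G ℓ' x y

      private
        J : ℕ → Store → Set
        J m s = ∃ λ rest → m ≡ length rest * relabelCost × Pending rest s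

      relabel-step : ∀ {x rest s} → Pending (x ∷ rest) s → Runs relabelBody s relabelTime (Pending rest)
      relabel-step {x} {rest} {s} pd =
        runs-seq (runs-straight fetch tt {Q = Fetched} small-s
            (q<B , small-s stkA _ , small-s stkA _ , small-s vVar 0 ,
             subst (_< B) (sym j≡) code<B , subst (_< B) (sym new≡) code'<B)
          λ sm → sm , same-post _ fetch tt , q'≡ , x'≡ , record { arg-u = x'≡ ; arg-v = v-s ; arg-j = j≡ } , new≡)
        λ { {s₁} (sm₁ , q₁ , qq₁ , x₁ , args₁ , new₁) → runs-seq
          (runs-rebucket {s₁} {b} {b₁} x v (core-same relabelArrays tt core sm₁ (same-trans frame (weaken q₁))) args₁ new₁
            (code-≥ (ℓ x) 1≤i) (code-≤ (ℓ x) i≤L (≤-trans 1≤i i≤L)) (code-≥ (ℓ x) 1≤k) (code-≤ (ℓ x) k≤L (≤-trans 1≤i i≤L))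
            (proj₁ (old (here refl))) (upd-same b x v _) (λ y z ne → upd-diff b x v _ ne)
            (buckets-same fetchArrays tt q₁ (λ _ _ → refl) bs-s))
        λ { {s₂} (sm₂ , q₂ , bs₂) → let q₁₂ = same-trans (weaken q₁) (weaken' q₂) in runs-seq
          (runs-straight reverse tt {Q = λ s₃ → Small s₃ × Same reverseArrays s₂ s₃ × Args s₃ v x (code (ℓ v) (ℓ x)) ×
              s₃ newArg 0 ≡ code (ℓ' v) (ℓ x)}
            sm₂ (sm₂ vVar 0 , sm₂ xVar 0 , subst (_< B) (sym (rj≡ q₁₂ q₂ x₁))
                (≤-<-trans (code-≤ (ℓ v) (ℓ≤L x) (≤-trans 1≤i i≤L)) L<B) ,
              subst (_< B) (sym (rnew≡ q₁₂ q₂ x₁)) (≤-<-trans (code-≤ (ℓ' v) (ℓ≤L x) (≤-trans 1≤i i≤L)) L<B))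
            λ sm → sm , same-post reverseArrays reverse tt ,
              record { arg-u = trans (same q₁₂ vVar 0 tt) v-s ; arg-v = trans (same q₂ xVar 0 tt) x₁ ; arg-j = rj≡ q₁₂
                  q₂ x₁ } ,
              rnew≡ q₁₂ q₂ x₁)
        λ { {s₃} (sm₃ , q₃ , args₃ , new₃) → let q₁₃ = same-trans q₁₂ (same-weaken reverseArrays relabelArrays tt q₃) in runs-weaken
          (runs-rebucket {s₃} {b₁} {b₂} v x (core-same relabelArrays tt core sm₃ (same-trans frame q₁₃)) args₃ new₃
            (code-≥ (ℓ v) (≤-trans (s≤s z≤n) (4≤ℓ x))) (code-≤ (ℓ v) (ℓ≤L x) (≤-trans 1≤i i≤L))
            (code-≥ (ℓ' v) (≤-trans (s≤s z≤n) (4≤ℓ x))) (code-≤ (ℓ' v) (ℓ≤L x) (≤-trans 1≤i i≤L))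
            (trans (upd-diff b x v _ λ { (v≡x , _) → x≢v (sym v≡x) }) (proj₂ (old (here refl))))
            (upd-same b₁ v x _) (λ y z ne → upd-diff b₁ v x _ ne)
            (buckets-same reverseArrays tt q₃ (λ _ _ → refl) bs₂))
          ≤-refl
        λ { {s₄} (sm₄ , q₄ , bs₄) → let q₁₄ = same-trans q₁₃ (weaken' q₄) in record
          { small-s = sm₄
          ; frame = same-trans frame q₁₄
          ; unique = tailU unique
          ; edges = edges ∘ there
          ; q≡-s = trans (same q₄ qVar 0 tt) (trans (same q₃ qVar 0 tt) (trans (same q₂ qVar 0 tt) qq₁))
          ; st-s = stackAt-same relabelArrays tt (rest ++ zs) q₁₄ (proj₂ st-s)
          ; bs-s = bs₄
          ; old = old'
          ; new = new'
          } } } } }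
        where
        open Pending pd
        fetchArrays : List ℕ
        fetchArrays = qVar ∷ xVar ∷ uArg ∷ wArg ∷ jArg ∷ newArg ∷ []
        reverseArrays : List ℕ
        reverseArrays = uArg ∷ wArg ∷ jArg ∷ newArg ∷ []
        weaken : ∀ {s s'} → Same fetchArrays s s' → Same relabelArrays s s'
        weaken = same-weaken fetchArrays relabelArrays tt
        weaken' : ∀ {s s'} → Same bucketArrays s s' → Same relabelArrays s s'
        weaken' = same-weaken bucketArrays relabelArrays tt
        Fetched : Store → Set
        Fetched s₁ = Small s₁ × Same fetchArrays s s₁ × s₁ qVar 0 ≡ length (rest ++ zs) × s₁ xVar 0 ≡ toℕ x ×
                     Args s₁ x v (code (ℓ x) (ℓ v)) × s₁ newArg 0 ≡ code (ℓ x) (ℓ' v)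
        tailU : ∀ {x : Fin n} {xs} → Unique (x ∷ xs) → Unique xs
        tailU (_ ∷ u) = u
        headU : ∀ {x : Fin n} {xs} → Unique (x ∷ xs) → x ∉ xs
        headU (a ∷ _) x∈ = All.lookup a x∈ refl
        x≢v : x ≢ v
        x≢v refl = contradiction (trans (sym (edges (here refl))) (irreflexive v)) λ ()
        1≤i : 1 ≤ ℓ v
        1≤i = ≤-trans (s≤s z≤n) (4≤ℓ v)
        1≤k : 1 ≤ ℓ' v
        1≤k = ≤-trans (s≤s z≤n) (4≤ℓ' v)
        i≤L : ℓ v ≤ L
        i≤L = ℓ≤L v
        k≤L : ℓ' v ≤ L
        k≤L = ℓ'≤L v
        v-s : s vVar 0 ≡ toℕ v
        v-s = trans (same frame vVar 0 tt) v≡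
        q'≡ : s qVar 0 ∸ 1 ≡ length (rest ++ zs)
        q'≡ = cong (_∸ 1) q≡-s
        q<B : s qVar 0 ∸ 1 < B
        q<B = ≤-<-trans (m∸n≤m _ 1) (small-s qVar 0)
        x'≡ : s stkA (s qVar 0 ∸ 1) ≡ toℕ x
        x'≡ = trans (cong (s stkA) q'≡) (proj₁ st-s)
        lx≡ : s levels (s stkA (s qVar 0 ∸ 1)) ≡ ℓ x
        lx≡ = trans (cong (s levels) x'≡) (trans (same frame levels _ tt) (level x))
        j≡ : code (s levels (s stkA (s qVar 0 ∸ 1))) (s iVar 0) ≡ code (ℓ x) (ℓ v)
        j≡ = cong₂ code lx≡ (trans (same frame iVar 0 tt) i≡)
        new≡ : code (s levels (s stkA (s qVar 0 ∸ 1))) (s kVar 0) ≡ code (ℓ x) (ℓ' v)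
        new≡ = cong₂ code lx≡ (trans (same frame kVar 0 tt) k≡)
        code<B : code (ℓ x) (ℓ v) < B
        code<B = ≤-<-trans (code-≤ (ℓ x) i≤L (≤-trans 1≤i i≤L)) L<B
        code'<B : code (ℓ x) (ℓ' v) < B
        code'<B = ≤-<-trans (code-≤ (ℓ x) k≤L (≤-trans 1≤i i≤L)) L<B
        b₁ = upd b x v (code (ℓ x) (ℓ' v))
        b₂ = upd b₁ v x (code (ℓ' v) (ℓ x))
        lx₂ : ∀ {s₁ s₂} → Same relabelArrays s s₂ → Same bucketArrays s₁ s₂ → s₁ xVar 0 ≡ toℕ x → s₂ levels (s₂ xVar 0) ≡ ℓ x
        lx₂ {s₁} {s₂} q q' e = trans (cong (s₂ levels) (trans (same q' xVar 0 tt) e))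
          (trans (same q levels _ tt) (trans (same frame levels _ tt) (level x)))
        rj≡ : ∀ {s₁ s₂} → Same relabelArrays s s₂ → Same bucketArrays s₁ s₂ → s₁ xVar 0 ≡ toℕ x →
              code (s₂ iVar 0) (s₂ levels (s₂ xVar 0)) ≡ code (ℓ v) (ℓ x)
        rj≡ q q' e = cong₂ code (trans (same q iVar 0 tt) (trans (same frame iVar 0 tt) i≡)) (lx₂ q q' e)
        rnew≡ : ∀ {s₁ s₂} → Same relabelArrays s s₂ → Same bucketArrays s₁ s₂ → s₁ xVar 0 ≡ toℕ x →
                code (s₂ kVar 0) (s₂ levels (s₂ xVar 0)) ≡ code (ℓ' v) (ℓ x)
        rnew≡ q q' e = cong₂ code (trans (same q kVar 0 tt) (trans (same frame kVar 0 tt) k≡)) (lx₂ q q' e)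
        old' : ∀ {y} → y ∈ rest → b₂ y v ≡ code (ℓ y) (ℓ v) × b₂ v y ≡ code (ℓ v) (ℓ y)
        old' {y} y∈ =
          trans (upd-diff b₁ v x _ (λ { (_ , refl) → x≢v refl }))
              (trans (upd-diff b x v _ λ { (refl , _) → headU unique y∈ }) (proj₁ (old (there y∈)))) ,
          trans (upd-diff b₁ v x _ (λ { (_ , refl) → headU unique y∈ }))
              (trans (upd-diff b x v _ λ { (refl , _) → x≢v refl }) (proj₂ (old (there y∈))))
        new' : ∀ y z → ¬ Touched rest y z → b₂ y z ≡ bucket G ℓ' y z
        new' y z ne with same? y v z x
        ... | yes (refl , refl) = trans (upd-same b₁ v x _) (trans (cong (code (ℓ' v)) (sym (others x x≢v)))
                                    (sym (bucket-edge G ℓ' v x (trans (symmetric v x) (edges (here refl))))))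
        ... | no ne₁ with same? y x z v
        ... | yes (refl , refl) = trans (upd-diff b₁ v x _ ne₁)
            (trans (upd-same b x v _) (trans (cong (λ l → code l (ℓ' v)) (sym (others x x≢v)))
                                    (sym (bucket-edge G ℓ' x v (edges (here refl))))))
        ... | no ne₂ = trans (upd-diff b₁ v x _ ne₁) (trans (upd-diff b x v _ ne₂) (new y z λ
          { (inj₁ (refl , here refl)) → ne₂ (refl , refl)
          ; (inj₁ (refl , there y∈)) → ne (inj₁ (refl , y∈))
          ; (inj₂ (refl , here refl)) → ne₁ (refl , refl)
          ; (inj₂ (refl , there z∈)) → ne (inj₂ (refl , z∈)) }))

      relabel-round : ∀ {m s} → J m s → Small s × Iterate relabelGuard relabelBody J (λ _ → Pending []) m s
      relabel-round {m} {s} ([] , m≡ , pd) = Pending.small-s pd ,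
        stop (trans (cong₂ ⟦ leq ⟧ (cong (_+ 1) (trans (same (Pending.frame pd) oVar 0 tt) o≡)) (Pending.q≡-s pd))
               (leq-false (≤-reflexive (+-comm 1 (length zs))))) pd
      relabel-round {m} {s} (x ∷ rest , m≡ , pd) = Pending.small-s pd , go relabelTime
        (1≢0 (trans (cong₂ ⟦ leq ⟧ (cong (_+ 1) (trans (same (Pending.frame pd) oVar 0 tt) o≡)) (Pending.q≡-s pd))
          (leq-true (≤-trans (≤-reflexive (+-comm (length zs) 1))
              (s≤s (≤-trans (m≤n+m (length zs) (length rest)) (≤-reflexive (sym (length-++ rest)))))))))
        (runs-weaken (relabel-step pd) ≤-refl λ pd' → length rest * relabelCost , (rest , refl , pd') , ≤-reflexive (sym m≡))

      runs-relabel : Runs (while relabelGuard relabelBody) s₀ (length us * relabelCost + suc (cost relabelGuard))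
          (Pending [])
      runs-relabel = runs-while J tt relabel-round (us , refl , record
        { small-s = small core
        ; frame = agree λ _ _ _ → refl
        ; unique = Enum.unique enum
        ; edges = λ x∈ → proj₁ (Enum.sound enum x∈)
        ; q≡-s = q≡
        ; st-s = st
        ; bs-s = bs
        ; old = λ {x} x∈ → let g = proj₁ (Enum.sound enum x∈) in
            bucket-edge G ℓ x v g , bucket-edge G ℓ v x (trans (symmetric v x) g)
        ; new = untouched enum
        })

-- The main loop

topGuard cnt₁E cntᵢE dirtyE : Exp
topGuard = var hVar
cnt₁E = read cntA (entry (var vVar) (lit 1))
cntᵢE = read cntA (entry (var vVar) (var iVar))
dirtyE = ((read floors (var iVar) ⊕ lit 1) ⊴ (cnt₁E ⊕ cntᵢE)) ⊕
         ((lit 5 ⊴ var iVar) ⊗ ((cnt₁E ⊕ lit 1) ⊴ read ceilings (var iVar ⊖ lit 5)))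

top pop settleBody settle : Cmd
top = vVar ≔ read stkA (var hVar ⊖ lit 1) ⨾ iVar ≔ levelE (var vVar)
pop = hVar ≔ var hVar ⊖ lit 1
settleBody = top ⨾ cond dirtyE relevel pop
settle = while topGuard settleBody

roundTime : ℕ → ℕ
roundTime t = suc (cost topGuard) + suc (time top + suc (cost dirtyE + t))

abstract
  -- The cost of the finished program defines `w`, and the potential is parametric in it, so there
  -- is no circularity. Every unit cost of a round is a summand of `w`; beyond that, the sealed
  -- value is used only through the inequalities below.
  popCost roundBase w : ℕ
  popCost   = roundTime (time pop)
  roundBase = roundTime relevelBase
  w         = iterCost + relabelCost + popCost + climbCost + roundBase

  popCost≡ : popCost ≡ roundTime (time pop)
  popCost≡ = refl

  roundBase≡ : roundBase ≡ roundTime relevelBase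
  roundBase≡ = refl

  1≤popCost : 1 ≤ popCost
  1≤popCost = s≤s z≤n

  1≤w : 1 ≤ w
  1≤w = s≤s z≤n

  popCost≤w : popCost ≤ w
  popCost≤w = ≤ᵇ⇒≤ popCost w tt

  w≤100000 : w ≤ 100000
  w≤100000 = ≤ᵇ⇒≤ w 100000 tt

  -- The left side is the time of a round with the new potential `f` and a prepaid pop for each
  -- stacked vertex. Each of the `d` collected neighbours costs a copy, a relabelling and a future
  -- pop, each of the `e` levels a climbing step, and the `2` covers the fixed part.
  w-pays : ∀ d e f l → roundBase + (d * iterCost + e * climbCost + d * relabelCost) + (f + (d + l) * popCost) ≤
           (f + w * (d + (e + 2))) + l * popCost
  w-pays = gather iterCost relabelCost popCost climbCost roundBase
    where
    lem : ∀ i r p k b d e f l → b + (d * i + e * k + d * r) + (f + (d + l) * p) +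
        (d * k + d * b + e * (i + r + p + b) + 2 * (i + r + p + k) + b)
          ≡ (f + (i + r + p + k + b) * (d + (e + 2))) + l * p
    lem = solve-∀
    gather : ∀ i r p k b d e f l → b + (d * i + e * k + d * r) + (f + (d + l) * p) ≤
        (f + (i + r + p + k + b) * (d + (e + 2))) + l * p
    gather i r p k b d e f l = ≤-trans (m≤m+n _ (d * k + d * b + e * (i + r + p + b) + 2 * (i + r + p + k) + b))
      (≤-reflexive (lem i r p k b d e f l))

-- Degrees are integers, so to exceed β^k is to exceed its floor, and to be below β^k is to be below
-- its ceiling.
Dirty : ∀ {n} → (F C : ℕ → ℕ) → Graph n → (Fin n → ℕ) → Fin n → Set
Dirty F C G ℓ v = F (ℓ v) < deg G ℓ v (ℓ v) ⊎ (5 ≤ ℓ v × deg G ℓ v (ℓ v ∸ 1) < C (ℓ v ∸ 5))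

-- The new level of a dirty vertex with target k: an overcrowded vertex climbs to k, a sparse one has k = ℓ v
-- and drops by one.
moved : ∀ {n} → (Fin n → ℕ) → Fin n → ℕ → Fin n → ℕ
moved ℓ v k x = if does (x Fin.≟ v) then k ∸ ⟦ leq ⟧ k (ℓ v) else ℓ x

moved-v : ∀ {n} (ℓ : Fin n → ℕ) v k → moved ℓ v k v ≡ k ∸ ⟦ leq ⟧ k (ℓ v)
moved-v ℓ v k with v Fin.≟ v
... | yes _ = refl
... | no ne = contradiction refl ne

moved-other : ∀ {n} (ℓ : Fin n → ℕ) v k x → x ≢ v → moved ℓ v k x ≡ ℓ x
moved-other ℓ v k x x≢ with x Fin.≟ v
... | yes e = contradiction e x≢
... | no _  = refl

module Settling {n Δ L B : ℕ} {F C : ℕ → ℕ} (th : Thresholds Δ L F C) (layout : Layout n Δ L B) where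
  open Relabelling n Δ L B F C layout public
  open Thresholds th
  open Potential th w

  runs-cond : ∀ {e c d s t} {Q : Store → Set} → Small s → T (wf e) →
              (eval e s ≢ 0 × Runs c s t Q) ⊎ (eval e s ≡ 0 × Runs d s t Q) → Runs (cond e c d) s (suc (cost e + t)) Q
  runs-cond {e} sm te (inj₁ (nz , runs ex b q)) = runs (cond-true (fits sm e te) nz ex) (s≤s (+-monoʳ-≤ (cost e) b)) q
  runs-cond {e} sm te (inj₂ (z , runs ex b q))  = runs (cond-false (fits sm e te) z ex) (s≤s (+-monoʳ-≤ (cost e) b)) q

  record Ranged (ℓ : Fin n → ℕ) : Set where
    field
      4≤ : ∀ x → 4 ≤ ℓ x
      ≤L : ∀ x → ℓ x ≤ L

  module _ {G : Graph n} (simple : Simple G) (Δ-bound : ∀ v → degree G v ≤ Δ) where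

    deg≤F : ∀ ℓ v → deg G ℓ v L ≤ F L
    deg≤F ℓ v = begin
      deg G ℓ v L       ≤⟨ sum-mono (λ u → shrink (G u v) (ℓ u ≤ᵇ L)) ⟩
      # (λ u → G u v)   ≡⟨ sym (card λ u → G u v) ⟩
      degree G v        ≤⟨ Δ-bound v ⟩
      Δ                 ≤⟨ F-top ⟩
      F L               ∎
      where
      open ≤-Reasoning
      shrink : ∀ p q → bit (p ∧ q) ≤ bit p
      shrink true true   = ≤-refl
      shrink true false  = z≤n
      shrink false q     = z≤n

    -- The upward search ends at level `L` at the latest: there the degree is at most Δ ≤ `F L`.
    target : ∀ ℓ → Ranged ℓ → ∀ v → ∃ (Target F L G ℓ v)
    target ℓ rg v = search (L ∸ ℓ v) (ℓ v) (m+[n∸m]≡n (Ranged.≤L rg v)) ≤-refl λ le lt → contradiction le (<⇒≱ lt)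
      where
      search : ∀ d k → k + d ≡ L → ℓ v ≤ k → (∀ {j} → ℓ v ≤ j → j < k → F j < deg G ℓ v j) → ∃ (Target F L G ℓ v)
      search zero k e ℓ≤k cr with trans (sym (+-identityʳ k)) e
      ... | refl = L , record { above = ℓ≤k ; within = ≤-refl ; settled = deg≤F ℓ v ; crowded = cr }
      search (suc d) k e ℓ≤k cr with deg G ℓ v k ≤? F k
      ... | yes le = k , record { above = ℓ≤k ; within = ≤-trans (m≤m+n k (suc d)) (≤-reflexive e) ; settled = le ;
          crowded = cr }
      ... | no gt = search d (suc k) (trans (sym (+-suc k d)) e) (m≤n⇒m≤1+n ℓ≤k) cr'
        where
        cr' : ∀ {j} → ℓ v ≤ j → j < suc k → F j < deg G ℓ v j
        cr' le (s≤s j≤k) with m≤n⇒m<n∨m≡n j≤k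
        ... | inj₁ lt   = cr le lt
        ... | inj₂ refl = ≰⇒> gt

    module _ {ℓ : Fin n → ℕ} (rg : Ranged ℓ) (v : Fin n) where
      open Ranged rg

      private
        D : ℕ → ℕ
        D = deg G ℓ v

      -- Both degrees in the definition of a dirty vertex are read off two counters, so a vertex is
      -- examined in constant time.
      counts : ∀ {s} → BucketsAt s (bucket G ℓ) → cntOf s v 1 ≡ D (ℓ v ∸ 1) × cntOf s v 1 + cntOf s v (ℓ v) ≡ D (ℓ v)
      counts {s} bs with bucket-prefix bs v ≤-refl (≤-trans (s≤s z≤n) (≤-trans (4≤ v) (≤L v))) (cntOf s v 1) ≤-refl
      ... | ys , pre with bucket-prefix bs v {suc (ℓ v ∸ 1)} (s≤s z≤n) (≤-trans (≤-reflexive ℓv≡) (≤L v))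
          (cntOf s v (suc (ℓ v ∸ 1))) ≤-refl
        where
        ℓv≡ : suc (ℓ v ∸ 1) ≡ ℓ v
        ℓv≡ = suc-∸1 (4≤ v)
      ... | ys' , pre' = trans (sym (Prefix.size pre)) (enum-deg start) , (begin
        cntOf s v 1 + cntOf s v (ℓ v)              ≡⟨ cong (λ z → cntOf s v 1 + cntOf s v z) (sym ℓv≡) ⟩
        cntOf s v 1 + cntOf s v (suc (ℓ v ∸ 1))    ≡⟨ cong₂ _+_ (sym (Prefix.size pre)) (sym (Prefix.size pre')) ⟩
        length ys + length ys'                     ≡⟨ +-comm (length ys) _ ⟩
        length ys' + length ys                     ≡⟨ sym (length-++ ys') ⟩
        length (ys' ++ ys)                         ≡⟨ enum-deg
            (enum-extend simple 4≤ bs v (≤-reflexive (sym ℓv≡)) start pre') ⟩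
        D (suc (ℓ v ∸ 1))                          ≡⟨ cong D ℓv≡ ⟩
        D (ℓ v)                                    ∎)
        where
        open ≡-Reasoning
        start = enum-start simple 4≤ bs v pre
        ℓv≡ : suc (ℓ v ∸ 1) ≡ ℓ v
        ℓv≡ = suc-∸1 (4≤ v)

      test : ℕ
      test = ⟦ leq ⟧ (F (ℓ v) + 1) (D (ℓ v)) + ⟦ leq ⟧ 5 (ℓ v) * ⟦ leq ⟧ (D (ℓ v ∸ 1) + 1) (C (ℓ v ∸ 5))

      test-dirty : Dirty F C G ℓ v → test ≢ 0
      test-dirty (inj₁ up) e = contradiction (m+n≡0⇒m≡0 _ e) (1≢0 (leq-true (≤-trans (≤-reflexive (+-comm _ 1)) up)))
      test-dirty (inj₂ (5≤ , low)) e = contradiction (m+n≡0⇒n≡0 (⟦ leq ⟧ (F (ℓ v) + 1) (D (ℓ v))) e)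
        (1≢0 (cong₂ _*_ (leq-true 5≤) (leq-true (≤-trans (≤-reflexive (+-comm _ 1)) low))))

      test-clean : ¬ Dirty F C G ℓ v → test ≡ 0
      test-clean clean = cong₂ _+_ (leq-false (≤-<-trans (≮⇒≥ (clean ∘ inj₁)) (≤-reflexive (+-comm 1 _)))) second
        where
        second : ⟦ leq ⟧ 5 (ℓ v) * ⟦ leq ⟧ (D (ℓ v ∸ 1) + 1) (C (ℓ v ∸ 5)) ≡ 0
        second with 5 ≤? ℓ v
        ... | yes 5≤ = trans (cong (⟦ leq ⟧ 5 (ℓ v) *_)
            (leq-false (≤-<-trans (≮⇒≥ λ lt → clean (inj₂ (5≤ , lt))) (≤-reflexive (+-comm 1 _)))))
                             (*-zeroʳ (⟦ leq ⟧ 5 (ℓ v)))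
        ... | no lt  = cong (_* ⟦ leq ⟧ (D (ℓ v ∸ 1) + 1) (C (ℓ v ∸ 5))) (leq-false (≰⇒> lt))

      dirty? : Dec (Dirty F C G ℓ v)
      dirty? with F (ℓ v) <? D (ℓ v) | 5 ≤? ℓ v | D (ℓ v ∸ 1) <? C (ℓ v ∸ 5)
      ... | yes up | _      | _       = yes (inj₁ up)
      ... | no nu  | yes 5≤ | yes low = yes (inj₂ (5≤ , low))
      ... | no nu  | no n5  | _       = no λ { (inj₁ up) → nu up ; (inj₂ (5≤ , _)) → n5 5≤ }
      ... | no nu  | yes _  | no nl   = no λ { (inj₁ up) → nu up ; (inj₂ (_ , low)) → nl low }

      module _ {k*} (tg : Target F L G ℓ v k*) where
        open Target tg

        private
          ℓ' = moved ℓ v k*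

        record Affordable : Set where
          field
            ranged : Ranged ℓ'
            pays   : Φ G ℓ' + w * (D k* + (k* ∸ ℓ v + 2)) ≤ Φ G ℓ

        ℓ'≤k* : ℓ' v ≤ k*
        ℓ'≤k* = ≤-trans (≤-reflexive (moved-v ℓ v k*)) (m∸n≤m k* (⟦ leq ⟧ k* (ℓ v)))

        moved-ranged : 4 ≤ ℓ' v → Ranged ℓ'
        moved-ranged 4≤k = record
          { 4≤ = λ x → at-all (4 ≤_) x (4≤ x) 4≤k
          ; ≤L = λ x → at-all (_≤ L) x (≤L x) (≤-trans ℓ'≤k* within)
          }
          where
          at-all : ∀ (P : ℕ → Set) x → P (ℓ x) → P (ℓ' v) → P (ℓ' x)
          at-all P x p p' with x Fin.≟ v
          ... | yes refl = subst P (moved-v ℓ v k*) p'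
          ... | no _     = p

        move : Dirty F C G ℓ v → Affordable
        -- Overcrowding is tested first: a drop may then assume that `v` is not overcrowded, which
        -- bounds the number of neighbours to be scanned.
        move dirty with F (ℓ v) <? D (ℓ v)
        ... | yes crowd = record
          { ranged = moved-ranged (≤-trans (4≤ v) (≤-trans (<⇒≤ i<k) (≤-reflexive (sym k≡))))
          ; pays = subst (λ z → Φ G ℓ' + w * (D z + (z ∸ ℓ v + 2)) ≤ Φ G ℓ) k≡
              (Relevel.Up.Φ-up th w simple v (moved-other ℓ v k*) (subst (ℓ v <_) (sym k≡) i<k) (4≤ v)
                  (subst (_≤ L) (sym k≡) within)
                (subst (λ z → F (z ∸ 1) < D (z ∸ 1)) (sym k≡)
                    (crowded (≤-pred (≤-trans i<k (≤-reflexive (sym suc-k)))) (≤-reflexive suc-k)))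
                (subst (λ z → D z ≤ F z) (sym k≡) settled))
          }
          where
          i<k : ℓ v < k*
          i<k = ≤∧≢⇒< above λ e → <⇒≱ crowd (subst (λ z → D z ≤ F z) (sym e) settled)
          suc-k : suc (k* ∸ 1) ≡ k*
          suc-k = suc-∸1 i<k
          k≡ : ℓ' v ≡ k*
          k≡ = trans (moved-v ℓ v k*) (cong (k* ∸_) (leq-false i<k))
        ... | no calm with dirty
        ... | inj₁ crowd = contradiction crowd calm
        ... | inj₂ (5≤ , sparse) = record
          { ranged = moved-ranged (≤-trans (∸-monoˡ-≤ 1 5≤) (≤-reflexive (sym k≡)))
          ; pays = ≤-trans (≤-reflexive (cong (λ z → Φ G ℓ' + w * z)
              (cong₂ _+_ (cong D k*≡) (cong (_+ 2) (trans (cong (_∸ ℓ v) k*≡) (n∸n≡0 (ℓ v)))))))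
              (Relevel.Down.Φ-down th w simple v (moved-other ℓ v k*) (trans (cong suc k≡) (suc-∸1 5≤))
                5≤ sparse (≮⇒≥ calm) 1≤w)
          }
          where
          k*≡ : k* ≡ ℓ v
          k*≡ = ≤-antisym (≮⇒≥ λ lt → calm (crowded ≤-refl lt)) above
          k≡ : ℓ' v ≡ ℓ v ∸ 1
          k≡ = trans (moved-v ℓ v k*) (cong₂ _∸_ k*≡ (leq-true (≤-reflexive k*≡)))

        -- If x is adjacent to `v`, it lies above `k*`, so `v` is strictly below x before and after
        -- the move. Hence the degrees of x at levels from `ℓ x ∸ 1` on, the only ones its
        -- conditions look at, are unchanged.
        same-dirty : ∀ {x} → x ≢ v → (G x v ≡ true → k* < ℓ x) → Dirty F C G ℓ' x → Dirty F C G ℓ x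
        same-dirty {x} x≢ far dirty = subst (λ l → deg-dirty l) (moved-other ℓ v k* x x≢) (unmoved dirty)
          where
          deg-dirty : ℕ → Set
          deg-dirty l = F l < deg G ℓ x l ⊎ (5 ≤ l × deg G ℓ x (l ∸ 1) < C (l ∸ 5))
          deg-≥ : ∀ j → ℓ x ∸ 1 ≤ j → deg G ℓ x j ≤ deg G ℓ' x j
          deg-≥ j le = deg-mono {G = G} {G} {ℓ} {ℓ'} {x} λ y g ly → g , lower y g ly
            where
            lower : ∀ y → G y x ≡ true → ℓ y ≤ j → ℓ' y ≤ j
            lower y g ly with y Fin.≟ v
            ... | no _ = ly
            ... | yes refl = ≤-trans (m∸n≤m k* (⟦ leq ⟧ k* (ℓ v)))
                (≤-trans (∸-monoˡ-≤ 1 (far (trans (Simple.symmetric simple x v) g))) le)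
          deg-≤' : ∀ j → ℓ x ∸ 1 ≤ j → deg G ℓ' x j ≤ deg G ℓ x j
          deg-≤' j le = deg-mono {G = G} {G} {ℓ'} {ℓ} {x} λ y g ly → g , lower y g ly
            where
            lower : ∀ y → G y x ≡ true → ℓ' y ≤ j → ℓ y ≤ j
            lower y g ly with y Fin.≟ v
            ... | no _ = ly
            ... | yes refl = ≤-trans above (≤-trans (∸-monoˡ-≤ 1 (far (trans (Simple.symmetric simple x v) g))) le)
          deg-same : ∀ j → ℓ x ∸ 1 ≤ j → deg G ℓ' x j ≡ deg G ℓ x j
          deg-same j le = ≤-antisym (deg-≤' j le) (deg-≥ j le)
          ℓ'x : ℓ x ∸ 1 ≤ ℓ' x ∸ 1
          ℓ'x = ≤-reflexive (cong (_∸ 1) (sym (moved-other ℓ v k* x x≢)))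
          unmoved : Dirty F C G ℓ' x → deg-dirty (ℓ' x)
          unmoved (inj₁ up) = inj₁ (subst (F (ℓ' x) <_) (deg-same (ℓ' x) (≤-trans ℓ'x (m∸n≤m (ℓ' x) 1))) up)
          unmoved (inj₂ (5≤ , low)) = inj₂ (5≤ , subst (_< C (ℓ' x ∸ 5)) (deg-same (ℓ' x ∸ 1) ℓ'x) low)

        -- Only the collected neighbours and `v` itself can become dirty. The vertex `v` stays on
        -- the stack below them, since after one drop it may still be sparse.
        dirty-kept : ∀ {us xs} → Enum G ℓ v k* us → (∀ x → Dirty F C G ℓ x → x ∈ v ∷ xs) →
                     ∀ x → Dirty F C G ℓ' x → x ∈ us ++ v ∷ xs
        dirty-kept {us} {xs} enum kept x dirty = cases (x Fin.≟ v) (G x v) refl (ℓ x ≤? k*)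
          where
          cases : Dec (x ≡ v) → ∀ g → G x v ≡ g → Dec (ℓ x ≤ k*) → x ∈ us ++ v ∷ xs
          cases (yes refl) _ _ _ = ∈-++⁺ʳ us (here refl)
          cases (no x≢) true g (yes le) = ∈-++⁺ˡ (Enum.complete enum g le)
          cases (no x≢) true g (no gt) = ∈-++⁺ʳ us (kept x (same-dirty x≢ (λ _ → ≰⇒> gt) dirty))
          cases (no x≢) false g _ = ∈-++⁺ʳ us (kept x (same-dirty x≢ (λ e → contradiction (trans (sym g) e) λ ()) dirty))

      module _ {s k* zs} (mem : Mem G ℓ zs s) (v≡ : s vVar 0 ≡ toℕ v) (i≡ : s iVar 0 ≡ ℓ v)
               (room : length zs + n + n < B) (tg : Target F L G ℓ v k*) (rg' : Ranged (moved ℓ v k*)) where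
        open Target tg
        open Mem mem

        private
          ℓ' = moved ℓ v k*

          Adjusted : List (Fin n) → Store → Set
          Adjusted us s₂ = Small s₂ × Same (stkA ∷ hVar ∷ pVar ∷ oVar ∷ jArg ∷ kVar ∷ qVar ∷ []) s s₂ ×
            s₂ kVar 0 ≡ ℓ' v × s₂ oVar 0 ≡ length zs × s₂ qVar 0 ≡ length (us ++ zs) × Stack s₂ (us ++ zs)

        runs-relevel : Runs relevel s (relevelBase + (D k* * iterCost + (k* ∸ ℓ v) * climbCost + D k* * relabelCost))
                       λ s' → ∃ λ us → Enum G ℓ v k* us × Mem G ℓ' (us ++ zs) s'
        runs-relevel = runs-weaken
          (runs-seq (runs-scan simple 4≤ ≤L core buckets v v≡ i≡ zs room tg (proj₂ stack) (proj₁ stack))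
          λ { {s₁} (k₁ , sc) → let open Scanned sc hiding (stack) in
            runs-seq (runs-straight adjust tt {Q = Adjusted us} small-s
              (≤-<-trans (m∸n≤m (s₁ kVar 0) (⟦ leq ⟧ (s₁ kVar 0) (s₁ iVar 0))) (small-s kVar 0) , small-s hVar 0)
              λ sm → sm ,
                same-trans (same-weaken scanArrays _ tt frame) (same-post _ adjust tt) ,
                trans (cong₂ (λ k i → k ∸ ⟦ leq ⟧ k i) k₁ (trans (same frame iVar 0 tt) i≡)) (sym (moved-v ℓ v k*)) ,
                o≡ , proj₁ (Scanned.stack sc) , proj₁ (Scanned.stack sc) ,
                stackAt-same (kVar ∷ qVar ∷ []) tt (us ++ zs) (same-post _ adjust tt) (proj₂ (Scanned.stack sc)))
          λ { {s₂} (sm₂ , q₂ , k₂ , o₂ , qq₂ , st₂) →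
            let core₂ = core-same scanned tt core sm₂ q₂ in
            runs-seq (runs-weaken
              (runs-relabel simple 4≤ ≤L (Ranged.4≤ rg') (Ranged.≤L rg') v (moved-other ℓ v k*) above (ℓ'≤k* tg)
                core₂ (λ x → trans (same q₂ levels _ tt) (level x)) (buckets-same scanned tt q₂ (λ _ _ → refl) buckets)
                (trans (same q₂ vVar 0 tt) v≡) (trans (same q₂ iVar 0 tt) i≡) k₂ o₂ qq₂ enum (proj₂ st₂))
              (≤-reflexive (cong (λ z → z * relabelCost + suc (cost relabelGuard)) (enum-deg enum))) id)
          λ { {s₃} pd → runs-straight publish tt (Pending.small-s pd) (Pending.small-s pd kVar 0)
            λ sm₄ → us , enum , finish sm₂ q₂ k₂ st₂ (Pending.small-s pd) (Pending.frame pd)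
              (buckets-same [] tt {s₃} {s₃} (agree λ _ _ _ → refl)
                  (λ x y → sym (Pending.new pd x y λ { (inj₁ (_ , ())) ; (inj₂ (_ , ())) })) (Pending.bs-s pd)) sm₄ } } })
          (≤-reflexive (lem scanBase (D k* * iterCost) ((k* ∸ ℓ v) * climbCost) (time adjust) (D k* * relabelCost)
              (suc (cost relabelGuard)) (time publish))) id
          where
          scanned : List ℕ
          scanned = stkA ∷ hVar ∷ pVar ∷ oVar ∷ jArg ∷ kVar ∷ qVar ∷ []
          finish : ∀ {us s₂ s₃} → Small s₂ → Same scanned s s₂ → s₂ kVar 0 ≡ ℓ' v → Stack s₂ (us ++ zs) →
                   Small s₃ → Same relabelArrays s₂ s₃ → BucketsAt s₃ (bucket G ℓ') → Small (post publish s₃) →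
                   Mem G ℓ' (us ++ zs) (post publish s₃)
          finish {us} {s₂} {s₃} sm₂ q₂ k₂ st₂ sm₃ q₃ bs₃ sm₄ = record
            { core = core-same (levels ∷ []) tt (core-same relabelArrays tt (core-same scanned tt core sm₂ q₂) sm₃ q₃) sm₄ q₄
            ; level = level'
            ; buckets = buckets-same (levels ∷ []) tt q₄ (λ _ _ → refl) bs₃
            ; stack = trans (same q₄ hVar 0 tt) (trans (same q₃ hVar 0 tt) (proj₁ st₂)) ,
                stackAt-same (levels ∷ []) tt (us ++ zs) q₄ (stackAt-same relabelArrays tt (us ++ zs) q₃ (proj₂ st₂))
            }
            where
            q₄ : Same (levels ∷ []) s₃ (post publish s₃)
            q₄ = same-post (levels ∷ []) publish tt
            v₃ : s₃ vVar 0 ≡ toℕ v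
            v₃ = trans (same q₃ vVar 0 tt) (trans (same q₂ vVar 0 tt) v≡)
            level' : ∀ x → post publish s₃ levels (toℕ x) ≡ ℓ' x
            level' x with x Fin.≟ v
            ... | yes refl = trans (trans (cong (post publish s₃ levels) (sym v₃))
                (get-same s₃ levels (s₃ vVar 0) (s₃ kVar 0)))
              (trans (same q₃ kVar 0 tt) (trans k₂ (moved-v ℓ v k*)))
            ... | no ne = trans (get-diff s₃ levels (s₃ vVar 0) (s₃ kVar 0) (λ e → ne (Fin.toℕ-injective (trans e v₃))))
              (trans (same q₃ levels _ tt) (trans (same q₂ levels _ tt) (level x)))
          lem : ∀ b d k a r g p → suc (b + (d + k) + suc (a + suc (r + g + p))) ≡ suc (b + suc (a + suc (g + p))) +
              (d + k + r)
          lem = solve-∀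

    module _ (limit : ℕ) (room : limit + n + n < B) where

      -- The credits are the potential plus the prepaid pops. Since a pop costs at least 1, the
      -- bound `m ≤ limit` also bounds the height of the stack, and so keeps its pointer within a
      -- memory word.
      Unsettled Settled : ℕ → Store → Set
      Unsettled m s = ∃ λ ℓ → ∃ λ xs → Ranged ℓ × Mem G ℓ xs s × (∀ x → Dirty F C G ℓ x → x ∈ xs) ×
                      m ≡ Φ G ℓ + length xs * popCost × m ≤ limit
      Settled m s = ∃ λ ℓ → Ranged ℓ × Mem G ℓ [] s × (∀ x → ¬ Dirty F C G ℓ x) × m ≡ Φ G ℓ

      private
        Topped : (Fin n → ℕ) → Fin n → Store → Store → Set
        Topped ℓ v s s₁ = Small s₁ × Same (vVar ∷ iVar ∷ []) s s₁ × s₁ vVar 0 ≡ toℕ v × s₁ iVar 0 ≡ ℓ v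

        runs-top : ∀ {ℓ v xs s} → Mem G ℓ (v ∷ xs) s → Runs top s (time top) (Topped ℓ v s)
        runs-top {ℓ} {v} {xs} {s} mem = runs-straight top tt (small core) (small core stkA _ , small core levels _)
          λ sm → sm , same-post _ top tt , v≡ , trans (cong (s levels) v≡) (level v)
          where
          open Mem mem
          v≡ : s stkA (s hVar 0 ∸ 1) ≡ toℕ v
          v≡ = trans (cong (λ h → s stkA (h ∸ 1)) (proj₁ stack)) (proj₁ (proj₂ stack))

        mem-topped : ∀ {ℓ v xs s s₁} → Mem G ℓ xs s → Topped ℓ v s s₁ → Mem G ℓ xs s₁
        mem-topped {xs = xs} mem (sm , q , _) = record
          { core = core-same (vVar ∷ iVar ∷ []) tt core sm q
          ; level = λ x → trans (same q levels _ tt) (level x)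
          ; buckets = buckets-same (vVar ∷ iVar ∷ []) tt q (λ _ _ → refl) buckets
          ; stack = trans (same q hVar 0 tt) (proj₁ stack) , stackAt-same (vVar ∷ iVar ∷ []) tt xs q (proj₂ stack)
          }
          where open Mem mem

        dirtyE-test : ∀ {ℓ v xs s₁} (rg : Ranged ℓ) → Mem G ℓ xs s₁ → s₁ vVar 0 ≡ toℕ v → s₁ iVar 0 ≡ ℓ v →
                      eval dirtyE s₁ ≡ test rg v
        dirtyE-test {ℓ} {v} {xs} {s₁} rg mem v≡ i≡ = cong₂ _+_
          (cong₂ ⟦ leq ⟧ (cong (_+ 1) (trans (cong (s₁ floors) i≡) (floors≡ core (ℓ v) (Ranged.≤L rg v))))
            (trans (cong₂ _+_ cnt₁≡ cntᵢ≡) (proj₂ cs)))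
          (cong₂ _*_ (cong (⟦ leq ⟧ 5) i≡) (cong₂ ⟦ leq ⟧ (cong (_+ 1) (trans cnt₁≡ (proj₁ cs)))
            (trans (cong (λ i → s₁ ceilings (i ∸ 5)) i≡)
                (ceiling≡ core (ℓ v ∸ 5) (≤-trans (m∸n≤m (ℓ v) 5) (Ranged.≤L rg v))))))
          where
          open Mem mem
          cs = counts rg v {s₁} buckets
          cnt₁≡ : eval cnt₁E s₁ ≡ cntOf s₁ v 1
          cnt₁≡ = cong (s₁ cntA) (cong (_+ 1) (cong₂ _*_ v≡ (width core)))
          cntᵢ≡ : eval cntᵢE s₁ ≡ cntOf s₁ v (ℓ v)
          cntᵢ≡ = cong (s₁ cntA) (cong₂ _+_ (cong₂ _*_ v≡ (width core)) i≡)

        settle-round : ∀ {m s} → Unsettled m s → Small s × Iterate topGuard settleBody Unsettled Settled m s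
        settle-round {m} {s} (ℓ , [] , rg , mem , kept , m≡ , m≤) = small (Mem.core mem) ,
          stop (proj₁ (Mem.stack mem)) (ℓ , rg , mem , (λ x d → contradiction (kept x d) λ ()) , trans m≡ (+-identityʳ _))
        settle-round {m} {s} (ℓ , v ∷ xs , rg , mem , kept , m≡ , m≤) with dirty? rg v
        ... | no clean = small (Mem.core mem) , go (suc (time top + suc (cost dirtyE + time pop)))
          (λ e → contradiction (trans (sym (proj₁ (Mem.stack mem))) e) λ ())
          (runs-seq (runs-top mem) λ { {s₁} tp@(sm₁ , q₁ , v₁ , i₁) →
            let mem₁ = mem-topped mem tp in
            runs-cond sm₁ tt (inj₂ (trans (dirtyE-test rg mem₁ v₁ i₁) (test-clean rg v clean) ,
              runs-straight pop tt sm₁ (≤-<-trans (m∸n≤m _ 1) (sm₁ hVar 0)) λ sm₂ →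
                Φ G ℓ + length xs * popCost ,
                (ℓ , xs , rg , popped mem₁ sm₂ , kept' , refl , ≤-trans
                    (≤-trans (m≤n+m (Φ G ℓ + length xs * popCost) (roundTime (time pop))) (≤-reflexive paid)) m≤) ,
                ≤-reflexive paid)) })
          where
          popped : ∀ {s₁} → Mem G ℓ (v ∷ xs) s₁ → Small (post pop s₁) → Mem G ℓ xs (post pop s₁)
          popped {s₁} mem₁ sm₂ = record
            { core = core-same (hVar ∷ []) tt core sm₂ q
            ; level = λ x → trans (same q levels _ tt) (level x)
            ; buckets = buckets-same (hVar ∷ []) tt q (λ _ _ → refl) buckets
            ; stack = cong (_∸ 1) (proj₁ stack) , stackAt-same (hVar ∷ []) tt xs q (proj₂ (proj₂ stack))
            }
            where
            open Mem mem₁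
            q = same-post (hVar ∷ []) pop tt {s₁}
          kept' : ∀ x → Dirty F C G ℓ x → x ∈ xs
          kept' x d with kept x d
          ... | here refl = contradiction d clean
          ... | there x∈  = x∈
          paid : roundTime (time pop) + (Φ G ℓ + length xs * popCost) ≡ m
          paid = trans (trans (lem (roundTime (time pop)) (Φ G ℓ) (length xs * popCost))
              (cong (λ p → Φ G ℓ + (p + length xs * popCost)) (sym popCost≡))) (sym m≡)
            where
            lem : ∀ p f r → p + (f + r) ≡ f + (p + r)
            lem = solve-∀
        ... | yes dirty with target ℓ rg v
        ... | k* , tg = small (Mem.core mem) ,
          go (suc (time top + suc (cost dirtyE + (relevelBase + work))))
          (λ e → contradiction (trans (sym (proj₁ (Mem.stack mem))) e) λ ())
          (runs-seq (runs-top mem) λ { {s₁} tp@(sm₁ , q₁ , v₁ , i₁) →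
            let mem₁ = mem-topped mem tp in
            runs-cond sm₁ tt (inj₁ ((λ e → test-dirty rg v dirty (trans (sym (dirtyE-test rg mem₁ v₁ i₁)) e)) ,
              runs-weaken (runs-relevel rg v mem₁ v₁ i₁ room-xs tg (Affordable.ranged mv)) ≤-refl
                λ { (us , enum , mem₂) → Φ G ℓ' + length (us ++ v ∷ xs) * popCost ,
                    (ℓ' , us ++ v ∷ xs , Affordable.ranged mv , mem₂ , dirty-kept rg v tg enum kept , refl ,
                      ≤-trans (≤-trans (m≤n+m (Φ G ℓ' + length (us ++ v ∷ xs) * popCost)
                          (roundTime (relevelBase + work))) (paid enum)) m≤) , paid enum })) })
          where
          ℓ' = moved ℓ v k*
          d = deg G ℓ v k*
          e = k* ∸ ℓ v
          work = d * iterCost + e * climbCost + d * relabelCost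
          mv = move rg v tg dirty
          room-xs : length (v ∷ xs) + n + n < B
          room-xs = ≤-<-trans (+-monoˡ-≤ n (+-monoˡ-≤ n (begin
            length (v ∷ xs)                        ≤⟨ m≤m*n (length (v ∷ xs)) popCost {{>-nonZero 1≤popCost}} ⟩
            length (v ∷ xs) * popCost              ≤⟨ m≤n+m _ (Φ G ℓ) ⟩
            Φ G ℓ + length (v ∷ xs) * popCost      ≡⟨ sym m≡ ⟩
            m                                      ≤⟨ m≤ ⟩
            limit                                  ∎))) room
            where open ≤-Reasoning
          paid : ∀ {us} → Enum G ℓ v k* us →
                 roundTime (relevelBase + work) + (Φ G ℓ' + length (us ++ v ∷ xs) * popCost) ≤ m
          paid {us} enum = begin
            roundTime (relevelBase + work) + (Φ G ℓ' + length (us ++ v ∷ xs) * popCost)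
              ≡⟨ cong₂ _+_ (trans (regroup (suc (cost topGuard)) (time top) (cost dirtyE) relevelBase work)
                  (cong (_+ work) (sym roundBase≡)))
                   (cong (λ z → Φ G ℓ' + z * popCost) (trans (length-++ us) (cong (_+ suc (length xs)) (enum-deg enum)))) ⟩
            roundBase + work + (Φ G ℓ' + (d + suc (length xs)) * popCost)
              ≤⟨ w-pays d e (Φ G ℓ') (suc (length xs)) ⟩
            (Φ G ℓ' + w * (d + (e + 2))) + suc (length xs) * popCost
              ≤⟨ +-monoˡ-≤ _ (Affordable.pays mv) ⟩
            Φ G ℓ + length (v ∷ xs) * popCost
              ≡⟨ sym m≡ ⟩
            m ∎
            where
            open ≤-Reasoning
            regroup : ∀ g t c b x → g + suc (t + suc (c + (b + x))) ≡ g + suc (t + suc (c + b)) + x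
            regroup = solve-∀

      settle-amortised : ∀ {m s} → Unsettled m s → ∃ λ s' → ∃ λ t → ∃ λ m' →
                         Exec W settle s s' t × t + m' ≤ m + suc (cost topGuard) × Settled m' s'
      settle-amortised = amortise Unsettled Settled tt settle-round

-- Edge updates

arg₀ arg₁ : Exp
arg₀ = read arguments (lit 0)
arg₁ = read arguments (lit 1)

aim : Exp → Exp → Cmd
aim e f = uArg ≔ e ⨾ wArg ≔ f ⨾ jArg ≔ codeE (levelE e) (levelE f)

pushBoth : Cmd
pushBoth =
  write stkA (var hVar) arg₀ ⨾ hVar ≔ var hVar ⊕ lit 1 ⨾
  write stkA (var hVar) arg₁ ⨾ hVar ≔ var hVar ⊕ lit 1

prepare : Cmd → Cmd
prepare edit = aim arg₀ arg₁ ⨾ edit ⨾ aim arg₁ arg₀ ⨾ edit ⨾ pushBoth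

algorithm : Algorithm
algorithm = record { onInsert = prepare add ⨾ settle ; onDelete = prepare remove ⨾ settle }

joins-off : ∀ {n} (u v x y : Fin n) → ¬ (x ≡ u × y ≡ v) → ¬ (x ≡ v × y ≡ u) → joins u v x y ≡ false
joins-off u v x y ne ne' with x Fin.≟ u | y Fin.≟ v | x Fin.≟ v | y Fin.≟ u
... | yes a | yes b | _     | _     = contradiction (a , b) ne
... | yes _ | no _  | yes c | yes d = contradiction (c , d) ne'
... | yes _ | no _  | yes _ | no _  = refl
... | yes _ | no _  | no _  | _     = refl
... | no _  | _     | yes c | yes d = contradiction (c , d) ne'
... | no _  | _     | yes _ | no _  = refl
... | no _  | _     | no _  | _     = refl

joins-on : ∀ {n} (u v : Fin n) → joins u v u v ≡ true
joins-on u v with u Fin.≟ u | v Fin.≟ v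
... | yes _ | yes _ = refl
... | no ne | _     = contradiction refl ne
... | yes _ | no ne = contradiction refl ne

joins-sym : ∀ {n} (u v x y : Fin n) → joins u v x y ≡ joins u v y x
joins-sym u v x y = trans (∨-comm _ (does (x Fin.≟ v) ∧ does (y Fin.≟ u)))
  (cong₂ _∨_ (∧-comm (does (x Fin.≟ v)) _) (∧-comm (does (x Fin.≟ u)) _))

joins-swap : ∀ {n} (u v : Fin n) → joins u v v u ≡ true
joins-swap u v = trans (joins-sym u v v u) (joins-on u v)

joins-loop : ∀ {n} {u v : Fin n} → u ≢ v → ∀ x → joins u v x x ≡ false
joins-loop {u = u} {v} u≢v x = joins-off u v x x
  (λ { (refl , refl) → u≢v refl }) (λ { (refl , refl) → u≢v refl })

endpoints : ∀ {n} → Update n → Fin n × Fin n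
endpoints (insert u v) = u , v
endpoints (delete u v) = u , v

-- The bucket of the edge on either side of the update, 0 standing for no edge; with these,
-- insertion and deletion share one proof.
before after : ∀ {n} → Update n → ℕ → ℕ
before (insert _ _) j = 0
before (delete _ _) j = j
after (insert _ _) j = j
after (delete _ _) j = 0

edit : ∀ {n} → Update n → Cmd
edit (insert _ _) = add
edit (delete _ _) = remove

admissible-≢ : ∀ {n} {G : Graph n} → Simple G → ∀ e → Admissible G e → proj₁ (endpoints e) ≢ proj₂ (endpoints e)
admissible-≢ simple (insert u v) (u≢v , _) = u≢v
admissible-≢ simple (delete u v) g refl = contradiction (trans (sym g) (Simple.irreflexive simple u)) λ ()

simple-apply : ∀ {n} {G : Graph n} → Simple G → ∀ e → Admissible G e → Simple (apply e G)
simple-apply simple e@(insert u v) adm = record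
  { symmetric   = λ x y → cong₂ _∨_ (joins-sym u v x y) (Simple.symmetric simple x y)
  ; irreflexive = λ x → cong₂ _∨_ (joins-loop (admissible-≢ simple e adm) x) (Simple.irreflexive simple x)
  }
simple-apply {G = G} simple e@(delete u v) adm = record
  { symmetric   = λ x y → cong₂ (λ p q → not p ∧ q) (joins-sym u v x y) (Simple.symmetric simple x y)
  ; irreflexive = λ x → trans (cong (not (joins u v x x) ∧_) (Simple.irreflexive simple x)) (∧-zeroʳ _)
  }

apply-other : ∀ {n} {G : Graph n} e {x y} → ¬ (x ≡ proj₁ (endpoints e) × y ≡ proj₂ (endpoints e)) →
              ¬ (x ≡ proj₂ (endpoints e) × y ≡ proj₁ (endpoints e)) → apply e G x y ≡ G x y
apply-other (insert u v) {x} {y} ne ne' rewrite joins-off u v x y ne ne' = refl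
apply-other (delete u v) {x} {y} ne ne' rewrite joins-off u v x y ne ne' = refl

module _ {n} {G : Graph n} (simple : Simple G) (ℓ : Fin n → ℕ) where
  open Simple simple

  before-bucket : ∀ e → Admissible G e → let (u , v) = endpoints e in
                  bucket G ℓ u v ≡ before e (code (ℓ u) (ℓ v)) × bucket G ℓ v u ≡ before e (code (ℓ v) (ℓ u))
  before-bucket (insert u v) (_ , g) = bucket-none G ℓ u v g , bucket-none G ℓ v u (trans (symmetric v u) g)
  before-bucket (delete u v) g = bucket-edge G ℓ u v g , bucket-edge G ℓ v u (trans (symmetric v u) g)

  after-bucket : ∀ e → let (u , v) = endpoints e in
                 bucket (apply e G) ℓ u v ≡ after e (code (ℓ u) (ℓ v)) × bucket (apply e G) ℓ v u ≡ after e
                     (code (ℓ v) (ℓ u))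
  after-bucket (insert u v) rewrite joins-on u v | joins-swap u v = refl , refl
  after-bucket (delete u v) rewrite joins-on u v | joins-swap u v = refl , refl

prepareTime : Cmd → ℕ
prepareTime c = suc (time (aim arg₀ arg₁) + suc (time c + suc (time (aim arg₁ arg₀) + suc (time c + time pushBoth))))

abstract
  updateBase : ℕ
  updateBase = suc (prepareTime add + prepareTime remove + (2 * popCost + suc (cost topGuard)))

  updateBase-pays : ∀ {n} (e : Update n) {t₁ t₂ m f x} → t₁ ≤ prepareTime (edit e) →
                    t₂ + m ≤ f + x + 2 * popCost + suc (cost topGuard) → suc (t₁ + t₂) + m ≤ f + (updateBase + x)
  updateBase-pays e b₁ b₂ = regroup (prepareTime add + prepareTime remove) (2 * popCost) (suc (cost topGuard))
                              (≤-trans b₁ (prepareTime-≤ e)) b₂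
    where
    prepareTime-≤ : ∀ {n} (e : Update n) → prepareTime (edit e) ≤ prepareTime add + prepareTime remove
    prepareTime-≤ (insert _ _) = m≤m+n (prepareTime add) (prepareTime remove)
    prepareTime-≤ (delete _ _) = m≤n+m (prepareTime remove) (prepareTime add)
    regroup : ∀ p y g {t₁ t₂ m f x} → t₁ ≤ p → t₂ + m ≤ f + x + y + g → suc (t₁ + t₂) + m ≤ f + (suc (p + (y + g)) + x)
    regroup p y g {t₁} {t₂} {m} {f} {x} b₁ b₂ = begin
      suc (t₁ + t₂) + m              ≡⟨ cong suc (+-assoc t₁ t₂ m) ⟩
      suc (t₁ + (t₂ + m))            ≤⟨ s≤s (+-mono-≤ b₁ b₂) ⟩
      suc (p + (f + x + y + g))      ≡⟨ lem p f x y g ⟩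
      f + (suc (p + (y + g)) + x)    ∎
      where
      open ≤-Reasoning
      lem : ∀ p f x y g → suc (p + (f + x + y + g)) ≡ f + (suc (p + (y + g)) + x)
      lem = solve-∀

module Updating {n Δ L B : ℕ} {F C : ℕ → ℕ} (th : Thresholds Δ L F C) (layout : Layout n Δ L B) where
  open Settling {n} th layout public
  open Potential th w

  EditSpec : Update n → Set
  EditSpec e = ∀ u v {j} → 1 ≤ j → j ≤ L → ∀ {s b} → Core s → Args s u v j → BucketsAt s b → b u v ≡ before e j →
    Runs (edit e) s (time (edit e)) λ s' → Small s' × Same bucketArrays s s' × BucketsAt s' (upd b u v (after e j))

  runs-edit : ∀ e → EditSpec e
  runs-edit (insert _ _) u v 1≤j j≤L = runs-add u v 1≤j j≤L
  runs-edit (delete _ _) u v 1≤j j≤L = runs-remove u v 1≤j j≤L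

  module _ {G : Graph n} (simple : Simple G) {ℓ} (rg : Ranged ℓ) (e : Update n) (adm : Admissible G e)
           {s} (mem : Mem G ℓ [] s) (a₀ : s arguments 0 ≡ toℕ (proj₁ (endpoints e)))
               (a₁ : s arguments 1 ≡ toℕ (proj₂ (endpoints e))) where
    open Mem mem
    open Ranged rg

    private
      u = proj₁ (endpoints e)
      v = proj₂ (endpoints e)
      G' = apply e G
      u≢v : u ≢ v
      u≢v = admissible-≢ simple e adm
      argArrays changed : List ℕ
      argArrays = uArg ∷ wArg ∷ jArg ∷ []
      changed = uArg ∷ wArg ∷ jArg ∷ posA ∷ cntA ∷ lstA ∷ lastVar ∷ placeVar ∷ []

      code≥ : ∀ x y → 1 ≤ code (ℓ x) (ℓ y)
      code≥ x y = code-≥ (ℓ x) (≤-trans (s≤s z≤n) (4≤ y))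
      code≤L : ∀ x y → code (ℓ x) (ℓ y) ≤ L
      code≤L x y = code-≤ (ℓ x) (≤L y) (≤-trans (s≤s z≤n) (≤-trans (4≤ y) (≤L y)))

      runs-aim : ∀ {s₁} a b {x y} → s₁ arguments a ≡ toℕ x → s₁ arguments b ≡ toℕ y →
                 T (wf (codeE (levelE (read arguments (lit a))) (levelE (read arguments (lit b))))) → T (a ≤ᵇ 9) → T
                     (b ≤ᵇ 9) →
                 (∀ x → s₁ levels (toℕ x) ≡ ℓ x) → Small s₁ →
                 Runs (aim (read arguments (lit a)) (read arguments (lit b))) s₁
                     (time (aim (read arguments (lit a)) (read arguments (lit b))))
                   λ s₂ → Small s₂ × Same argArrays s₁ s₂ × Args s₂ x y (code (ℓ x) (ℓ y))
      runs-aim {s₁} a b {x} {y} ea eb tw ta tb lev sm = runs-straight aimed tt' sm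
        (sm arguments a , sm arguments b , subst (_< B) (sym code≡) (≤-<-trans (code≤L x y) L<B))
        λ sm₂ → sm₂ , same-post argArrays aimed tt , record { arg-u = ea ; arg-v = eb ; arg-j = code≡ }
        where
        aimed = aim (read arguments (lit a)) (read arguments (lit b))
        T-∧⁺ : ∀ {p q} → T p → T q → T (p ∧ q)
        T-∧⁺ {true} _ t = t
        tt' : T (straight aimed)
        tt' = T-∧⁺ ta (T-∧⁺ tb tw)
        code≡ : code (s₁ levels (s₁ arguments a)) (s₁ levels (s₁ arguments b)) ≡ code (ℓ x) (ℓ y)
        code≡ = cong₂ code (trans (cong (s₁ levels) ea) (lev x)) (trans (cong (s₁ levels) eb) (lev y))

    runs-prepare : Runs (prepare (edit e)) s (prepareTime (edit e)) λ s' → Mem G' ℓ (v ∷ u ∷ []) s'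
    runs-prepare =
      runs-seq (runs-aim 0 1 a₀ a₁ tt tt tt level (small core)) λ { {s₁} (sm₁ , q₁ , args₁) →
      runs-seq (runs-edit e u v (code≥ u v) (code≤L u v) (core-same argArrays tt core sm₁ q₁) args₁
        (buckets-same argArrays tt q₁ (λ _ _ → refl) buckets) (proj₁ (before-bucket simple ℓ e adm))) λ
            { {s₂} (sm₂ , q₂ , bs₂) →
      let q₁₂ = same-trans (same-weaken argArrays changed tt q₁) (same-weaken bucketArrays changed tt q₂) in
      runs-seq (runs-aim 1 0 (trans (same q₁₂ arguments 1 tt) a₁) (trans (same q₁₂ arguments 0 tt) a₀) tt tt tt
        (λ x → trans (same q₁₂ levels _ tt) (level x)) sm₂) λ { {s₃} (sm₃ , q₃ , args₃) →
      let q₁₃ = same-trans q₁₂ (same-weaken argArrays changed tt q₃) in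
      runs-seq (runs-edit e v u (code≥ v u) (code≤L v u) (core-same changed tt core sm₃ q₁₃) args₃
        (buckets-same argArrays tt q₃ (λ _ _ → refl) bs₂)
        (trans (upd-diff (bucket G ℓ) u v _ λ { (v≡u , _) → u≢v (sym v≡u) }) (proj₂ (before-bucket simple ℓ e adm))))
            λ { {s₄} (sm₄ , q₄ , bs₄) →
      let q₁₄ = same-trans q₁₃ (same-weaken bucketArrays changed tt q₄)
          h₄ = trans (same q₁₄ hVar 0 tt) (proj₁ stack) in
      runs-straight pushBoth tt sm₄ (sm₄ arguments 0 , h<B {s₄} h₄ 1 tt , sm₄ arguments 1 , h<B' {s₄} h₄) λ sm₅ →
      let q₅ = same-post (stkA ∷ hVar ∷ []) pushBoth tt {s₄} in record
        { core = core-same (stkA ∷ hVar ∷ []) tt (core-same changed tt core sm₄ q₁₄) sm₅ q₅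
        ; level = λ x → trans (same q₅ levels _ tt) (trans (same q₁₄ levels _ tt) (level x))
        ; buckets = buckets-same (stkA ∷ hVar ∷ []) tt q₅ agrees bs₄
        ; stack = pushed {s₄} h₄ (trans (same q₁₄ arguments 0 tt) a₀) (trans (same q₁₄ arguments 1 tt) a₁)
        } } } } }
      where
      h<B : ∀ {s₄} → s₄ hVar 0 ≡ 0 → ∀ k → T (k ≤ᵇ 9) → s₄ hVar 0 + k < B
      h<B {s₄} h k t = subst (λ z → z + k < B) (sym h) (≤-trans (s≤s (≤ᵇ⇒≤ k 9 t)) 10≤B)
      h<B' : ∀ {s₄} → s₄ hVar 0 ≡ 0 → s₄ hVar 0 + 1 + 1 < B
      h<B' {s₄} h = subst (λ z → z + 1 + 1 < B) (sym h) (≤-trans (s≤s (s≤s (s≤s z≤n))) 10≤B)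
      pushed : ∀ {s₄} → s₄ hVar 0 ≡ 0 → s₄ arguments 0 ≡ toℕ u → s₄ arguments 1 ≡ toℕ v → Stack (post pushBoth s₄)
          (v ∷ u ∷ [])
      pushed {s₄} h e₀ e₁ rewrite h = refl , e₁ , e₀ , tt
      agrees : ∀ x y → bucket G' ℓ x y ≡ upd (upd (bucket G ℓ) u v (after e (code (ℓ u) (ℓ v)))) v u
          (after e (code (ℓ v) (ℓ u))) x y
      agrees x y with same? x v y u
      ... | yes (refl , refl) = trans (proj₂ (after-bucket simple ℓ e)) (sym (upd-same _ v u _))
      ... | no ne with same? x u y v
      ... | yes (refl , refl) = trans (proj₁ (after-bucket simple ℓ e))
          (sym (trans (upd-diff _ v u _ ne) (upd-same _ u v _)))
      ... | no ne' = trans (cong (λ g → if g then code (ℓ x) (ℓ y) else 0) (apply-other {G = G} e ne' ne))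
        (sym (trans (upd-diff _ v u _ ne) (upd-diff _ u v _ ne')))

    dirty-endpoints : (∀ x → ¬ Dirty F C G ℓ x) → ∀ x → Dirty F C G' ℓ x → x ∈ v ∷ u ∷ []
    dirty-endpoints clean x dirty with x Fin.≟ v | x Fin.≟ u
    ... | yes x≡v | _ = here x≡v
    ... | no _ | yes x≡u = there (here x≡u)
    ... | no x≢v | no x≢u = contradiction (unchanged dirty) (clean x)
      where
      deg-same : ∀ j → deg G' ℓ x j ≡ deg G ℓ x j
      deg-same j = sum-cong-≗ λ y → cong (λ g → bit (g ∧ (ℓ y ≤ᵇ j)))
          (apply-other {G = G} e (λ { (_ , eq) → x≢v eq }) (λ { (_ , eq) → x≢u eq }))
      unchanged : Dirty F C G' ℓ x → Dirty F C G ℓ x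
      unchanged (inj₁ up) = inj₁ (subst (F (ℓ x) <_) (deg-same (ℓ x)) up)
      unchanged (inj₂ (5≤ , low)) = inj₂ (5≤ , subst (_< C (ℓ x ∸ 5)) (deg-same (ℓ x ∸ 1)) low)

  Φ-apply : ∀ (G : Graph n) ℓ e → Φ (apply e G) ℓ ≤ Φ G ℓ + (c * (L + L) + α * 2)
  Φ-apply G ℓ (insert u v) = ≤-trans (Φ-insert G ℓ u v) (+-monoʳ-≤ (Φ G ℓ) (m≤m+n _ _))
  Φ-apply G ℓ (delete u v) = ≤-trans (Φ-delete G ℓ u v) (+-monoʳ-≤ (Φ G ℓ) (m≤n+m _ _))

  -- The largest stock of credits with which the main loop can start: a bound on the potential and
  -- two prepaid pops for the endpoints of the edge.
  limit : ℕ
  limit = c * (n * (n * L)) + α * (n * Δ) + 2 * popCost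

  handler≡ : ∀ e → handler algorithm e ≡ prepare (edit {n} e) ⨾ settle
  handler≡ (insert _ _) = refl
  handler≡ (delete _ _) = refl

  record Rest (G : Graph n) (m : ℕ) (s : Store) : Set where
    field
      {lev}  : Fin n → ℕ
      ranged : Ranged lev
      mem    : Mem G lev [] s
      clean  : ∀ x → ¬ Dirty F C G lev x
      credit : m ≡ Φ G lev

  supply-mem : ∀ {G ℓ s} (e : Update n) → Mem G ℓ [] s → Mem G ℓ [] (supply e s)
  supply-mem {s = s} e mem = record
    { core = core-same (arguments ∷ []) tt core (sm e) (q e)
    ; level = λ x → trans (same (q e) levels _ tt) (level x)
    ; buckets = buckets-same (arguments ∷ []) tt (q e) (λ _ _ → refl) buckets
    ; stack = trans (same (q e) hVar 0 tt) (proj₁ stack) , tt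
    }
    where
    open Mem mem
    vertex<B : (u : Fin n) → toℕ u < B
    vertex<B u = <-trans (vertex<M u) M<B
    sm : ∀ e → Small (supply e s)
    sm (insert u v) = small-write (small-write (small core) (vertex<B u)) (vertex<B v)
    sm (delete u v) = small-write (small-write (small core) (vertex<B u)) (vertex<B v)
    q : ∀ e → Same (arguments ∷ []) s (supply e s)
    q (insert u v) = same-post (arguments ∷ [])
        (write arguments (lit 0) (lit (toℕ u)) ⨾ write arguments (lit 1) (lit (toℕ v))) tt
    q (delete u v) = same-post (arguments ∷ [])
        (write arguments (lit 0) (lit (toℕ u)) ⨾ write arguments (lit 1) (lit (toℕ v))) tt

  supply-args : ∀ e s → supply e s arguments 0 ≡ toℕ (proj₁ (endpoints {n} e)) × supply e s arguments 1 ≡ toℕ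
      (proj₂ (endpoints e))
  supply-args (insert u v) s = refl , refl
  supply-args (delete u v) s = refl , refl

  module _ (room : limit + n + n < B) where

    handle : ∀ {G : Graph n} {m s} → Simple G → ∀ e → Admissible G e → (∀ v → degree (apply e G) v ≤ Δ) → Rest G m s →
             ∃ λ s' → ∃ λ t → ∃ λ m' → Exec W (handler algorithm e) (supply e s) s' t ×
             t + m' ≤ m + (updateBase + (c * (L + L) + α * 2)) × Rest (apply e G) m' s'
    handle {G} {m} {s} simple e adm bound rest =
      conclude (runs-prepare simple ranged e adm mem₀ (proj₁ (supply-args e s)) (proj₂ (supply-args e s)))
      where
      open Rest rest
      mem₀ = supply-mem e mem
      xs = proj₂ (endpoints e) ∷ proj₁ (endpoints e) ∷ []
      start : ∀ {s₁} → Mem (apply e G) lev xs s₁ →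
              Unsettled (simple-apply simple e adm) bound limit room (Φ (apply e G) lev + 2 * popCost) s₁
      start mem₁ = lev , xs , ranged , mem₁ ,
        dirty-endpoints simple ranged e adm mem₀ (proj₁ (supply-args e s)) (proj₂ (supply-args e s)) clean , refl ,
        +-monoˡ-≤ (2 * popCost) (Φ-bound (apply e G) lev (Ranged.≤L ranged))
      conclude : Runs (prepare (edit e)) (supply e s) (prepareTime (edit e)) (Mem (apply e G) lev xs) →
                 ∃ λ s' → ∃ λ t → ∃ λ m' → Exec W (handler algorithm e) (supply e s) s' t ×
                 t + m' ≤ m + (updateBase + (c * (L + L) + α * 2)) × Rest (apply e G) m' s'
      conclude (runs {taken = t₁} ex₁ b₁ mem₁) =
        let (s' , t , m' , ex , b₂ , (ℓ' , rg' , mem' , clean' , m'≡)) =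
              settle-amortised (simple-apply simple e adm) bound limit room (start mem₁) in
        s' , suc (t₁ + t) , m' , subst (λ p → Exec W p (supply e s) s' (suc (t₁ + t))) (sym (handler≡ e)) (ex₁ ⨾ ex) ,
        subst (λ f → suc (t₁ + t) + m' ≤ f + (updateBase + (c * (L + L) + α * 2))) (sym credit)
          (updateBase-pays e {t₁} {t} {m'} {Φ G lev} b₁ (≤-trans b₂
            (+-monoˡ-≤ (suc (cost topGuard)) (+-monoˡ-≤ (2 * popCost) (Φ-apply G lev e))))) ,
        record { ranged = rg' ; mem = mem' ; clean = clean' ; credit = m'≡ }

-- Integer roots of powers and the real number β

ι : ℕ → ℚ
ι n = ℤ.+ n ℚ./ 1

infixr 8 _^ℚ_
_^ℚ_ : ℚ → ℕ → ℚ
_^ℚ_ = Power._^_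

ι≡ : ∀ n → ι n ≡ mkℚ (ℤ.+ n) 0 (Coprimality.sym (Coprimality.1-coprimeTo n))
ι≡ n = ℚ.normalize-coprime (Coprimality.sym (Coprimality.1-coprimeTo n))

ι-mono : ∀ {m n} → m ≤ n → ι m ℚ.≤ ι n
ι-mono {m} {n} m≤n rewrite ι≡ m | ι≡ n = ℚ.*≤* (ℤ.*-monoʳ-≤-nonNeg (ℤ.+ 1) (ℤ.+≤+ m≤n))

ι-cancel : ∀ {m n} → ι m ℚ.≤ ι n → m ≤ n
ι-cancel {m} {n} le rewrite ι≡ m | ι≡ n with le
... | ℚ.*≤* h = ℤ.drop‿+≤+ (subst₂ ℤ._≤_ (ℤ.*-identityʳ (ℤ.+ m)) (ℤ.*-identityʳ (ℤ.+ n)) h)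

ι-mono-< : ∀ {m n} → m < n → ι m ℚ.< ι n
ι-mono-< m<n = ℚ.≰⇒> λ le → <⇒≱ m<n (ι-cancel le)

ι-* : ∀ m n → ι (m * n) ≡ ι m ℚ.* ι n
ι-* m n rewrite ι≡ m | ι≡ n = cong (ℚ._/ 1) (ℤ.pos-* m n)

ι-suc : ∀ n → ι (suc n) ≡ ι n ℚ.+ 1ℚ
ι-suc n rewrite ι≡ n = cong (ℚ._/ 1) (trans (cong ℤ.+_ (+-comm 1 n))
  (cong (ℤ._+ ℤ.+ 1) (sym (ℤ.*-identityʳ (ℤ.+ n)))))

ι-^ : ∀ m k → ι (m ^ k) ≡ ι m ^ℚ k
ι-^ m zero    = refl
ι-^ m (suc k) = trans (ι-* m (m ^ k)) (cong (ι m ℚ.*_) (ι-^ m k))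

0≤ι : ∀ n → 0ℚ ℚ.≤ ι n
0≤ι n = ι-mono {0} {n} z≤n

above-ℚ : ∀ r → ∃ λ n → r ℚ.≤ ι n
above-ℚ (mkℚ (ℤ.+ a) d c) = a , subst (mkℚ (ℤ.+ a) d c ℚ.≤_) (sym (ι≡ a))
  (ℚ.*≤* (ℤ.*-monoˡ-≤-nonNeg (ℤ.+ a) (ℤ.+≤+ (s≤s z≤n))))
above-ℚ (mkℚ ℤ.-[1+ a ] d c) = 0 , ℚ.<⇒≤ (ℚ.negative⁻¹ (mkℚ ℤ.-[1+ a ] d c))

*-mono-ℚ : ∀ {a b c d} → 0ℚ ℚ.≤ c → 0ℚ ℚ.≤ b → a ℚ.≤ b → c ℚ.≤ d → a ℚ.* c ℚ.≤ b ℚ.* d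
*-mono-ℚ {a} {b} {c} {d} 0≤c 0≤b a≤b c≤d = ℚ.≤-trans
  (ℚ.*-monoʳ-≤-nonNeg c {{ℚ.nonNegative 0≤c}} a≤b) (ℚ.*-monoˡ-≤-nonNeg b {{ℚ.nonNegative 0≤b}} c≤d)

0≤* : ∀ {a b} → 0ℚ ℚ.≤ a → 0ℚ ℚ.≤ b → 0ℚ ℚ.≤ a ℚ.* b
0≤* {a} {b} 0≤a 0≤b = ℚ.nonNegative⁻¹ (a ℚ.* b) {{ℚ.nonNeg*nonNeg⇒nonNeg a {{ℚ.nonNegative 0≤a}} b {{ℚ.nonNegative 0≤b}}}}

0<* : ∀ {a b} → 0ℚ ℚ.< a → 0ℚ ℚ.< b → 0ℚ ℚ.< a ℚ.* b
0<* {a} {b} 0<a 0<b = ℚ.positive⁻¹ (a ℚ.* b) {{ℚ.pos*pos⇒pos a {{ℚ.positive 0<a}} b {{ℚ.positive 0<b}}}}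

0≤1 : 0ℚ ℚ.≤ 1ℚ
0≤1 = ℚ.<⇒≤ (ℚ.positive⁻¹ 1ℚ)

0≤^ : ∀ {a} k → 0ℚ ℚ.≤ a → 0ℚ ℚ.≤ a ^ℚ k
0≤^ zero    0≤a = 0≤1
0≤^ (suc k) 0≤a = 0≤* 0≤a (0≤^ k 0≤a)

0<^ : ∀ {a} k → 0ℚ ℚ.< a → 0ℚ ℚ.< a ^ℚ k
0<^ zero    0<a = ℚ.positive⁻¹ 1ℚ
0<^ (suc k) 0<a = 0<* 0<a (0<^ k 0<a)

^-mono-ℚ : ∀ {a b} k → 0ℚ ℚ.≤ a → a ℚ.≤ b → a ^ℚ k ℚ.≤ b ^ℚ k
^-mono-ℚ zero    0≤a a≤b = ℚ.≤-refl
^-mono-ℚ (suc k) 0≤a a≤b = *-mono-ℚ (0≤^ k 0≤a) (ℚ.≤-trans 0≤a a≤b) a≤b (^-mono-ℚ k 0≤a a≤b)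

^-mono-<-ℚ : ∀ {a b} k → 1 ≤ k → 0ℚ ℚ.≤ a → a ℚ.< b → a ^ℚ k ℚ.< b ^ℚ k
^-mono-<-ℚ {a} {b} (suc k) _ 0≤a a<b = ℚ.≤-<-trans
  (ℚ.*-monoˡ-≤-nonNeg a {{ℚ.nonNegative 0≤a}} (^-mono-ℚ k 0≤a (ℚ.<⇒≤ a<b)))
  (ℚ.*-monoˡ-<-pos (b ^ℚ k) {{ℚ.positive (0<^ k (ℚ.≤-<-trans 0≤a a<b))}} a<b)

^-swap : ∀ q m n → (q ^ℚ m) ^ℚ n ≡ (q ^ℚ n) ^ℚ m
^-swap q m n = trans (Power.^-assocʳ q m n) (trans (cong (q ^ℚ_) (*-comm m n)) (sym (Power.^-assocʳ q n m)))

module _ {x : ℚ} (0<x : 0ℚ ℚ.< x) where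
  private
    instance
      x⁺ : ℚ.Positive x
      x⁺ = ℚ.positive 0<x
      x≢0 : ℚ.NonZero x
      x≢0 = ℚ.pos⇒nonZero x

  quotient : ∀ c → x ℚ.* (ℚ.1/ x ℚ.* c) ≡ c
  quotient c = trans (sym (ℚ.*-assoc x (ℚ.1/ x) c)) (trans (cong (ℚ._* c) (ℚ.*-inverseʳ x)) (ℚ.*-identityˡ c))

  shrink-factor : ∀ {y c} → 0ℚ ℚ.≤ c → c ℚ.< x ℚ.* y → ∃ λ y' → 0ℚ ℚ.< y' × y' ℚ.< y × c ℚ.< x ℚ.* y'
  shrink-factor {y} {c} 0≤c c<xy with ℚ.<-dense {ℚ.1/ x ℚ.* c} {y}
    (ℚ.*-cancelˡ-<-nonNeg x {{ℚ.pos⇒nonNeg x}} (subst (ℚ._< x ℚ.* y) (sym (quotient c)) c<xy))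
  ... | y' , lo , hi = y' , ℚ.≤-<-trans 0≤c/x lo , hi , subst (ℚ._< x ℚ.* y') (quotient c) (ℚ.*-monoʳ-<-pos x lo)
    where
    0≤c/x : 0ℚ ℚ.≤ ℚ.1/ x ℚ.* c
    0≤c/x = 0≤* (ℚ.<⇒≤ (ℚ.positive⁻¹ (ℚ.1/ x) {{ℚ.1/pos⇒pos x}})) 0≤c

  grow-factor : ∀ {y c} → x ℚ.* y ℚ.< c → ∃ λ y' → y ℚ.< y' × x ℚ.* y' ℚ.< c
  grow-factor {y} {c} xy<c with ℚ.<-dense {y} {ℚ.1/ x ℚ.* c}
    (ℚ.*-cancelˡ-<-nonNeg x {{ℚ.pos⇒nonNeg x}} (subst (x ℚ.* y ℚ.<_) (sym (quotient c)) xy<c))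
  ... | y' , lo , hi = y' , lo , subst (x ℚ.* y' ℚ.<_) (quotient c) (ℚ.*-monoʳ-<-pos x hi)

-- Continuity of powers in rational form: density gives room in one factor at a time, and the larger
-- of the two bases found serves for the whole product.
shrink-base : ∀ {a} → 0ℚ ℚ.< a → ∀ m {c} → 0ℚ ℚ.≤ c → c ℚ.< a ^ℚ m →
              ∃ λ a' → 0ℚ ℚ.≤ a' × a' ℚ.< a × c ℚ.< a' ^ℚ m
shrink-base 0<a zero 0≤c c<1 = 0ℚ , ℚ.≤-refl , 0<a , c<1
shrink-base {a} 0<a (suc m) {c} 0≤c c<aᵐ =
  let (y , 0<y , y<aᵐ , c<ay)     = shrink-factor {a} 0<a {a ^ℚ m} {c} 0≤c c<aᵐ
      (x , 0<x , x<a , c<yx)      = shrink-factor {y} 0<y {a} {c} 0≤c (subst (c ℚ.<_) (ℚ.*-comm a y) c<ay)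
      (a' , 0≤a' , a'<a , y<a'ᵐ)  = shrink-base {a} 0<a m {y} (ℚ.<⇒≤ 0<y) y<aᵐ in
  larger {x} {y} {a'} 0<x 0<y x<a (subst (c ℚ.<_) (ℚ.*-comm y x) c<yx) 0≤a' a'<a y<a'ᵐ (ℚ.≤-total x a')
  where
  larger : ∀ {x y a'} → 0ℚ ℚ.< x → 0ℚ ℚ.< y → x ℚ.< a → c ℚ.< x ℚ.* y → 0ℚ ℚ.≤ a' → a' ℚ.< a → y ℚ.< a' ^ℚ m →
           x ℚ.≤ a' ⊎ a' ℚ.≤ x → ∃ λ z → 0ℚ ℚ.≤ z × z ℚ.< a × c ℚ.< z ℚ.* z ^ℚ m
  larger {x} {y} {a'} 0<x 0<y x<a c<xy 0≤a' a'<a y< (inj₁ x≤a') = a' , 0≤a' , a'<a ,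
    ℚ.<-≤-trans {c} {x ℚ.* y} {a' ℚ.* a' ^ℚ m} c<xy (*-mono-ℚ {x} {a'} {y} {a' ^ℚ m} (ℚ.<⇒≤ 0<y) 0≤a' x≤a' (ℚ.<⇒≤ y<))
  larger {x} {y} {a'} 0<x 0<y x<a c<xy 0≤a' a'<a y< (inj₂ a'≤x) = x , ℚ.<⇒≤ 0<x , x<a ,
    ℚ.<-≤-trans {c} {x ℚ.* y} {x ℚ.* x ^ℚ m} c<xy (*-mono-ℚ {x} {x} {y} {x ^ℚ m} (ℚ.<⇒≤ 0<y) (ℚ.<⇒≤ 0<x) ℚ.≤-refl
      (ℚ.≤-trans {y} {a' ^ℚ m} {x ^ℚ m} (ℚ.<⇒≤ y<) (^-mono-ℚ m 0≤a' a'≤x)))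

grow-base : ∀ {a} → 0ℚ ℚ.< a → ∀ m {c} → a ^ℚ m ℚ.< c → ∃ λ a' → a ℚ.< a' × a' ^ℚ m ℚ.< c
grow-base {a} 0<a zero {c} 1<c = a ℚ.+ 1ℚ , a<a+1 , 1<c
  where
  a<a+1 : a ℚ.< a ℚ.+ 1ℚ
  a<a+1 = subst (ℚ._< a ℚ.+ 1ℚ) (ℚ.+-identityʳ a) (ℚ.+-monoʳ-< a {0ℚ} {1ℚ} (ℚ.positive⁻¹ 1ℚ))
grow-base {a} 0<a (suc m) {c} aᵐ<c =
  let (y , aᵐ<y , ay<c)   = grow-factor {a} 0<a {a ^ℚ m} {c} aᵐ<c
      0<y                 = ℚ.<-trans {0ℚ} {a ^ℚ m} {y} (0<^ m 0<a) aᵐ<y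
      (x , a<x , yx<c)    = grow-factor {y} 0<y {a} {c} (subst (ℚ._< c) (ℚ.*-comm a y) ay<c)
      (a' , a<a' , a'ᵐ<y) = grow-base {a} 0<a m {y} aᵐ<y in
  smaller {x} {y} {a'} (ℚ.<⇒≤ (ℚ.<-trans {0ℚ} {a} {x} 0<a a<x)) (ℚ.<⇒≤ (ℚ.<-trans {0ℚ} {a} {a'} 0<a a<a')) a<x a<a'
    (subst (ℚ._< c) (ℚ.*-comm y x) yx<c) a'ᵐ<y (ℚ.≤-total a' x)
  where
  smaller : ∀ {x y a'} → 0ℚ ℚ.≤ x → 0ℚ ℚ.≤ a' → a ℚ.< x → a ℚ.< a' → x ℚ.* y ℚ.< c → a' ^ℚ m ℚ.< y →
            a' ℚ.≤ x ⊎ x ℚ.≤ a' → ∃ λ z → a ℚ.< z × z ℚ.* z ^ℚ m ℚ.< c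
  smaller {x} {y} {a'} 0≤x 0≤a' a<x a<a' xy<c y> (inj₁ a'≤x) = a' , a<a' ,
    ℚ.≤-<-trans {a' ℚ.* a' ^ℚ m} {x ℚ.* y} {c} (*-mono-ℚ {a'} {x} {a' ^ℚ m} {y} (0≤^ m 0≤a') 0≤x a'≤x (ℚ.<⇒≤ y>)) xy<c
  smaller {x} {y} {a'} 0≤x 0≤a' a<x a<a' xy<c y> (inj₂ x≤a') = x , a<x ,
    ℚ.≤-<-trans {x ℚ.* x ^ℚ m} {x ℚ.* y} {c} (*-mono-ℚ {x} {x} {x ^ℚ m} {y} (0≤^ m 0≤x) 0≤x ℚ.≤-refl
      (ℚ.≤-trans {x ^ℚ m} {a' ^ℚ m} {y} (^-mono-ℚ m 0≤x x≤a') (ℚ.<⇒≤ y>))) xy<c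

seq-^ : ∀ β k n → seq (β ^ℝ k) n ≡ seq β n ^ℚ k
seq-^ β zero    n = refl
seq-^ β (suc k) n = cong (seq β n ℚ.*_) (seq-^ β k n)

-- Eventual inequalities and comparison of β^k with integers

Eventually : (ℕ → Set) → Set
Eventually P = ∃ λ N → ∀ n → N ≤ n → P n

both-eventually : ∀ {P Q R : ℕ → Set} → (∀ n → P n → Q n → R n) → Eventually P → Eventually Q → Eventually R
both-eventually f (N , p) (N' , q) = N ⊔ N' , λ n le → f n (p n (≤-trans (m≤m⊔n N N') le)) (q n (≤-trans (m≤n⊔m N N') le))

map-eventually : ∀ {P Q : ℕ → Set} → (∀ n → P n → Q n) → Eventually P → Eventually Q
map-eventually f (N , p) = N , λ n le → f n (p n le)

p-q+q : ∀ p q → p ℚ.- q ℚ.+ q ≡ p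
p-q+q p q = trans (ℚ.+-assoc p (ℚ.- q) q) (trans (cong (p ℚ.+_) (ℚ.+-inverseˡ q)) (ℚ.+-identityʳ p))

p+[q-p] : ∀ p q → p ℚ.+ (q ℚ.- p) ≡ q
p+[q-p] p q = trans (ℚ.+-comm p (q ℚ.- p)) (p-q+q q p)

0<q-p : ∀ {p q} → p ℚ.< q → 0ℚ ℚ.< q ℚ.- p
0<q-p {p} {q} p<q = subst (ℚ._< q ℚ.- p) (ℚ.+-inverseʳ p) (ℚ.+-monoˡ-< (ℚ.- p) p<q)

p<p+ε : ∀ p {ε} → 0ℚ ℚ.< ε → p ℚ.< p ℚ.+ ε
p<p+ε p {ε} 0<ε = subst (ℚ._< p ℚ.+ ε) (ℚ.+-identityʳ p) (ℚ.+-monoʳ-< p 0<ε)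

≤ℝ-trans : ∀ {x y z} → x ≤ℝ y → y ≤ℝ z → x ≤ℝ z
≤ℝ-trans {x} {y} {z} x≤y y≤z ε 0<ε = both-eventually
  (λ n p q → ℚ.≤-trans p (ℚ.≤-trans (ℚ.+-monoˡ-≤ δ q)
      (ℚ.≤-reflexive (trans (ℚ.+-assoc (seq z n) δ δ) (cong (seq z n ℚ.+_) δ+δ)))))
  (x≤y δ 0<δ) (y≤z δ 0<δ)
  where
  δ = ½ ℚ.* ε
  0<δ : 0ℚ ℚ.< δ
  0<δ = 0<* (ℚ.positive⁻¹ ½) 0<ε
  δ+δ : δ ℚ.+ δ ≡ ε
  δ+δ = trans (sym (ℚ.*-distribʳ-+ ε ½ ½)) (ℚ.*-identityˡ ε)

fromℕ-mono : ∀ {m n} → m ≤ n → fromℕ m ≤ℝ fromℕ n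
fromℕ-mono {m} {n} m≤n ε 0<ε = 0 , λ _ _ → ℚ.≤-trans (ι-mono m≤n) (ℚ.<⇒≤ (p<p+ε (ι n) 0<ε))

-- An error of ½ is harmless between integers; in this way inequalities for the approximations of β
-- become inequalities of naturals.
near : ∀ {m n} → ι m ℚ.≤ ι n ℚ.+ ½ → m ≤ n
near {m} {n} le = ≮⇒≥ λ n<m → ℚ.<-irrefl refl (ℚ.<-≤-trans
  (ℚ.+-monoʳ-< (ι n) ½<1) (ℚ.≤-trans (ℚ.≤-reflexive (sym (ι-suc n))) (ℚ.≤-trans (ι-mono n<m) le)))
  where
  ½<1 : ½ ℚ.< 1ℚ
  ½<1 = p<p+ε ½ (ℚ.positive⁻¹ ½)

module Roots (β : ℝ) (20<β : fromℕ 20 <ℝ β) where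
  private
    q : ℕ → ℚ
    q = seq β

  20≤q : Eventually λ n → ι 20 ℚ.≤ q n
  20≤q = map-eventually (λ n → ℚ.≤-trans (ℚ.<⇒≤ (p<p+ε (ι 20) (proj₁ (proj₂ 20<β))))) (proj₂ (proj₂ 20<β))

  -- Obtained from β alone, before Δ is given; the constant of the time bound is computed from it.
  natural-bound : ∃ λ b → Eventually λ n → q n ℚ.≤ ι b
  natural-bound = b , N , λ n N≤n → begin
    q n                          ≡⟨ sym (p-q+q (q n) (q N)) ⟩
    q n ℚ.- q N ℚ.+ q N          ≤⟨ ℚ.+-monoˡ-≤ (q N) (p≤∣p∣ (q n ℚ.- q N)) ⟩
    ℚ.∣ q n ℚ.- q N ∣ ℚ.+ q N    ≤⟨ ℚ.+-monoˡ-≤ (q N) (proj₂ close n N N≤n ≤-refl) ⟩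
    1ℚ ℚ.+ q N                   ≤⟨ proj₂ (above-ℚ (1ℚ ℚ.+ q N)) ⟩
    ι b                          ∎
    where
    open ℚ.≤-Reasoning
    close = cauchy β 1ℚ (ℚ.positive⁻¹ 1ℚ)
    N = proj₁ close
    b = proj₁ (above-ℚ (1ℚ ℚ.+ q N))
    p≤∣p∣ : ∀ p → p ℚ.≤ ℚ.∣ p ∣
    p≤∣p∣ p with ℚ.≤-total 0ℚ p
    ... | inj₁ 0≤p = ℚ.≤-reflexive (sym (ℚ.0≤p⇒∣p∣≡p 0≤p))
    ... | inj₂ p≤0 = ℚ.≤-trans p≤0 (ℚ.0≤∣p∣ p)

  module Radical (Δ L : ℕ) (β^L≃Δ : β ^ℝ L ≃ℝ fromℕ Δ) (1≤L : 1 ≤ L) where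

    q^L≤ : ∀ {ε} → 0ℚ ℚ.< ε → Eventually λ n → q n ^ℚ L ℚ.≤ ι Δ ℚ.+ ε
    q^L≤ {ε} 0<ε = map-eventually (λ n → subst (ℚ._≤ ι Δ ℚ.+ ε) (seq-^ β L n)) (proj₁ β^L≃Δ ε 0<ε)

    ≤q^L : ∀ {ε} → 0ℚ ℚ.< ε → Eventually λ n → ι Δ ℚ.≤ q n ^ℚ L ℚ.+ ε
    ≤q^L {ε} 0<ε = map-eventually (λ n → subst (λ z → ι Δ ℚ.≤ z ℚ.+ ε) (seq-^ β L n)) (proj₂ β^L≃Δ ε 0<ε)

    0≤q : ∀ {n} → ι 20 ℚ.≤ q n → 0ℚ ℚ.≤ q n
    0≤q = ℚ.≤-trans (0≤ι 20)

    20^L≤Δ : 20 ^ L ≤ Δ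
    20^L≤Δ = near (proj₂ close (proj₁ close) ≤-refl)
      where
      open ℚ.≤-Reasoning
      close : Eventually λ _ → ι (20 ^ L) ℚ.≤ ι Δ ℚ.+ ½
      close = both-eventually (λ n p r → begin
        ι (20 ^ L)      ≡⟨ ι-^ 20 L ⟩
        ι 20 ^ℚ L       ≤⟨ ^-mono-ℚ L (0≤ι 20) p ⟩
        q n ^ℚ L        ≤⟨ r ⟩
        ι Δ ℚ.+ ½       ∎) 20≤q (q^L≤ (ℚ.positive⁻¹ ½))

    Δ≤bound^L : Δ ≤ proj₁ natural-bound ^ L
    Δ≤bound^L = near (proj₂ close (proj₁ close) ≤-refl)
      where
      open ℚ.≤-Reasoning
      b = proj₁ natural-bound
      close : Eventually λ _ → ι Δ ℚ.≤ ι (b ^ L) ℚ.+ ½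
      close = both-eventually (λ n (p , r) s → begin
        ι Δ                   ≤⟨ s ⟩
        q n ^ℚ L ℚ.+ ½        ≤⟨ ℚ.+-monoˡ-≤ ½ (^-mono-ℚ L (0≤q p) r) ⟩
        ι b ^ℚ L ℚ.+ ½        ≡⟨ cong (ℚ._+ ½) (sym (ι-^ b L)) ⟩
        ι (b ^ L) ℚ.+ ½       ∎) (both-eventually (λ n → _,_) 20≤q (proj₂ natural-bound)) (≤q^L (ℚ.positive⁻¹ ½))

    0<Δ : 0ℚ ℚ.< ι Δ
    0<Δ = ι-mono-< {0} {Δ} (≤-trans (m^n>0 20 L) 20^L≤Δ)

    module _ (k : ℕ) where

      private
        Δᵏ : ℚ
        Δᵏ = ι Δ ^ℚ k

      -- The L-th powers are compared, as (q^k)^L = (q^L)^k and q^L tends to Δ. The strict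
      -- inequality survives when Δ is replaced by some `a` < Δ, and the difference absorbs the
      -- error of the approximation.
      below-power : ∀ {h} → 0ℚ ℚ.≤ h → h ^ℚ L ℚ.< Δᵏ → Eventually λ n → h ℚ.≤ q n ^ℚ k
      below-power {h} 0≤h lt = reach (shrink-base {ι Δ} 0<Δ k {h ^ℚ L} (0≤^ L 0≤h) lt)
        where
        reach : (∃ λ a → 0ℚ ℚ.≤ a × a ℚ.< ι Δ × h ^ℚ L ℚ.< a ^ℚ k) → Eventually λ n → h ℚ.≤ q n ^ℚ k
        reach (a , 0≤a , a<Δ , lt') = both-eventually (λ n p r → ℚ.≮⇒≥ (absurd n p (a≤ r))) 20≤q (≤q^L (0<q-p a<Δ))
          where
          a≤ : ∀ {z} → ι Δ ℚ.≤ z ℚ.+ (ι Δ ℚ.- a) → a ℚ.≤ z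
          a≤ {z} le = ℚ.≮⇒≥ λ z<a → ℚ.<-irrefl refl (ℚ.≤-<-trans {ι Δ} {z ℚ.+ (ι Δ ℚ.- a)} {ι Δ} le
            (subst (z ℚ.+ (ι Δ ℚ.- a) ℚ.<_) (p+[q-p] a (ι Δ)) (ℚ.+-monoˡ-< (ι Δ ℚ.- a) z<a)))
          absurd : ∀ n → ι 20 ℚ.≤ q n → a ℚ.≤ q n ^ℚ L → ¬ (q n ^ℚ k ℚ.< h)
          absurd n p a≤qᴸ qᵏ<h = ℚ.<-irrefl refl (begin-strict
            h ^ℚ L               <⟨ lt' ⟩
            a ^ℚ k               ≤⟨ ^-mono-ℚ k 0≤a a≤qᴸ ⟩
            (q n ^ℚ L) ^ℚ k      ≡⟨ ^-swap (q n) L k ⟩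
            (q n ^ℚ k) ^ℚ L      ≤⟨ ^-mono-ℚ L (0≤^ k (0≤q p)) (ℚ.<⇒≤ qᵏ<h) ⟩
            h ^ℚ L               ∎)
            where open ℚ.≤-Reasoning

      above-power : ∀ {h} → 0ℚ ℚ.≤ h → Δᵏ ℚ.< h ^ℚ L → Eventually λ n → q n ^ℚ k ℚ.≤ h
      above-power {h} 0≤h lt = reach (grow-base {ι Δ} 0<Δ k {h ^ℚ L} lt)
        where
        reach : (∃ λ a → ι Δ ℚ.< a × a ^ℚ k ℚ.< h ^ℚ L) → Eventually λ n → q n ^ℚ k ℚ.≤ h
        reach (a , Δ<a , lt') = both-eventually
          (λ n p r → ℚ.≮⇒≥ (absurd n p (ℚ.≤-trans {q n ^ℚ L} {ι Δ ℚ.+ (a ℚ.- ι Δ)} {a} r (ℚ.≤-reflexive (p+[q-p] (ι Δ) a)))))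
          20≤q (q^L≤ (0<q-p Δ<a))
          where
          absurd : ∀ n → ι 20 ℚ.≤ q n → q n ^ℚ L ℚ.≤ a → ¬ (h ℚ.< q n ^ℚ k)
          absurd n p qᴸ≤a h<qᵏ = ℚ.<-irrefl refl (begin-strict
            h ^ℚ L               ≤⟨ ^-mono-ℚ L 0≤h (ℚ.<⇒≤ h<qᵏ) ⟩
            (q n ^ℚ k) ^ℚ L      ≡⟨ ^-swap (q n) k L ⟩
            (q n ^ℚ L) ^ℚ k      ≤⟨ ^-mono-ℚ k (0≤^ L (0≤q p)) qᴸ≤a ⟩
            a ^ℚ k               <⟨ lt' ⟩
            h ^ℚ L               ∎)
            where open ℚ.≤-Reasoning

      ι-≤-power : ∀ {a b} i j → a ^ i ≤ b ^ j → ι a ^ℚ i ℚ.≤ ι b ^ℚ j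
      ι-≤-power {a} {b} i j le = subst₂ ℚ._≤_ (ι-^ a i) (ι-^ b j) (ι-mono le)

      ι-<-power : ∀ {a b} i j → a ^ i < b ^ j → ι a ^ℚ i ℚ.< ι b ^ℚ j
      ι-<-power {a} {b} i j lt = subst₂ ℚ._<_ (ι-^ a i) (ι-^ b j) (ι-mono-< lt)

      below-ℝ : ∀ {g} → g ^ L ≤ Δ ^ k → fromℕ g ≤ℝ β ^ℝ k
      below-ℝ {g} le ε 0<ε = cases (ℚ.≤-total (ι g) ε)
        where
        Goal = Eventually λ n → ι g ℚ.≤ seq (β ^ℝ k) n ℚ.+ ε
        cases : ι g ℚ.≤ ε ⊎ ε ℚ.≤ ι g → Goal
        -- Here `ι g ℚ.- ε` would not be positive and could not be raised to the L-th power
        -- monotonically; but the claim already follows from β^k ≥ 0.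
        cases (inj₁ g≤ε) = map-eventually small 20≤q
          where
          open ℚ.≤-Reasoning
          small : ∀ n → ι 20 ℚ.≤ q n → ι g ℚ.≤ seq (β ^ℝ k) n ℚ.+ ε
          small n p = begin
            ι g                       ≤⟨ g≤ε ⟩
            ε                         ≡⟨ sym (ℚ.+-identityˡ ε) ⟩
            0ℚ ℚ.+ ε                  ≤⟨ ℚ.+-monoˡ-≤ ε (0≤^ k (0≤q p)) ⟩
            q n ^ℚ k ℚ.+ ε            ≡⟨ cong (ℚ._+ ε) (sym (seq-^ β k n)) ⟩
            seq (β ^ℝ k) n ℚ.+ ε      ∎
        cases (inj₂ ε≤g) = map-eventually large
          (below-power {h} 0≤h (ℚ.<-≤-trans {h ^ℚ L} {ι g ^ℚ L} {Δᵏ} (^-mono-<-ℚ L 1≤L 0≤h h<g) (ι-≤-power L k le)))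
          where
          open ℚ.≤-Reasoning
          h = ι g ℚ.- ε
          0≤h : 0ℚ ℚ.≤ h
          0≤h = subst (ℚ._≤ h) (ℚ.+-inverseʳ ε) (ℚ.+-monoˡ-≤ (ℚ.- ε) ε≤g)
          h<g : h ℚ.< ι g
          h<g = subst (h ℚ.<_) (p-q+q (ι g) ε) (p<p+ε h 0<ε)
          large : ∀ n → h ℚ.≤ q n ^ℚ k → ι g ℚ.≤ seq (β ^ℝ k) n ℚ.+ ε
          large n p = begin
            ι g                       ≡⟨ sym (p-q+q (ι g) ε) ⟩
            h ℚ.+ ε                   ≤⟨ ℚ.+-monoˡ-≤ ε p ⟩
            q n ^ℚ k ℚ.+ ε            ≡⟨ cong (ℚ._+ ε) (sym (seq-^ β k n)) ⟩
            seq (β ^ℝ k) n ℚ.+ ε      ∎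

      above-ℝ : ∀ {g} → Δ ^ k ≤ g ^ L → β ^ℝ k ≤ℝ fromℕ g
      above-ℝ {g} le ε 0<ε = map-eventually (λ n → subst (ℚ._≤ h) (sym (seq-^ β k n)))
        (above-power {h} (ℚ.≤-trans {0ℚ} {ι g} {h} (0≤ι g) (ℚ.<⇒≤ g<h))
          (ℚ.≤-<-trans {Δᵏ} {ι g ^ℚ L} {h ^ℚ L} (ι-≤-power k L le) (^-mono-<-ℚ L 1≤L (0≤ι g) g<h)))
        where
        h = ι g ℚ.+ ε
        g<h : ι g ℚ.< h
        g<h = p<p+ε (ι g) 0<ε

      strictly-above-ℝ : ∀ {g} → 1 ≤ g → Δ ^ k < g ^ L → β ^ℝ k <ℝ fromℕ g
      strictly-above-ℝ {g} 1≤g lt =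
        gap (shrink-base {ι g} (ι-mono-< {0} {g} 1≤g) L {Δᵏ} (0≤^ k (ℚ.<⇒≤ 0<Δ)) (ι-<-power k L lt))
        where
        gap : (∃ λ h → 0ℚ ℚ.≤ h × h ℚ.< ι g × Δᵏ ℚ.< h ^ℚ L) → β ^ℝ k <ℝ fromℕ g
        gap (h , 0≤h , h<g , lt') = ι g ℚ.- h , 0<q-p h<g , map-eventually lower (above-power {h} 0≤h lt')
          where
          open ℚ.≤-Reasoning
          lower : ∀ n → q n ^ℚ k ℚ.≤ h → seq (β ^ℝ k) n ℚ.+ (ι g ℚ.- h) ℚ.≤ ι g
          lower n p = begin
            seq (β ^ℝ k) n ℚ.+ (ι g ℚ.- h)   ≡⟨ cong (ℚ._+ (ι g ℚ.- h)) (seq-^ β k n) ⟩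
            q n ^ℚ k ℚ.+ (ι g ℚ.- h)         ≤⟨ ℚ.+-monoˡ-≤ (ι g ℚ.- h) p ⟩
            h ℚ.+ (ι g ℚ.- h)                ≡⟨ p+[q-p] h (ι g) ⟩
            ι g                              ∎

      strictly-below-ℝ : ∀ {g} → g ^ L < Δ ^ k → fromℕ g <ℝ β ^ℝ k
      -- `grow-base` needs a positive base, so 0 is treated apart: β^k ≥ 1 supplies the gap 1.
      strictly-below-ℝ {zero} lt = 1ℚ , ℚ.positive⁻¹ 1ℚ , map-eventually
        (λ n p → subst (1ℚ ℚ.≤_) (sym (seq-^ β k n)) (1≤^ (ℚ.≤-trans {1ℚ} {ι 20} {q n} (ι-mono {1} {20} (s≤s z≤n)) p))) 20≤q
        where
        1^ : ∀ k → 1ℚ ≡ 1ℚ ^ℚ k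
        1^ zero    = refl
        1^ (suc k) = trans (1^ k) (sym (ℚ.*-identityˡ (1ℚ ^ℚ k)))
        1≤^ : ∀ {a} → 1ℚ ℚ.≤ a → 1ℚ ℚ.≤ a ^ℚ k
        1≤^ {a} 1≤a = ℚ.≤-trans {1ℚ} {1ℚ ^ℚ k} {a ^ℚ k} (ℚ.≤-reflexive (1^ k)) (^-mono-ℚ k 0≤1 1≤a)
      strictly-below-ℝ {suc g} lt = gap (grow-base {ι (suc g)} (ι-mono-< {0} {suc g} (s≤s z≤n)) L {Δᵏ} (ι-<-power L k lt))
        where
        gap : (∃ λ h → ι (suc g) ℚ.< h × h ^ℚ L ℚ.< Δᵏ) → fromℕ (suc g) <ℝ β ^ℝ k
        gap (h , g<h , lt') = h ℚ.- ι (suc g) , 0<q-p g<h , map-eventually lower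
            (below-power {h} (ℚ.≤-trans {0ℚ} {ι (suc g)} {h} (0≤ι (suc g)) (ℚ.<⇒≤ g<h)) lt')
          where
          open ℚ.≤-Reasoning
          lower : ∀ n → h ℚ.≤ q n ^ℚ k → ι (suc g) ℚ.+ (h ℚ.- ι (suc g)) ℚ.≤ seq (β ^ℝ k) n
          lower n p = begin
            ι (suc g) ℚ.+ (h ℚ.- ι (suc g))  ≡⟨ p+[q-p] (ι (suc g)) h ⟩
            h                                ≤⟨ p ⟩
            q n ^ℚ k                         ≡⟨ sym (seq-^ β k n) ⟩
            seq (β ^ℝ k) n                   ∎

-- The roundings of β^k and the word size

-- The floor of the L-th root of N, by induction on N: the root rises by at most one when N does.
-- The search only proves existence; its values enter the initial memory.
root : ∀ L → 1 ≤ L → ∀ N → ∃ λ f → f ^ L ≤ N × N < suc f ^ L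
root L@(suc l) _ zero = 0 , z≤n , ≤-reflexive (sym (^-zeroˡ L))
root L 1≤L (suc N) with root L 1≤L N
... | f , f≤ , <sf with suc f ^ L ≤? suc N
... | yes le = suc f , le , ≤-<-trans <sf (^-monoˡ-< L {{>-nonZero 1≤L}} (n<1+n (suc f)))
... | no gt  = f , m≤n⇒m≤1+n f≤ , ≰⇒> gt

ceiling-root : ∀ L (1≤L : 1 ≤ L) N → ∃ λ c → N ≤ c ^ L × (1 ≤ N → pred c ^ L < N) × c ≤ suc (proj₁ (root L 1≤L N))
ceiling-root L 1≤L N with root L 1≤L N
... | f , f≤ , <sf with N ≤? f ^ L
... | no gt = suc f , <⇒≤ <sf , (λ _ → ≰⇒> gt) , ≤-refl
... | yes le = f , le , tight f f≤ , n≤1+n f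
  where
  tight : ∀ f → f ^ L ≤ N → 1 ≤ N → pred f ^ L < N
  tight zero    f≤ 1≤N = subst (_< N) (sym (0^ L 1≤L)) 1≤N
    where
    0^ : ∀ L → 1 ≤ L → 0 ^ L ≡ 0
    0^ (suc _) _ = refl
  tight (suc f) f≤ _   = <-≤-trans (^-monoˡ-< L {{>-nonZero 1≤L}} (n<1+n f)) f≤

^-distrib-* : ∀ a b k → (a * b) ^ k ≡ a ^ k * b ^ k
^-distrib-* a b zero    = refl
^-distrib-* a b (suc k) = trans (cong (a * b *_) (^-distrib-* a b k)) (lem a b (a ^ k) (b ^ k))
  where
  lem : ∀ a b x y → a * b * (x * y) ≡ a * x * (b * y)
  lem = solve-∀

^-cancel-< : ∀ {a b} L → a ^ L < b ^ L → a < b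
^-cancel-< L lt = ≰⇒> λ b≤a → <⇒≱ lt (^-monoˡ-≤ L b≤a)

module Roundings (Δ L : ℕ) (1≤L : 1 ≤ L) (20^L≤Δ : 20 ^ L ≤ Δ) where

  abstract
    F C : ℕ → ℕ
    F k = proj₁ (root L 1≤L (Δ ^ k))
    C k = proj₁ (ceiling-root L 1≤L (Δ ^ k))

    F-≤ : ∀ k → F k ^ L ≤ Δ ^ k
    F-≤ k = proj₁ (proj₂ (root L 1≤L (Δ ^ k)))

    F-< : ∀ k → Δ ^ k < suc (F k) ^ L
    F-< k = proj₂ (proj₂ (root L 1≤L (Δ ^ k)))

    C-≥ : ∀ k → Δ ^ k ≤ C k ^ L
    C-≥ k = proj₁ (proj₂ (ceiling-root L 1≤L (Δ ^ k)))

    C-> : ∀ k → pred (C k) ^ L < Δ ^ k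
    C-> k = proj₁ (proj₂ (proj₂ (ceiling-root L 1≤L (Δ ^ k)))) (m^n>0 Δ {{>-nonZero (≤-trans (m^n>0 20 L) 20^L≤Δ)}} k)

    C-≤ : ∀ k → C k ≤ suc (F k)
    C-≤ k = proj₂ (proj₂ (proj₂ (ceiling-root L 1≤L (Δ ^ k))))

  private
    -- Both bounds are read off L-th powers: (a · F k)^L ≤ Δ^(k+1) < (F (k+1) + 1)^L. With a = 20
    -- this is the growth of `F`, with a = `F 1` its supermultiplicativity.
    scale : ∀ a k → a ^ L ≤ Δ → a * F k ≤ F (suc k)
    scale a k aᴸ≤Δ = ≤-pred (^-cancel-< L (begin-strict
      (a * F k) ^ L           ≡⟨ ^-distrib-* a (F k) L ⟩
      a ^ L * F k ^ L         ≤⟨ *-mono-≤ aᴸ≤Δ (F-≤ k) ⟩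
      Δ ^ suc k               <⟨ F-< (suc k) ⟩
      suc (F (suc k)) ^ L     ∎))
      where open ≤-Reasoning

  thresholds : Thresholds Δ L F C
  thresholds = record
    { F-zero  = ≤-pred (^-cancel-< {1} {suc (F 0)} L (subst (_< suc (F 0) ^ L) (sym (^-zeroˡ L)) (F-< 0)))
    ; F-ratio = λ k → scale 20 k 20^L≤Δ
    ; F-lower = λ k → scale (F 1) k (subst (F 1 ^ L ≤_) (*-identityʳ Δ) (F-≤ 1))
    ; F-upper = λ k → <⇒≤ (^-cancel-< L (begin-strict
        F (suc k) ^ L                   ≤⟨ F-≤ (suc k) ⟩
        Δ * Δ ^ k                       <⟨ *-mono-< (subst (_< suc (F 1) ^ L) (*-identityʳ Δ) (F-< 1)) (F-< k) ⟩
        suc (F 1) ^ L * suc (F k) ^ L   ≡⟨ sym (^-distrib-* (suc (F 1)) (suc (F k)) L) ⟩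
        (suc (F 1) * suc (F k)) ^ L     ∎))
    ; C-upper = C-≤
    ; F-top   = ≤-pred (^-cancel-< L (F-< L))
    ; F-bound = λ k k≤L → ≮⇒≥ λ Δ<F → <⇒≱ (^-monoˡ-< L {{>-nonZero 1≤L}} Δ<F)
        (≤-trans (F-≤ k) (^-monoʳ-≤ Δ {{>-nonZero (≤-trans (m^n>0 20 L) 20^L≤Δ)}} k≤L))
    }
    where open ≤-Reasoning

-- The constants `α` and `c` as functions of `b`, which itself comes from Δ. By monotonicity `b` can
-- be replaced by a bound that depends on β only.
αOf cOf rate : ℕ → ℕ
αOf b = 16 * w * b
cOf b = (αOf b + w) * b + 3 * w
rate b = updateBase + cOf b * 2 + αOf b * 2

αOf-mono : ∀ {b b'} → b ≤ b' → αOf b ≤ αOf b'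
αOf-mono = *-monoʳ-≤ (16 * w)

cOf-mono : ∀ {b b'} → b ≤ b' → cOf b ≤ cOf b'
cOf-mono b≤ = +-monoˡ-≤ (3 * w) (*-mono-≤ (+-monoˡ-≤ w (αOf-mono b≤)) b≤)

rate-mono : ∀ {b b'} → b ≤ b' → rate b ≤ rate b'
rate-mono b≤ = +-mono-≤ (+-monoʳ-≤ updateBase (*-monoˡ-≤ 2 (cOf-mono b≤))) (*-monoˡ-≤ 2 (αOf-mono b≤))

n<20^n : ∀ n → n < 20 ^ n
n<20^n zero    = ≤-refl
n<20^n (suc n) = begin-strict
  suc n                 ≤⟨ n<20^n n ⟩
  20 ^ n                <⟨ m<m*n (20 ^ n) 20 {{>-nonZero (m^n>0 20 n)}} (s≤s (s≤s z≤n)) ⟩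
  20 ^ n * 20           ≡⟨ *-comm (20 ^ n) 20 ⟩
  20 * 20 ^ n           ∎
  where open ≤-Reasoning

module Words-suffice (n Δ L b : ℕ) (20^L≤Δ : 20 ^ L ≤ Δ) (4≤L : 4 ≤ L) (b≤Δ : b ≤ Δ) where

  -- The exponent 9: `c` is at most `M ^ 5` and is multiplied by n · n · L ≤ `M ^ 3`. The five
  -- summands of the bound in `room` are each at most `M ^ 8`, and one more factor `M` exceeds their
  -- number.
  M B : ℕ
  M = n + Δ
  B = M ^ 9

  abstract
    -- 20^4 = 160000, so L ≥ 4 already makes Δ larger than the constant `w` of the program.
    100000≤M : 100000 ≤ M
    100000≤M = begin
      100000      ≤⟨ ≤ᵇ⇒≤ 100000 (20 ^ 4) tt ⟩
      20 ^ 4      ≤⟨ ^-monoʳ-≤ 20 4≤L ⟩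
      20 ^ L      ≤⟨ 20^L≤Δ ⟩
      Δ           ≤⟨ m≤n+m Δ n ⟩
      M           ∎
      where open ≤-Reasoning

    small≤M : ∀ k → T (k ≤ᵇ 100000) → k ≤ M
    small≤M k t = ≤-trans (≤ᵇ⇒≤ k 100000 t) 100000≤M

  instance
    M≢0 : NonZero M
    M≢0 = >-nonZero (small≤M 1 tt)

  abstract
    n≤M : n ≤ M
    n≤M = m≤m+n n Δ

    Δ≤M : Δ ≤ M
    Δ≤M = m≤n+m Δ n

    n<M : n < M
    n<M = m<m+n n (≤-trans (m^n>0 20 L) 20^L≤Δ)

    L<M : L < M
    L<M = ≤-trans (n<20^n L) (≤-trans 20^L≤Δ Δ≤M)

    sucM<B : suc M < B
    sucM<B = begin-strict
      suc M       <⟨ +-monoˡ-< M (small≤M 2 tt) ⟩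
      M + M       ≡⟨ cong (M +_) (sym (+-identityʳ M)) ⟩
      2 * M       ≤⟨ *-monoˡ-≤ M (small≤M 2 tt) ⟩
      M * M       ≡⟨ cong (M *_) (sym (^-identityʳ M)) ⟩
      M ^ 2       ≤⟨ ^-monoʳ-≤ M (s≤s (s≤s (z≤n {7}))) ⟩
      B           ∎
      where open ≤-Reasoning

    M<B : M < B
    M<B = <-trans (n<1+n M) sucM<B

    10≤B : 10 ≤ B
    10≤B = ≤-trans (small≤M 10 tt) (<⇒≤ M<B)

    w≤M : w ≤ M
    w≤M = ≤-trans w≤100000 100000≤M

    b≤M : b ≤ M
    b≤M = ≤-trans b≤Δ Δ≤M

    α≤ : αOf b ≤ M * M * M
    α≤ = *-mono-≤ (*-mono-≤ (small≤M 16 tt) w≤M) b≤M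

    c≤ : cOf b ≤ M * (M * M * M * M)
    c≤ = begin
      (αOf b + w) * b + 3 * w                            ≤⟨ +-mono-≤ (*-mono-≤ (+-mono-≤ α≤ w≤) b≤M) (*-monoʳ-≤ 3 w≤') ⟩
      (M * M * M + M * M * M) * M + 3 * (M * M * M * M)  ≡⟨ lem M ⟩
      5 * (M * M * M * M)                                ≤⟨ *-monoˡ-≤ (M * M * M * M) (small≤M 5 tt) ⟩
      M * (M * M * M * M)                                ∎
      where
      open ≤-Reasoning
      w≤ : w ≤ M * M * M
      w≤ = ≤-trans w≤M (≤-trans (m≤m*n M M) (m≤m*n (M * M) M))
      w≤' : w ≤ M * M * M * M
      w≤' = ≤-trans w≤ (m≤m*n (M * M * M) M)
      lem : ∀ M → (M * M * M + M * M * M) * M + 3 * (M * M * M * M) ≡ 5 * (M * M * M * M)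
      lem = solve-∀

    room : ∀ {c α} → c ≡ cOf b → α ≡ αOf b → c * (n * (n * L)) + α * (n * Δ) + 2 * popCost + n + n < B
    room {c} {α} c≡ α≡ = begin-strict
      c * (n * (n * L)) + α * (n * Δ) + 2 * popCost + n + n
        ≤⟨ +-mono-≤ (+-mono-≤ (+-mono-≤ (+-mono-≤ c-part α-part) pop-part) n-part) n-part ⟩
      M ^ 8 + M ^ 8 + M ^ 8 + M ^ 8 + M ^ 8
        ≡⟨ lem (M ^ 8) ⟩
      5 * M ^ 8
        <⟨ *-monoˡ-< (M ^ 8) {{>-nonZero (m^n>0 M 8)}} (small≤M 6 tt) ⟩
      M * M ^ 8 ∎
      where
      open ≤-Reasoning
      lem : ∀ x → x + x + x + x + x ≡ 5 * x
      lem = solve-∀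
      eight : ∀ M → M * (M * M * M * M) * (M * (M * M)) ≡ M * (M * (M * (M * (M * (M * (M * (M * 1)))))))
      eight = solve-∀
      five : ∀ M → M * M * M * (M * M) ≡ M * (M * (M * (M * (M * 1))))
      five = solve-∀
      two : ∀ M → M * M ≡ M * (M * 1)
      two = solve-∀
      c-part : c * (n * (n * L)) ≤ M ^ 8
      c-part = ≤-trans (*-mono-≤ (≤-trans (≤-reflexive c≡) c≤) (*-mono-≤ n≤M (*-mono-≤ n≤M (<⇒≤ L<M))))
          (≤-reflexive (eight M))
      α-part : α * (n * Δ) ≤ M ^ 8
      α-part = ≤-trans (*-mono-≤ (≤-trans (≤-reflexive α≡) α≤) (*-mono-≤ n≤M Δ≤M))
          (≤-trans (≤-reflexive (five M)) (^-monoʳ-≤ M (≤ᵇ⇒≤ 5 8 tt)))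
      pop-part : 2 * popCost ≤ M ^ 8
      pop-part = ≤-trans (*-mono-≤ (small≤M 2 tt) (≤-trans popCost≤w w≤M))
          (≤-trans (≤-reflexive (two M)) (^-monoʳ-≤ M (≤ᵇ⇒≤ 2 8 tt)))
      n-part : n ≤ M ^ 8
      n-part = ≤-trans n≤M (≤-trans (≤-reflexive (sym (^-identityʳ M))) (^-monoʳ-≤ M (≤ᵇ⇒≤ 1 8 tt)))

-- The algorithm for given β, Δ and vertex set

module Instance (β : ℝ) (20<β : fromℕ 20 <ℝ β) (Δ L : ℕ) (β^L≃Δ : β ^ℝ L ≃ℝ fromℕ Δ) (3<L : 3 < L) (n : ℕ) where
  open Roots β 20<β

  1≤L : 1 ≤ L
  1≤L = ≤-trans (s≤s z≤n) 3<L

  open Radical Δ L β^L≃Δ 1≤L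
  open Roundings Δ L 1≤L 20^L≤Δ
  open Thresholds thresholds

  b : ℕ
  b = suc (F 1)

  b≤Δ : b ≤ Δ
  b≤Δ = begin
    1 + F 1               ≤⟨ +-monoˡ-≤ (F 1) 1≤F₁ ⟩
    F 1 + F 1             ≤⟨ +-monoʳ-≤ (F 1) (m≤m+n (F 1) _) ⟩
    20 * F 1              ≤⟨ F-ratio 1 ⟩
    F 2                   ≤⟨ F-bound 2 (≤-trans (s≤s (s≤s z≤n)) 3<L) ⟩
    Δ                     ∎
    where
    open ≤-Reasoning
    1≤F₁ : 1 ≤ F 1
    1≤F₁ = ≤-trans F-zero (≤-trans (m≤m+n (F 0) _) (F-ratio 0))

  b≤bound : b ≤ suc (proj₁ natural-bound)
  b≤bound = s≤s (≮⇒≥ λ lt → <⇒≱ (^-monoˡ-< L {{>-nonZero 1≤L}} lt)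
    (≤-trans (subst (F 1 ^ L ≤_) (*-identityʳ Δ) (F-≤ 1)) (Δ≤bound^L)))

  module Suffice = Words-suffice n Δ L b 20^L≤Δ 3<L b≤Δ
  open Suffice using (room; sucM<B)

  layout : Layout n Δ L Suffice.B
  layout = record { 10≤B = Suffice.10≤B ; M<B = Suffice.M<B ; n<M = Suffice.n<M ; L<M = Suffice.L<M }

  open Updating {n} thresholds layout
  open Potential thresholds w using (c; α; Φ-empty)

  initial-store : Store
  initial-store 0 0 = n
  initial-store 0 1 = Δ
  initial-store 0 2 = L
  initial-store 0 (suc (suc (suc _))) = 0
  initial-store 1 k = if k ≤ᵇ L then F k else 0
  initial-store 2 k = if k ≤ᵇ L then C k else 0
  initial-store 3 _ = 0
  initial-store 4 _ = 4
  initial-store (suc (suc (suc (suc (suc _))))) _ = 0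

  upto : ∀ {k} (f : ℕ → ℕ) → k ≤ L → (if k ≤ᵇ L then f k else 0) ≡ f k
  upto f k≤L rewrite ≤ᵇ⁺ k≤L = refl

  beyond : ∀ {k} (f : ℕ → ℕ) → L < k → (if k ≤ᵇ L then f k else 0) ≡ 0
  beyond f L<k rewrite ≤ᵇ-false L<k = refl

  initially : Initial β Δ L n initial-store
  initially = record
    { size = refl ; bound = refl ; top = refl
    ; floor = λ k k≤L → subst (λ f → fromℕ f ≤ℝ β ^ℝ k × β ^ℝ k <ℝ fromℕ (suc f)) (sym (upto F k≤L))
        (below-ℝ k {F k} (F-≤ k) , strictly-above-ℝ k {suc (F k)} (s≤s z≤n) (F-< k))
    ; ceiling = λ k k≤L → subst (λ f → β ^ℝ k ≤ℝ fromℕ f × fromℕ (pred f) <ℝ β ^ℝ k) (sym (upto C k≤L))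
        (above-ℝ k {C k} (C-≥ k) , strictly-below-ℝ k {pred (C k)} (C-> k))
    ; initial = λ _ → refl
    ; params₀ = λ { (suc (suc (suc _))) _ → refl ; 1 (s≤s ()) ; 2 (s≤s (s≤s ())) }
    ; floors₀ = λ k → beyond F
    ; ceil₀ = λ k → beyond C
    ; args₀ = λ _ → refl
    ; rest₀ = λ { (suc (suc (suc (suc (suc _))))) _ _ → refl ; 1 _ (s≤s ()) ; 2 _ (s≤s (s≤s ()))
              ; 3 _ (s≤s (s≤s (s≤s ()))) ; 4 _ (s≤s (s≤s (s≤s (s≤s ())))) }
    }

  initial-rest : Rest (λ _ _ → false) 0 initial-store
  initial-rest = record
    { lev = λ _ → 4
    ; ranged = record { 4≤ = λ _ → ≤-refl ; ≤L = λ _ → 3<L }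
    ; mem = record
      { core = record
        { small = small₀ ; order = refl ; maxdeg = refl
        ; floors≡ = λ k → upto F ; ceiling≡ = λ k → upto C }
      ; level = λ _ → refl
      ; buckets = record
        { bounded = λ _ _ → z≤n
        ; into = λ { _ _ refl () }
        ; from = λ _ _ _ ()
        }
      ; stack = refl , tt
      }
    ; clean = λ x → λ
      { (inj₁ lt) → <⇒≱ lt (≤-trans (≤-reflexive (sum-zero {n} λ _ → refl)) z≤n)
      ; (inj₂ (le , _)) → <-irrefl refl le }
    ; credit = sym Φ-empty
    }
    where
    ≤M : ∀ {x} → x ≤ Δ → suc x < Suffice.B
    ≤M x≤Δ = ≤-<-trans (s≤s (≤-trans x≤Δ Suffice.Δ≤M)) sucM<B
    0<B : 0 < Suffice.B
    0<B = ≤-trans (s≤s z≤n) 10≤B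
    cut : ∀ {k} (f : ℕ → ℕ) → (k ≤ L → f k < Suffice.B) → Dec (k ≤ L) → (if k ≤ᵇ L then f k else 0) < Suffice.B
    cut f f<B (yes k≤L) = subst (_< Suffice.B) (sym (upto f k≤L)) (f<B k≤L)
    cut f f<B (no k≰L)  = subst (_< Suffice.B) (sym (beyond f (≰⇒> k≰L))) 0<B
    small₀ : Small initial-store
    small₀ 0 0 = <-trans n<M M<B
    small₀ 0 1 = ≤-<-trans Suffice.Δ≤M M<B
    small₀ 0 2 = <-trans L<M M<B
    small₀ 0 (suc (suc (suc _))) = 0<B
    small₀ 1 k = cut F (λ k≤L → <-trans (n<1+n (F k)) (≤M (F-bound k k≤L))) (k ≤? L)
    small₀ 2 k = cut C (λ k≤L → ≤-<-trans (C-upper k) (≤M (F-bound k k≤L))) (k ≤? L)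
    small₀ 3 _ = 0<B
    small₀ 4 _ = ≤-trans (s≤s (s≤s (s≤s (s≤s (s≤s z≤n))))) 10≤B
    small₀ (suc (suc (suc (suc (suc _))))) _ = 0<B

  unit : ℕ
  unit = updateBase + (c * (L + L) + α * 2)

  α≡ : α ≡ αOf b
  α≡ = refl

  c≡ : c ≡ cOf b
  c≡ = refl

  enough : limit + n + n < Suffice.B
  enough = room {c} {α} c≡ α≡

  Processed : List (Update n) → Set
  Processed es = ∃ λ s → ∃ λ T → ∃ λ m → Run algorithm W initial-store es s T × T + m ≤ length es * unit ×
                 Rest (graph es) m s × Simple (graph es)

  process : ∀ es → Legal Δ es → Processed es
  process [] _ = initial-store , 0 , 0 , [] , z≤n , initial-rest ,
    record { symmetric = λ _ _ → refl ; irreflexive = λ _ → refl }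
  process (e ∷ es) (legal , adm , bounded) =
    let (s , T , m , run , T+m≤ , rest , simple) = process es legal
        (s' , t , m' , ex , t+m'≤ , rest') = handle enough simple e adm bounded rest in
    s' , T + t , m' , step run ex , spend {T} {m} {t} {m'} T+m≤ t+m'≤ , rest' , simple-apply simple e adm
    where
    spend : ∀ {T m t m' l u} → T + m ≤ l → t + m' ≤ m + u → T + t + m' ≤ u + l
    spend {T} {m} {t} {m'} {l} {u} p q = begin
      T + t + m'       ≡⟨ +-assoc T t m' ⟩
      T + (t + m')     ≤⟨ +-monoʳ-≤ T q ⟩
      T + (m + u)      ≡⟨ sym (+-assoc T m u) ⟩
      T + m + u        ≤⟨ +-monoˡ-≤ u p ⟩
      l + u            ≡⟨ +-comm l u ⟩
      u + l            ∎
      where open ≤-Reasoning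

  -- 2^L ≤ 20^L ≤ Δ, so a cost proportional to `L` is logarithmic in Δ.
  L≤log : L ≤ ⌊log₂ Δ ⌋
  L≤log = subst (_≤ ⌊log₂ Δ ⌋) (⌊log₂[2^n]⌋≡n L)
    (⌊log₂⌋-mono-≤ (≤-trans (^-monoˡ-≤ L (s≤s (s≤s z≤n))) 20^L≤Δ))

  unit≤ : unit ≤ rate (suc (proj₁ natural-bound)) * ⌊log₂ Δ ⌋
  unit≤ = begin
    unit                                            ≡⟨ cong₂ (λ c α → updateBase + (c * (L + L) + α * 2)) c≡ α≡ ⟩
    updateBase + (cOf b * (L + L) + αOf b * 2)      ≤⟨ spread updateBase (cOf b) (αOf b * 2) L 1≤L ⟩
    rate b * L                                      ≤⟨ *-mono-≤ (rate-mono b≤bound) L≤log ⟩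
    rate (suc (proj₁ natural-bound)) * ⌊log₂ Δ ⌋    ∎
    where
    open ≤-Reasoning
    spread : ∀ u c a L → 1 ≤ L → u + (c * (L + L) + a) ≤ (u + c * 2 + a) * L
    spread u c a L 1≤L = begin
      u + (c * (L + L) + a)           ≤⟨ +-mono-≤ (m≤m*n u L {{>-nonZero 1≤L}})
          (+-monoʳ-≤ (c * (L + L)) (m≤m*n a L {{>-nonZero 1≤L}})) ⟩
      u * L + (c * (L + L) + a * L)   ≡⟨ lem u c a L ⟩
      (u + c * 2 + a) * L             ∎
      where
      lem : ∀ u c a L → u * L + (c * (L + L) + a * L) ≡ (u + c * 2 + a) * L
      lem = solve-∀

  valid : ∀ {G m store} → Rest G m store → ValidLevels β L G (levelOf store)
  valid {G} {m} {store} rest = record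
    { range = λ v → subst (4 ≤_) (sym (level v)) (4≤ v) , subst (_≤ L) (sym (level v)) (≤L v)
    ; lower = λ v 4<ℓv → ≤ℝ-trans {β ^ℝ (levelOf store v ∸ 5)} {fromℕ (C (levelOf store v ∸ 5))}
        {fromℕ ∣ 𝒩 G (levelOf store) v 4 (levelOf store v ∸ 1) ∣}
        (above-ℝ (levelOf store v ∸ 5) {C (levelOf store v ∸ 5)} (C-≥ (levelOf store v ∸ 5)))
        (fromℕ-mono {C (levelOf store v ∸ 5)} {∣ 𝒩 G (levelOf store) v 4 (levelOf store v ∸ 1) ∣}
            (subst₂ _≤_ (cong (λ l → C (l ∸ 5)) (sym (level v)))
          (trans (cong (λ l → deg G lev v (l ∸ 1)) (sym (level v))) (sym (card-𝒩 v _)))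
          (≮⇒≥ λ lt → clean v (inj₂ (subst (4 <_) (level v) 4<ℓv , lt)))))
    ; upper = λ v → ≤ℝ-trans {fromℕ ∣ 𝒩 G (levelOf store) v 4 (levelOf store v) ∣} {fromℕ (F (levelOf store v))}
        {β ^ℝ levelOf store v}
        (fromℕ-mono {∣ 𝒩 G (levelOf store) v 4 (levelOf store v) ∣} {F (levelOf store v)}
            (subst₂ _≤_ (trans (cong (deg G lev v) (sym (level v))) (sym (card-𝒩 v _))) (cong F (sym (level v)))
          (≮⇒≥ λ lt → clean v (inj₁ lt))))
        (below-ℝ (levelOf store v) {F (levelOf store v)} (F-≤ (levelOf store v)))
    }
    where
    open Rest rest
    open Mem mem
    open Ranged ranged
    card-𝒩 : ∀ v j → ∣ 𝒩 G (levelOf store) v 4 j ∣ ≡ deg G lev v j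
    card-𝒩 v j = trans (card λ u → G u v ∧ (4 ≤ᵇ levelOf store u) ∧ (levelOf store u ≤ᵇ j))
      (sum-cong-≗ λ u → cong (λ z → bit (G u v ∧ z)) (trans (cong (λ l → (4 ≤ᵇ l) ∧ (l ≤ᵇ j)) (level u))
        (cong (_∧ (lev u ≤ᵇ j)) (≤ᵇ⁺ (4≤ u)))))

theorem2 : (β : ℝ) → fromℕ 20 <ℝ β →
    ∃[ A ] ∃[ K ] ∃[ C ]
    ((Δ L : ℕ) → β ^ℝ L ≃ℝ fromℕ Δ → 3 < L →
    (n : ℕ) →
    ∃[ s₀ ] (Initial β Δ L n s₀ ×
    ((es : List (Update n)) → Legal Δ es →
    ∃[ s ] ∃[ T ]
    (Run A ((n + Δ) ^ K) s₀ es s T ×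
    T ≤ (C * ⌊log₂ Δ ⌋) * length es ×
    ValidLevels β L (graph es) (levelOf s)))))
theorem2 β 20<β = algorithm , 9 * R , rate (suc (proj₁ (Roots.natural-bound β 20<β))) , λ Δ L β^L≃Δ 3<L n →
  let open Instance β 20<β Δ L β^L≃Δ 3<L n in
  initial-store , initially , λ es legal →
  let (s , T , m , run , T+m≤ , rest , _) = process es legal in
  s , T ,
  subst (λ W → Run algorithm W initial-store es s T) (^-*-assoc (n + Δ) 9 R) run ,
  ≤-trans (m+n≤o⇒m≤o T T+m≤) (≤-trans (≤-reflexive (*-comm (length es) unit)) (*-monoˡ-≤ (length es) unit≤)) ,
  valid rest
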